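{- The composite $\langle M\rangle\backslash\mathcal{F}\longleftrightarrow M\longrightarrow f_M$, in which an oriented çark with a base edge is identified with the corresponding hyperbolic element $M$ of $\mathrm{PSL}_2(\mathbf{Z})$, defines a surjection from the set of oriented çarks with a base edge (up to isomorphism) onto the set of primitive indefinite integral binary quadratic forms of non-square discriminant.
   Context: Let $S(z)=-1/z$ and $R(z)=(z-1)/z$, elements of orders $2$ and $3$ which generate $\mathrm{PSL}_2(\mathbf{Z})=\langle S\rangle*\langle R\rangle$. The bipartite Farey tree $\mathcal{F}$ is the bipartite graph with edge set $\{\{W\}: W\in\mathrm{PSL}_2(\mathbf{Z})\}$, $\otimes$-vertices $\{W,WS\}$ and $\bullet$-vertices $\{W,WR,WR^2\}$ ($W\in\mathrm{PSL}_2(\mathbf{Z})$); the edge $\{W\}$ joins $\{W,WS\}$ to $\{W,WR,WR^2\}$, and the edges at a $\bullet$-vertex are cyclically ordered as $(\{W\},\{WR\},\{WR^2\})$. $\mathrm{PSL}_2(\mathbf{Z})$ acts on $\mathcal{F}$ by left multiplication. A çark is a quotient ribbon graph $\langle M\rangle\backslash\mathcal{F}$ with $M\in\mathrm{PSL}_2(\mathbf{Z})$ hyperbolic ($|\mathrm{tr}\,M|>2$). Its unique circuit, the image of the axis of $M$ in $\mathcal{F}$, is its spine; a çark is oriented (directed) if an orientation of the spine is chosen. Hyperbolic elements $M$ correspond bijectively to isomorphism classes of oriented çarks with a base edge, by sending $M$ to $\langle M\rangle\backslash\mathcal{F}$ with base edge $\langle M\rangle\cdot\{I\}$ and the spine oriented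 in the direction in which $M$ translates its axis. A form $f=(A,B,C)$ means $f(x,y)=Ax^2+Bxy+Cy^2$ with $A,B,C\in\mathbf{Z}$; its discriminant is $\Delta(f)=B^2-4AC$; it is primitive if $\gcd(A,B,C)=1$ and indefinite if $\Delta(f)>0$. For a hyperbolic element $M=\begin{pmatrix}p&q\\ r&s\end{pmatrix}\in\mathrm{PSL}_2(\mathbf{Z})$ put $$f_M=\frac{\mathrm{sgn}(p+s)}{\gcd(q,s-p,r)}\,(r,\ s-p,\ -q).$$ -}

module Defs where

open import Level using (0ℓ)
open import Algebra.Bundles using (Group)
open import Data.Fin.Base using (Fin; toℕ; fromℕ<)
open import Data.Fin.Properties using (toℕ-fromℕ<)
open import Data.Integer.Base using (ℤ; +_; +0; +[1+_]; -[1+_]; 0ℤ; 1ℤ; -1ℤ; _+_; _*_; _-_; -_; ∣_∣; _<_; _/_; ≢-nonZero)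
import Data.Integer.Base as ℤ using (suc; pred)
open import Data.Integer.GCD using (gcd; gcd[i,j]≡0⇒i≡0; gcd[i,j]≡0⇒j≡0)
import Data.Integer.Properties as ℤ
open import Data.Integer.Tactic.RingSolver using (solve-∀)
import Data.Nat.Base as ℕ
open import Data.Nat.Base using (ℕ; zero; suc)
open import Data.Nat.DivMod using (_%_; m≡m%n+[m/n]*n; m%n<n)
open import Data.Nat.GeneralisedArithmetic using (iterate)
import Data.Nat.Properties as ℕ
open import Data.Product.Base using (Σ-syntax; ∃-syntax; _×_; _,_; proj₁; proj₂)
open import Function.Bundles using (Func; Inverse)
import Function.Construct.Composition as Compose
import Function.Construct.Identity as Identity
import Function.Construct.Symmetry as Symmetry
open import Relation.Binary.Bundles using (Setoid)
import Relation.Binary.Construct.On as On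
open import Relation.Binary.PropositionalEquality.Core using (_≡_; refl; sym; trans; cong; cong₂)
import Relation.Binary.PropositionalEquality.Properties as ≡ using (setoid)
open import Relation.Binary.Structures using (IsEquivalence)
open import Relation.Nullary.Negation.Core using (¬_)

------------------------------------------------------------------------
-- PSL₂(ℤ)

-- Without η, so that conversion checking does not expand products into entries.
record Matrix : Set where
  no-eta-equality
  pattern
  constructor ⟦_,_,_,_⟧
  field p q r s : ℤ

det : Matrix → ℤ
det ⟦ p , q , r , s ⟧ = p * s - q * r

_*ᴹ_ : Matrix → Matrix → Matrix
⟦ p , q , r , s ⟧ *ᴹ ⟦ p′ , q′ , r′ , s′ ⟧ =
  ⟦ p * p′ + q * r′ , p * q′ + q * s′ , r * p′ + s * r′ , r * q′ + s * s′ ⟧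

adjugate : Matrix → Matrix
adjugate ⟦ p , q , r , s ⟧ = ⟦ s , - q , - r , p ⟧

negate : Matrix → Matrix
negate ⟦ p , q , r , s ⟧ = ⟦ - p , - q , - r , - s ⟧

record SL₂ℤ : Set where
  no-eta-equality
  pattern
  constructor _,det=1:_
  field
    matrix : Matrix
    det≡1  : det matrix ≡ 1ℤ
  open Matrix matrix public

open SL₂ℤ using (matrix; det≡1)

-- PSL₂(ℤ) has SL₂(ℤ) as carrier and equality up to sign.
infix 4 _≃_
data _≃_ (X Y : SL₂ℤ) : Set where
  same     : matrix X ≡ matrix Y → X ≃ Y
  opposite : matrix X ≡ negate (matrix Y) → X ≃ Y

private
  matrix-≡ : ∀ {p q r s p′ q′ r′ s′} → p ≡ p′ → q ≡ q′ → r ≡ r′ → s ≡ s′ →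
             ⟦ p , q , r , s ⟧ ≡ ⟦ p′ , q′ , r′ , s′ ⟧
  matrix-≡ refl refl refl refl = refl

  negate-involutive : ∀ A → negate (negate A) ≡ A
  negate-involutive ⟦ p , q , r , s ⟧ =
    matrix-≡ (ℤ.neg-involutive p) (ℤ.neg-involutive q) (ℤ.neg-involutive r) (ℤ.neg-involutive s)

  negate-*ᴹˡ : ∀ A B → negate A *ᴹ B ≡ negate (A *ᴹ B)
  negate-*ᴹˡ ⟦ p , q , r , s ⟧ ⟦ p′ , q′ , r′ , s′ ⟧ =
    matrix-≡ (e p p′ q r′) (e p q′ q s′) (e r p′ s r′) (e r q′ s s′)
    where
    e : ∀ a b c d → - a * b + - c * d ≡ - (a * b + c * d)
    e = solve-∀

  negate-*ᴹʳ : ∀ A B → A *ᴹ negate B ≡ negate (A *ᴹ B)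
  negate-*ᴹʳ ⟦ p , q , r , s ⟧ ⟦ p′ , q′ , r′ , s′ ⟧ =
    matrix-≡ (e p p′ q r′) (e p q′ q s′) (e r p′ s r′) (e r q′ s s′)
    where
    e : ∀ a b c d → a * - b + c * - d ≡ - (a * b + c * d)
    e = solve-∀

  *ᴹ-assoc : ∀ A B C → (A *ᴹ B) *ᴹ C ≡ A *ᴹ (B *ᴹ C)
  *ᴹ-assoc ⟦ p , q , r , s ⟧ ⟦ p′ , q′ , r′ , s′ ⟧ ⟦ p″ , q″ , r″ , s″ ⟧ =
    matrix-≡ (e p q p′ q′ r′ s′ p″ r″) (e p q p′ q′ r′ s′ q″ s″)
             (e r s p′ q′ r′ s′ p″ r″) (e r s p′ q′ r′ s′ q″ s″)
    where
    e : ∀ x y a b c d z w →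
        (x * a + y * c) * z + (x * b + y * d) * w ≡ x * (a * z + b * w) + y * (c * z + d * w)
    e = solve-∀

  det-*ᴹ : ∀ A B → det (A *ᴹ B) ≡ det A * det B
  det-*ᴹ ⟦ p , q , r , s ⟧ ⟦ p′ , q′ , r′ , s′ ⟧ = e p q r s p′ q′ r′ s′
    where
    e : ∀ p q r s p′ q′ r′ s′ →
        (p * p′ + q * r′) * (r * q′ + s * s′) - (p * q′ + q * s′) * (r * p′ + s * r′)
        ≡ (p * s - q * r) * (p′ * s′ - q′ * r′)
    e = solve-∀

  det-adjugate : ∀ A → det (adjugate A) ≡ det A
  det-adjugate ⟦ p , q , r , s ⟧ = e p q r s
    where
    e : ∀ p q r s → s * p - (- q) * (- r) ≡ p * s - q * r
    e = solve-∀

  adjugate-negate : ∀ A → adjugate (negate A) ≡ negate (adjugate A)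
  adjugate-negate ⟦ _ , _ , _ , _ ⟧ = refl

  identity : Matrix
  identity = ⟦ 1ℤ , 0ℤ , 0ℤ , 1ℤ ⟧

  *ᴹ-identityˡ : ∀ A → identity *ᴹ A ≡ A
  *ᴹ-identityˡ ⟦ p , q , r , s ⟧ = matrix-≡ (e p r) (e q s) (e′ p r) (e′ q s)
    where
    e : ∀ x y → 1ℤ * x + 0ℤ * y ≡ x
    e = solve-∀
    e′ : ∀ x y → 0ℤ * x + 1ℤ * y ≡ y
    e′ = solve-∀

  *ᴹ-identityʳ : ∀ A → A *ᴹ identity ≡ A
  *ᴹ-identityʳ ⟦ p , q , r , s ⟧ = matrix-≡ (e p q) (e′ p q) (e r s) (e′ r s)
    where
    e : ∀ x y → x * 1ℤ + y * 0ℤ ≡ x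
    e = solve-∀
    e′ : ∀ x y → x * 0ℤ + y * 1ℤ ≡ y
    e′ = solve-∀

  *ᴹ-inverseˡ : ∀ A → det A ≡ 1ℤ → adjugate A *ᴹ A ≡ identity
  *ᴹ-inverseˡ ⟦ p , q , r , s ⟧ d =
    matrix-≡ (trans (e₁ p q r s) d) (e₂ q s) (e₃ p r) (trans (e₄ p q r s) d)
    where
    e₁ : ∀ p q r s → s * p + - q * r ≡ p * s - q * r
    e₁ = solve-∀
    e₂ : ∀ q s → s * q + - q * s ≡ 0ℤ
    e₂ = solve-∀
    e₃ : ∀ p r → - r * p + p * r ≡ 0ℤ
    e₃ = solve-∀
    e₄ : ∀ p q r s → - r * q + p * s ≡ p * s - q * r
    e₄ = solve-∀

  *ᴹ-inverseʳ : ∀ A → det A ≡ 1ℤ → A *ᴹ adjugate A ≡ identity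
  *ᴹ-inverseʳ ⟦ p , q , r , s ⟧ d =
    matrix-≡ (trans (e₁ p q r s) d) (e₂ p q) (e₃ r s) (trans (e₄ p q r s) d)
    where
    e₁ : ∀ p q r s → p * s + q * - r ≡ p * s - q * r
    e₁ = solve-∀
    e₂ : ∀ p q → p * - q + q * p ≡ 0ℤ
    e₂ = solve-∀
    e₃ : ∀ r s → r * s + s * - r ≡ 0ℤ
    e₃ = solve-∀
    e₄ : ∀ p q r s → r * - q + s * p ≡ p * s - q * r
    e₄ = solve-∀

  ≃-isEquivalence : IsEquivalence _≃_
  ≃-isEquivalence = record { refl = same refl ; sym = ≃-sym ; trans = ≃-trans }
    where
    flip-negate : ∀ {A B} → A ≡ negate B → B ≡ negate A
    flip-negate {B = B} refl = sym (negate-involutive B)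
    ≃-sym : ∀ {X Y} → X ≃ Y → Y ≃ X
    ≃-sym (same e)     = same (sym e)
    ≃-sym (opposite e) = opposite (flip-negate e)
    ≃-trans : ∀ {X Y Z} → X ≃ Y → Y ≃ Z → X ≃ Z
    ≃-trans (same e)     (same f)     = same (trans e f)
    ≃-trans (same e)     (opposite f) = opposite (trans e f)
    ≃-trans (opposite e) (same f)     = opposite (trans e (cong negate f))
    ≃-trans (opposite e) (opposite f) = same (trans e (sym (flip-negate f)))

_·_ : SL₂ℤ → SL₂ℤ → SL₂ℤ
(A ,det=1: d) · (B ,det=1: e) = (A *ᴹ B) ,det=1: trans (det-*ᴹ A B) (cong₂ _*_ d e)

one : SL₂ℤ
one = identity ,det=1: refl

inverse : SL₂ℤ → SL₂ℤ
inverse (A ,det=1: d) = adjugate A ,det=1: trans (det-adjugate A) d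

private
  ·-cong : ∀ {X Y U V} → X ≃ Y → U ≃ V → (X · U) ≃ (Y · V)
  ·-cong {_ ,det=1: _} {_ ,det=1: _} {_ ,det=1: _} {_ ,det=1: _} (same e) (same f) =
    same (cong₂ _*ᴹ_ e f)
  ·-cong {_ ,det=1: _} {B ,det=1: _} {_ ,det=1: _} {D ,det=1: _} (same e) (opposite f) =
    opposite (trans (cong₂ _*ᴹ_ e f) (negate-*ᴹʳ B D))
  ·-cong {_ ,det=1: _} {B ,det=1: _} {_ ,det=1: _} {D ,det=1: _} (opposite e) (same f) =
    opposite (trans (cong₂ _*ᴹ_ e f) (negate-*ᴹˡ B D))
  ·-cong {_ ,det=1: _} {B ,det=1: _} {_ ,det=1: _} {D ,det=1: _} (opposite e) (opposite f) =
    same (trans (cong₂ _*ᴹ_ e f)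
         (trans (negate-*ᴹˡ B (negate D))
         (trans (cong negate (negate-*ᴹʳ B D)) (negate-involutive _))))

  inverse-cong : ∀ {X Y} → X ≃ Y → inverse X ≃ inverse Y
  inverse-cong {_ ,det=1: _} {_ ,det=1: _} (same e)     = same (cong adjugate e)
  inverse-cong {_ ,det=1: _} {B ,det=1: _} (opposite e) = opposite (trans (cong adjugate e) (adjugate-negate B))

  ·-assoc : ∀ X Y Z → ((X · Y) · Z) ≃ (X · (Y · Z))
  ·-assoc (A ,det=1: _) (B ,det=1: _) (C ,det=1: _) = same (*ᴹ-assoc A B C)

  ·-identityˡ : ∀ X → (one · X) ≃ X
  ·-identityˡ (A ,det=1: _) = same (*ᴹ-identityˡ A)

  ·-identityʳ : ∀ X → (X · one) ≃ X
  ·-identityʳ (A ,det=1: _) = same (*ᴹ-identityʳ A)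

  ·-inverseˡ : ∀ X → (inverse X · X) ≃ one
  ·-inverseˡ (A ,det=1: d) = same (*ᴹ-inverseˡ A d)

  ·-inverseʳ : ∀ X → (X · inverse X) ≃ one
  ·-inverseʳ (A ,det=1: d) = same (*ᴹ-inverseʳ A d)

PSL₂ℤ : Group 0ℓ 0ℓ
PSL₂ℤ = record
  { Carrier = SL₂ℤ
  ; _≈_     = _≃_
  ; _∙_     = _·_
  ; ε       = one
  ; _⁻¹     = inverse
  ; isGroup = record
    { isMonoid = record
      { isSemigroup = record
        { isMagma = record { isEquivalence = ≃-isEquivalence ; ∙-cong = ·-cong }
        ; assoc   = ·-assoc
        }
      ; identity = ·-identityˡ , ·-identityʳ
      }
    ; inverse = ·-inverseˡ , ·-inverseʳ
    ; ⁻¹-cong = inverse-cong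
    }
  }

open Group PSL₂ℤ using (_≈_; _∙_; ε; _⁻¹; ∙-cong; ∙-congˡ; ∙-congʳ; assoc; identityˡ; identityʳ; inverseˡ; inverseʳ)
private
  module PSL = Group PSL₂ℤ

open import Algebra.Properties.Monoid.Mult PSL.monoid using (×-homo-+; ×-congˡ; ×-congʳ; ×-assocˡ) renaming (_×_ to _times_)
open import Relation.Binary.Reasoning.Setoid PSL.setoid

infixr 8 _^ℕ_ _^_

_^ℕ_ : SL₂ℤ → ℕ → SL₂ℤ
X ^ℕ n = n times X

_^_ : SL₂ℤ → ℤ → SL₂ℤ
X ^ (+ n)    = X ^ℕ n
X ^ -[1+ n ] = (X ⁻¹) ^ℕ suc n

S : SL₂ℤ
S = ⟦ 0ℤ , -1ℤ , 1ℤ , 0ℤ ⟧ ,det=1: refl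

R : SL₂ℤ
R = ⟦ 1ℤ , -1ℤ , 1ℤ , 0ℤ ⟧ ,det=1: refl

S²≈ε : S ^ℕ 2 ≈ ε
S²≈ε = opposite refl

R³≈ε : R ^ℕ 3 ≈ ε
R³≈ε = opposite refl

private
  ^-suc : ∀ X i → X ^ (ℤ.suc i) ≈ X ∙ X ^ i
  ^-suc X (+ n)        = PSL.refl
  ^-suc X -[1+ zero  ] = PSL.sym (PSL.trans (∙-congˡ (identityʳ _)) (inverseʳ X))
  ^-suc X -[1+ suc n ] = begin
    (X ⁻¹) ^ℕ suc n                      ≈⟨ identityˡ _ ⟨
    ε ∙ (X ⁻¹) ^ℕ suc n                  ≈⟨ ∙-congʳ (inverseʳ X) ⟨
    (X ∙ X ⁻¹) ∙ (X ⁻¹) ^ℕ suc n         ≈⟨ assoc X (X ⁻¹) _ ⟩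
    X ∙ (X ⁻¹ ∙ (X ⁻¹) ^ℕ suc n)         ∎

  ^-pred : ∀ X i → X ^ (ℤ.pred i) ≈ X ⁻¹ ∙ X ^ i
  ^-pred X i = begin
    X ^ ℤ.pred i                       ≈⟨ identityˡ _ ⟨
    ε ∙ X ^ ℤ.pred i                   ≈⟨ ∙-congʳ (inverseˡ X) ⟨
    (X ⁻¹ ∙ X) ∙ X ^ ℤ.pred i          ≈⟨ assoc (X ⁻¹) X _ ⟩
    X ⁻¹ ∙ (X ∙ X ^ ℤ.pred i)          ≈⟨ ∙-congˡ (^-suc X (ℤ.pred i)) ⟨
    X ⁻¹ ∙ X ^ ℤ.suc (ℤ.pred i)        ≡⟨ cong (λ j → X ⁻¹ ∙ X ^ j) (ℤ.suc-pred i) ⟩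
    X ⁻¹ ∙ X ^ i                       ∎

^-homo-+ : ∀ X i j → X ^ (i + j) ≈ X ^ i ∙ X ^ j
^-homo-+ X +0 j = begin
  X ^ (0ℤ + j)  ≡⟨ cong (X ^_) (ℤ.+-identityˡ j) ⟩
  X ^ j         ≈⟨ identityˡ _ ⟨
  ε ∙ X ^ j     ∎
^-homo-+ X +[1+ n ] j = begin
  X ^ (+[1+ n ] + j)         ≡⟨ cong (X ^_) (ℤ.+-assoc 1ℤ (+ n) j) ⟩
  X ^ ℤ.suc (+ n + j)        ≈⟨ ^-suc X (+ n + j) ⟩
  X ∙ X ^ (+ n + j)          ≈⟨ ∙-congˡ (^-homo-+ X (+ n) j) ⟩
  X ∙ (X ^ (+ n) ∙ X ^ j)    ≈⟨ assoc X _ _ ⟨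
  (X ∙ X ^ (+ n)) ∙ X ^ j    ∎
^-homo-+ X -[1+ zero ] j = begin
  X ^ ℤ.pred j               ≈⟨ ^-pred X j ⟩
  X ⁻¹ ∙ X ^ j               ≈⟨ ∙-congʳ (identityʳ (X ⁻¹)) ⟨
  (X ⁻¹ ∙ ε) ∙ X ^ j         ∎
^-homo-+ X -[1+ suc n ] j = begin
  X ^ (-[1+ suc n ] + j)             ≡⟨ cong (X ^_) (ℤ.+-assoc -1ℤ -[1+ n ] j) ⟩
  X ^ ℤ.pred (-[1+ n ] + j)          ≈⟨ ^-pred X (-[1+ n ] + j) ⟩
  X ⁻¹ ∙ X ^ (-[1+ n ] + j)          ≈⟨ ∙-congˡ (^-homo-+ X -[1+ n ] j) ⟩
  X ⁻¹ ∙ (X ^ -[1+ n ] ∙ X ^ j)      ≈⟨ assoc (X ⁻¹) _ _ ⟨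
  (X ⁻¹ ∙ X ^ -[1+ n ]) ∙ X ^ j      ∎

------------------------------------------------------------------------
-- Bipartite ribbon graphs

-- The vertices of one colour, each with a cyclic order on the edges at it.
-- By `cyclic` the edges at a vertex form a single orbit of `next`, so that
-- `next` permutes them cyclically.
record Vertices (E : Setoid 0ℓ 0ℓ) : Set₁ where
  field
    Vertex : Setoid 0ℓ 0ℓ
    end    : Func E Vertex
    next   : Func E E
  module Vertex = Setoid Vertex
  field
    end-next : ∀ e → Func.to end (Func.to next e) Vertex.≈ Func.to end e
    cyclic   : ∀ e e′ → Func.to end e Vertex.≈ Func.to end e′ →
               ∃[ n ] Setoid._≈_ E (iterate (Func.to next) e n) e′

record RibbonGraph : Set₁ where
  field
    Edge : Setoid 0ℓ 0ℓ
    ⊗v   : Vertices Edge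
    •v   : Vertices Edge
  module Edge = Setoid Edge
  module ⊗ = Vertices ⊗v
  module • = Vertices •v

record VerticesIso {E E′ : Setoid 0ℓ 0ℓ} (φ : Inverse E E′)
                   (V : Vertices E) (V′ : Vertices E′) : Set where
  private
    module V  = Vertices V
    module V′ = Vertices V′
  field
    vertices  : Inverse V.Vertex V′.Vertex
    incidence : ∀ e → Inverse.to vertices (Func.to V.end e) V′.Vertex.≈ Func.to V′.end (Inverse.to φ e)
    rotation  : ∀ e → Setoid._≈_ E′ (Inverse.to φ (Func.to V.next e)) (Func.to V′.next (Inverse.to φ e))

record _≅ᴿ_ (G H : RibbonGraph) : Set where
  private
    module G = RibbonGraph G
    module H = RibbonGraph H
  field
    edges : Inverse G.Edge H.Edge
    ⊗-iso : VerticesIso edges G.⊗v H.⊗v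
    •-iso : VerticesIso edges G.•v H.•v
  open Inverse edges public using (to; from)

-- Bi-infinite walks: `before i` and `after i` are the edges by which the walk
-- enters and leaves its i-th ⊗-vertex.
record Walk (G : RibbonGraph) : Set where
  open RibbonGraph G
  field
    before after : ℤ → Edge.Carrier
    at-⊗ : ∀ i → Func.to ⊗.end (before i) ⊗.Vertex.≈ Func.to ⊗.end (after i)
    at-• : ∀ i → Func.to •.end (after i) •.Vertex.≈ Func.to •.end (before (ℤ.suc i))

record NonBacktracking {G : RibbonGraph} (w : Walk G) : Set where
  open RibbonGraph G
  open Walk w
  field
    turns-⊗ : ∀ i → ¬ (before i Edge.≈ after i)
    turns-• : ∀ i → ¬ (after i Edge.≈ before (ℤ.suc i))

-- φ carries w to w′ up to a shift of the parametrization.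
Carries : ∀ {G H} → G ≅ᴿ H → Walk G → Walk H → Set
Carries {H = H} φ w w′ =
  ∃[ j ] ∀ i → (to (before w i) Edge.≈ before w′ (i + j)) × (to (after w i) Edge.≈ after w′ (i + j))
  where
  open RibbonGraph H
  open _≅ᴿ_ φ
  open Walk

------------------------------------------------------------------------
-- The bipartite Farey tree and its quotients

private
  ε^ : ∀ m → ε ^ℕ m ≈ ε
  ε^ zero    = PSL.refl
  ε^ (suc m) = PSL.trans (identityˡ _) (ε^ m)

  ^ℕ-% : ∀ {T} n .{{_ : ℕ.NonZero n}} → T ^ℕ n ≈ ε → ∀ k → T ^ℕ (k % n) ≈ T ^ℕ k
  ^ℕ-% {T} n Tⁿ≈ε k = begin
    T ^ℕ (k % n)                                  ≈⟨ identityʳ _ ⟨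
    T ^ℕ (k % n) ∙ ε                              ≈⟨ ∙-congˡ (ε^ (k ℕ./ n)) ⟨
    T ^ℕ (k % n) ∙ ε ^ℕ (k ℕ./ n)                 ≈⟨ ∙-congˡ (×-congʳ (k ℕ./ n) Tⁿ≈ε) ⟨
    T ^ℕ (k % n) ∙ (T ^ℕ n) ^ℕ (k ℕ./ n)          ≈⟨ ∙-congˡ (×-assocˡ T (k ℕ./ n) n) ⟩
    T ^ℕ (k % n) ∙ T ^ℕ (k ℕ./ n ℕ.* n)           ≈⟨ ×-homo-+ T (k % n) (k ℕ./ n ℕ.* n) ⟨
    T ^ℕ (k % n ℕ.+ k ℕ./ n ℕ.* n)                ≡⟨ cong (T ^ℕ_) (m≡m%n+[m/n]*n k n) ⟨
    T ^ℕ k                                        ∎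

record LeftInvariantEquivalence : Set₁ where
  infix 4 _~_
  field
    _~_           : SL₂ℤ → SL₂ℤ → Set
    isEquivalence : IsEquivalence _~_
    reflexive     : ∀ {X Y} → X ≈ Y → X ~ Y
    invariant     : ∀ Z {X Y} → X ~ Y → Z ∙ X ~ Z ∙ Y
  setoid : Setoid 0ℓ 0ℓ
  setoid = record { isEquivalence = isEquivalence }

singletons : LeftInvariantEquivalence
singletons = record
  { _~_ = _≈_ ; isEquivalence = PSL.isEquivalence ; reflexive = λ e → e ; invariant = λ _ → ∙-congˡ }

-- X and Y represent the same set {W, WT, …, WTⁿ⁻¹}.
cosets : ∀ T n .{{_ : ℕ.NonZero n}} → T ^ℕ n ≈ ε → LeftInvariantEquivalence
cosets T n Tⁿ≈ε = record
  { _~_           = λ X Y → Σ[ i ∈ Fin n ] X ∙ T ^ℕ toℕ i ≈ Y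
  ; isEquivalence = record { refl = reflexive PSL.refl ; sym = ~-sym ; trans = ~-trans }
  ; reflexive     = reflexive
  ; invariant     = λ Z (i , e) → i , PSL.trans (assoc Z _ _) (∙-congˡ e)
  }
  where
  reduce : ∀ {X Y} k → X ∙ T ^ℕ k ≈ Y → Σ[ i ∈ Fin n ] X ∙ T ^ℕ toℕ i ≈ Y
  reduce {X} {Y} k e = fromℕ< (m%n<n k n) , (begin
    X ∙ T ^ℕ toℕ (fromℕ< (m%n<n k n))  ≡⟨ cong (λ j → X ∙ T ^ℕ j) (toℕ-fromℕ< (m%n<n k n)) ⟩
    X ∙ T ^ℕ (k % n)                   ≈⟨ ∙-congˡ (^ℕ-% n Tⁿ≈ε k) ⟩
    X ∙ T ^ℕ k                         ≈⟨ e ⟩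
    Y                                  ∎)

  reflexive : ∀ {X Y} → X ≈ Y → Σ[ i ∈ Fin n ] X ∙ T ^ℕ toℕ i ≈ Y
  reflexive e = reduce 0 (PSL.trans (identityʳ _) e)

  ~-trans : ∀ {X Y Z} → Σ[ i ∈ Fin n ] X ∙ T ^ℕ toℕ i ≈ Y → Σ[ i ∈ Fin n ] Y ∙ T ^ℕ toℕ i ≈ Z →
            Σ[ i ∈ Fin n ] X ∙ T ^ℕ toℕ i ≈ Z
  ~-trans {X} {Y} {Z} (i , e) (j , f) = reduce (toℕ i ℕ.+ toℕ j) (begin
    X ∙ T ^ℕ (toℕ i ℕ.+ toℕ j)          ≈⟨ ∙-congˡ (×-homo-+ T (toℕ i) (toℕ j)) ⟩
    X ∙ (T ^ℕ toℕ i ∙ T ^ℕ toℕ j)       ≈⟨ assoc X _ _ ⟨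
    (X ∙ T ^ℕ toℕ i) ∙ T ^ℕ toℕ j       ≈⟨ ∙-congʳ e ⟩
    Y ∙ T ^ℕ toℕ j                      ≈⟨ f ⟩
    Z                                   ∎)

  ~-sym : ∀ {X Y} → Σ[ i ∈ Fin n ] X ∙ T ^ℕ toℕ i ≈ Y → Σ[ i ∈ Fin n ] Y ∙ T ^ℕ toℕ i ≈ X
  ~-sym {X} {Y} (i , e) = reduce k (begin
    Y ∙ T ^ℕ k                          ≈⟨ ∙-congʳ e ⟨
    (X ∙ T ^ℕ toℕ i) ∙ T ^ℕ k           ≈⟨ assoc X _ _ ⟩
    X ∙ (T ^ℕ toℕ i ∙ T ^ℕ k)           ≈⟨ ∙-congˡ (×-homo-+ T (toℕ i) k) ⟨
    X ∙ T ^ℕ (toℕ i ℕ.+ k)              ≡⟨ cong (λ m → X ∙ T ^ℕ m) (ℕ.m+[n∸m]≡n (i≤i*n (toℕ i))) ⟩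
    X ∙ T ^ℕ (toℕ i ℕ.* n)              ≈⟨ ∙-congˡ (×-assocˡ T (toℕ i) n) ⟨
    X ∙ (T ^ℕ n) ^ℕ toℕ i               ≈⟨ ∙-congˡ (×-congʳ (toℕ i) Tⁿ≈ε) ⟩
    X ∙ ε ^ℕ toℕ i                      ≈⟨ ∙-congˡ (ε^ (toℕ i)) ⟩
    X ∙ ε                               ≈⟨ identityʳ X ⟩
    X                                   ∎)
    where
    k : ℕ
    k = toℕ i ℕ.* n ℕ.∸ toℕ i
    i≤i*n : ∀ m → m ℕ.≤ m ℕ.* n
    i≤i*n m = ℕ.m≤m*n m n

-- The quotient by the left action of ⟨M⟩.
⟨_⟩＼_ : SL₂ℤ → LeftInvariantEquivalence → Setoid 0ℓ 0ℓ
⟨ M ⟩＼ L = record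
  { Carrier       = SL₂ℤ
  ; _≈_           = λ X Y → ∃[ k ] M ^ k ∙ X ~ Y
  ; isEquivalence = record
    { refl  = 0ℤ , reflexive (identityˡ _)
    ; sym   = λ {X} {Y} (k , e) → - k ,
                L.trans (invariant (M ^ (- k)) (L.sym e))
                (reflexive (PSL.trans (join (- k) k X)
                           (PSL.trans (∙-congʳ (PSL.reflexive (cong (M ^_) (ℤ.+-inverseˡ k)))) (identityˡ X))))
    ; trans = λ {X} (k , e) (l , f) → l + k ,
                L.trans (reflexive (PSL.sym (join l k X))) (L.trans (invariant (M ^ l) e) f)
    }
  }
  where
  open LeftInvariantEquivalence L
  module L = IsEquivalence isEquivalence
  join : ∀ k l X → M ^ k ∙ (M ^ l ∙ X) ≈ M ^ (k + l) ∙ X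
  join k l X = PSL.trans (PSL.sym (assoc _ _ X)) (∙-congʳ (PSL.sym (^-homo-+ M k l)))

private
  iterate-∙ : ∀ T X n → iterate (_∙ T) X n ≈ X ∙ T ^ℕ n
  iterate-∙ T X zero    = PSL.sym (identityʳ X)
  iterate-∙ T X (suc n) = PSL.trans (iterate-∙ T (X ∙ T) n) (assoc X T _)

-- Vertices {W, WT, …, WTⁿ⁻¹} with cyclic order ({W}, {WT}, …, {WTⁿ⁻¹}).
cosetVertices : ∀ T n .{{_ : ℕ.NonZero n}} → T ^ℕ n ≈ ε →
                Vertices (LeftInvariantEquivalence.setoid singletons)
cosetVertices T n Tⁿ≈ε = record
  { Vertex   = C.setoid
  ; end      = record { to = λ X → X ; cong = C.reflexive }
  ; next     = record { to = _∙ T ; cong = ∙-congʳ }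
  ; end-next = λ X → C.sym (step X)
  ; cyclic   = λ X Y (i , e) → toℕ i , PSL.trans (iterate-∙ T X (toℕ i)) e
  }
  where
  module C where
    open LeftInvariantEquivalence (cosets T n Tⁿ≈ε) public
    open IsEquivalence isEquivalence public using (sym)
  step : ∀ X → X C.~ (X ∙ T)
  step X = fromℕ< (m%n<n 1 n) , (begin
    X ∙ T ^ℕ toℕ (fromℕ< (m%n<n 1 n))  ≡⟨ cong (λ j → X ∙ T ^ℕ j) (toℕ-fromℕ< (m%n<n 1 n)) ⟩
    X ∙ T ^ℕ (1 % n)                   ≈⟨ ∙-congˡ (^ℕ-% n Tⁿ≈ε 1) ⟩
    X ∙ (T ∙ ε)                        ≈⟨ ∙-congˡ (identityʳ T) ⟩
    X ∙ T                              ∎)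

quotientVertices : ∀ M T n .{{_ : ℕ.NonZero n}} → T ^ℕ n ≈ ε → Vertices (⟨ M ⟩＼ singletons)
quotientVertices M T n Tⁿ≈ε = record
  { Vertex   = ⟨ M ⟩＼ cosets T n Tⁿ≈ε
  ; end      = record { to = λ X → X ; cong = λ (k , e) → k , C.reflexive e }
  ; next     = record { to = _∙ T ; cong = λ (k , e) → k , PSL.trans (PSL.sym (assoc _ _ T)) (∙-congʳ e) }
  ; end-next = λ X → 0ℤ , C.trans (C.reflexive (identityˡ _)) (V.end-next X)
  ; cyclic   = λ X Y (k , i , e) → toℕ i , k , (begin
      M ^ k ∙ iterate (_∙ T) X (toℕ i)  ≈⟨ ∙-congˡ (iterate-∙ T X (toℕ i)) ⟩
      M ^ k ∙ (X ∙ T ^ℕ toℕ i)          ≈⟨ assoc _ X _ ⟨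
      (M ^ k ∙ X) ∙ T ^ℕ toℕ i          ≈⟨ e ⟩
      Y                                 ∎)
  }
  where
  module V = Vertices (cosetVertices T n Tⁿ≈ε)
  module C where
    open LeftInvariantEquivalence (cosets T n Tⁿ≈ε) public
    open IsEquivalence isEquivalence public using (trans)

𝓕 : RibbonGraph
𝓕 = record
  { Edge = LeftInvariantEquivalence.setoid singletons
  ; ⊗v   = cosetVertices S 2 S²≈ε
  ; •v   = cosetVertices R 3 R³≈ε
  }

⟨_⟩＼𝓕 : SL₂ℤ → RibbonGraph
⟨ M ⟩＼𝓕 = record
  { Edge = ⟨ M ⟩＼ singletons
  ; ⊗v   = quotientVertices M S 2 S²≈ε
  ; •v   = quotientVertices M R 3 R³≈ε
  }

project : ∀ M → Walk 𝓕 → Walk ⟨ M ⟩＼𝓕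
project M w = record
  { before = before
  ; after  = after
  ; at-⊗   = λ i → 0ℤ , ⊗.trans (⊗.reflexive (identityˡ _)) (at-⊗ i)
  ; at-•   = λ i → 0ℤ , •.trans (•.reflexive (identityˡ _)) (at-• i)
  }
  where
  open Walk w
  module ⊗ where
    open LeftInvariantEquivalence (cosets S 2 S²≈ε) public
    open IsEquivalence isEquivalence public using (trans)
  module • where
    open LeftInvariantEquivalence (cosets R 3 R³≈ε) public
    open IsEquivalence isEquivalence public using (trans)

------------------------------------------------------------------------
-- Hyperbolic elements

trace : SL₂ℤ → ℤ
trace M = SL₂ℤ.p M + SL₂ℤ.s M

Hyperbolic : SL₂ℤ → Set
Hyperbolic M = 2 ℕ.< ∣ trace M ∣

HyperbolicElement : Set
HyperbolicElement = Σ[ M ∈ SL₂ℤ ] Hyperbolic M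

hyperbolicElements : Setoid 0ℓ 0ℓ
hyperbolicElements = On.setoid {B = HyperbolicElement} PSL.setoid proj₁

-- The axis of M with one of its two directions: a parametrized line of the
-- tree on which M acts as a nontrivial translation. The direction is that of
-- the parametrization; M translates along it exactly when length > 0.
record OrientedAxis (M : SL₂ℤ) : Set where
  field
    line            : Walk 𝓕
    nonBacktracking : NonBacktracking line
    length          : ℤ
    length≢0        : ¬ (length ≡ 0ℤ)
  open Walk line
  field
    translates-before : ∀ i → M ∙ before i ≈ before (i + length)
    translates-after  : ∀ i → M ∙ after i ≈ after (i + length)

------------------------------------------------------------------------
-- Oriented çarks with a base edge

-- The spine is the image of the axis, and is oriented by a direction of it.
record OrientedÇark : Set where
  field
    M          : SL₂ℤ
    hyperbolic : Hyperbolic M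
    base       : RibbonGraph.Edge.Carrier ⟨ M ⟩＼𝓕
    axis       : OrientedAxis M
  graph : RibbonGraph
  graph = ⟨ M ⟩＼𝓕
  spine : Walk graph
  spine = project M (OrientedAxis.line axis)

record _≅_ (Γ Δ : OrientedÇark) : Set where
  private
    module Γ = OrientedÇark Γ
    module Δ = OrientedÇark Δ
  field
    graph-iso  : Γ.graph ≅ᴿ Δ.graph
    base-edge  : RibbonGraph.Edge._≈_ Δ.graph (_≅ᴿ_.to graph-iso Γ.base) Δ.base
    spine-walk : Carries graph-iso Γ.spine Δ.spine

private
  idᴿ : ∀ {G} → G ≅ᴿ G
  idᴿ {G} = record
    { edges = Identity.inverse _
    ; ⊗-iso = record { vertices = Identity.inverse _ ; incidence = λ _ → ⊗.Vertex.refl ; rotation = λ _ → Edge.refl }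
    ; •-iso = record { vertices = Identity.inverse _ ; incidence = λ _ → •.Vertex.refl ; rotation = λ _ → Edge.refl }
    }
    where open RibbonGraph G

  module _ {E E′ : Setoid 0ℓ 0ℓ} {φ : Inverse E E′} {V : Vertices E} {V′ : Vertices E′} where

    private
      module E  = Setoid E
      module E′ = Setoid E′
      module V  = Vertices V
      module V′ = Vertices V′
      module φ  = Inverse φ

    symⱽ : VerticesIso φ V V′ → VerticesIso (Symmetry.inverse φ) V′ V
    symⱽ ψ = record
      { vertices  = Symmetry.inverse vertices
      ; incidence = λ e → v.inverseʳ (V′.Vertex.sym (V′.Vertex.trans (incidence (φ.from e))
                                                     (Func.cong V′.end (φ.inverseˡ E.refl))))
      ; rotation  = λ e → φ.inverseʳ (E′.sym (E′.trans (rotation (φ.from e))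
                                               (Func.cong V′.next (φ.inverseˡ E.refl))))
      }
      where
      open VerticesIso ψ
      module v = Inverse vertices

  transⱽ : {E₁ E₂ E₃ : Setoid 0ℓ 0ℓ} {φ : Inverse E₁ E₂} {ψ : Inverse E₂ E₃}
           {V₁ : Vertices E₁} {V₂ : Vertices E₂} {V₃ : Vertices E₃} →
           VerticesIso φ V₁ V₂ → VerticesIso ψ V₂ V₃ → VerticesIso (Compose.inverse φ ψ) V₁ V₃
  transⱽ {E₃ = E₃} {φ} {ψ} {V₃ = V₃} α β = record
    { vertices  = Compose.inverse α.vertices β.vertices
    ; incidence = λ e → Setoid.trans (Vertices.Vertex V₃)
                          (Inverse.to-cong β.vertices (α.incidence e)) (β.incidence (Inverse.to φ e))
    ; rotation  = λ e → Setoid.trans E₃ (Inverse.to-cong ψ (α.rotation e)) (β.rotation (Inverse.to φ e))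
    }
    where
    module α = VerticesIso α
    module β = VerticesIso β

  symᴿ : ∀ {G H} → G ≅ᴿ H → H ≅ᴿ G
  symᴿ φ = record { edges = Symmetry.inverse edges ; ⊗-iso = symⱽ ⊗-iso ; •-iso = symⱽ •-iso }
    where open _≅ᴿ_ φ

  transᴿ : ∀ {G H K} → G ≅ᴿ H → H ≅ᴿ K → G ≅ᴿ K
  transᴿ φ ψ = record
    { edges = Compose.inverse φ.edges ψ.edges
    ; ⊗-iso = transⱽ φ.⊗-iso ψ.⊗-iso
    ; •-iso = transⱽ φ.•-iso ψ.•-iso
    }
    where
    module φ = _≅ᴿ_ φ
    module ψ = _≅ᴿ_ ψ

  idᶜ : ∀ {G} (w : Walk G) → Carries idᴿ w w
  idᶜ {G} w = 0ℤ , λ i →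
      RibbonGraph.Edge.reflexive G (cong before (sym (ℤ.+-identityʳ i)))
    , RibbonGraph.Edge.reflexive G (cong after (sym (ℤ.+-identityʳ i)))
    where open Walk w

  symᶜ : ∀ {G H} (φ : G ≅ᴿ H) {w w′} → Carries φ w w′ → Carries (symᴿ φ) w′ w
  symᶜ {G} {H} φ {w} {w′} (j , c) = - j , λ i →
      φ.inverseʳ (H.sym (H.trans (proj₁ (c (i - j))) (H.reflexive (cong (before w′) (cancel i j)))))
    , φ.inverseʳ (H.sym (H.trans (proj₂ (c (i - j))) (H.reflexive (cong (after w′) (cancel i j)))))
    where
    open Walk
    module φ = Inverse (_≅ᴿ_.edges φ)
    module H = RibbonGraph.Edge H
    cancel : ∀ i j → (i - j) + j ≡ i
    cancel = solve-∀

  transᶜ : ∀ {G H K} (φ : G ≅ᴿ H) (ψ : H ≅ᴿ K) {w w′ w″} →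
           Carries φ w w′ → Carries ψ w′ w″ → Carries (transᴿ φ ψ) w w″
  transᶜ {K = K} φ ψ {w″ = w″} (j , c) (k , d) = j + k , λ i →
      K.trans (to-cong (proj₁ (c i))) (K.trans (proj₁ (d (i + j))) (K.reflexive (cong (before w″) (ℤ.+-assoc i j k))))
    , K.trans (to-cong (proj₂ (c i))) (K.trans (proj₂ (d (i + j))) (K.reflexive (cong (after w″) (ℤ.+-assoc i j k))))
    where
    open Walk
    open Inverse (_≅ᴿ_.edges ψ)
    module K = RibbonGraph.Edge K

orientedÇarks : Setoid 0ℓ 0ℓ
orientedÇarks = record
  { Carrier       = OrientedÇark
  ; _≈_           = _≅_
  ; isEquivalence = record
    { refl  = λ {Γ} → record
        { graph-iso  = idᴿ
        ; base-edge  = RibbonGraph.Edge.refl (OrientedÇark.graph Γ)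
        ; spine-walk = idᶜ (OrientedÇark.spine Γ)
        }
    ; sym   = λ {Γ} {Δ} φ → let open _≅_ φ in record
        { graph-iso  = symᴿ graph-iso
        ; base-edge  = Inverse.inverseʳ (_≅ᴿ_.edges graph-iso)
                         (RibbonGraph.Edge.sym (OrientedÇark.graph Δ) base-edge)
        ; spine-walk = symᶜ graph-iso {OrientedÇark.spine Γ} {OrientedÇark.spine Δ} spine-walk
        }
    ; trans = λ {Γ} {Δ} {Θ} φ ψ → record
        { graph-iso  = transᴿ (_≅_.graph-iso φ) (_≅_.graph-iso ψ)
        ; base-edge  = RibbonGraph.Edge.trans (OrientedÇark.graph Θ)
                         (Inverse.to-cong (_≅ᴿ_.edges (_≅_.graph-iso ψ)) (_≅_.base-edge φ))
                         (_≅_.base-edge ψ)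
        ; spine-walk = transᶜ (_≅_.graph-iso φ) (_≅_.graph-iso ψ)
                         {OrientedÇark.spine Γ} {OrientedÇark.spine Δ} {OrientedÇark.spine Θ}
                         (_≅_.spine-walk φ) (_≅_.spine-walk ψ)
        }
    }
  }

-- Γ is isomorphic to ⟨M⟩\𝓕 with base edge ⟨M⟩·{I} and its spine oriented in
-- the direction in which M translates its axis.
_IsÇarkOf_ : OrientedÇark → HyperbolicElement → Set
Γ IsÇarkOf (M , h) = Σ[ axis ∈ OrientedAxis M ]
  (0ℤ < OrientedAxis.length axis) ×
  Γ ≅ record { M = M ; hyperbolic = h ; base = ε ; axis = axis }

------------------------------------------------------------------------
-- Binary quadratic forms

-- (A, B, C) stands for the form A x² + B x y + C y².
record Form : Set where
  constructor ⟨_,_,_⟩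
  field A B C : ℤ

discriminant : Form → ℤ
discriminant ⟨ A , B , C ⟩ = B * B - + 4 * A * C

Primitive : Form → Set
Primitive ⟨ A , B , C ⟩ = gcd A (gcd B C) ≡ 1ℤ

Indefinite : Form → Set
Indefinite f = 0ℤ < discriminant f

IsSquare : ℤ → Set
IsSquare n = ∃[ m ] n ≡ m * m

AdmissibleForm : Set
AdmissibleForm = Σ[ f ∈ Form ] Primitive f × Indefinite f × ¬ IsSquare (discriminant f)

admissibleForms : Setoid 0ℓ 0ℓ
admissibleForms = On.setoid {B = AdmissibleForm} (≡.setoid Form) proj₁

sgn : ℤ → ℤ
sgn +[1+ _ ] = 1ℤ
sgn +0       = 0ℤ
sgn -[1+ _ ] = -1ℤ

content : SL₂ℤ → ℤ
content M = gcd q (gcd (s - p) r)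
  where open SL₂ℤ M

private
  square≡1⇒∣i∣≡1 : ∀ i → i * i ≡ 1ℤ → ∣ i ∣ ≡ 1
  square≡1⇒∣i∣≡1 i e = ℕ.m*n≡1⇒m≡1 ∣ i ∣ ∣ i ∣ (trans (sym (ℤ.abs-* i i)) (cong ∣_∣ e))

content≢0 : ∀ M → Hyperbolic M → ¬ (content M ≡ 0ℤ)
content≢0 (⟦ p , q , r , s ⟧ ,det=1: d) h c≡0 =
  ℕ.<⇒≱ h (ℕ.≤-trans (ℤ.∣i+j∣≤∣i∣+∣j∣ p s) (ℕ.≤-reflexive ∣p∣+∣s∣≡2))
  where
  rest≡0 : gcd (s - p) r ≡ 0ℤ
  rest≡0 = gcd[i,j]≡0⇒j≡0 {q} c≡0
  s≡p : s ≡ p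
  s≡p = ℤ.i-j≡0⇒i≡j s p (gcd[i,j]≡0⇒i≡0 (s - p) r rest≡0)
  q≡0 : q ≡ 0ℤ
  q≡0 = gcd[i,j]≡0⇒i≡0 q (gcd (s - p) r) c≡0
  p*p≡1 : p * p ≡ 1ℤ
  p*p≡1 = trans (sym (trans (cong₂ (λ x y → p * x - y * r) s≡p q≡0) (ℤ.+-identityʳ (p * p)))) d
  ∣p∣≡1 : ∣ p ∣ ≡ 1
  ∣p∣≡1 = square≡1⇒∣i∣≡1 p p*p≡1
  ∣p∣+∣s∣≡2 : ∣ p ∣ ℕ.+ ∣ s ∣ ≡ 2
  ∣p∣+∣s∣≡2 = cong₂ ℕ._+_ ∣p∣≡1 (trans (cong ∣_∣ s≡p) ∣p∣≡1)

-- The divisions are exact.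
form : HyperbolicElement → Form
form (M , h) = ⟨ scaled r , scaled (s - p) , scaled (- q) ⟩
  where
  open SL₂ℤ M
  scaled : ℤ → ℤ
  scaled x = _/_ (sgn (trace M) * x) (content M) {{≢-nonZero (content≢0 M h)}}

{-# OPTIONS --safe #-}

{-
In the generators S and R every element of PSL₂(ℤ) is R^a, a product of the letters
S R and S R², and possibly a final S. A walk without backtracking in the tree is the
same thing as a base edge and a bi-infinite sequence of letters, so an axis of M is a
conjugation of M to a product of letters; it is found by cyclic reduction.

That the axis is unique is read off the form f_M. An edge X lies on the axis, oriented
forwards, only if A < 0 < C for the form (A , B , C) of X⁻¹ M X. If the edges X and
X C both have this property, the sign change of f_M on a quadrant forces C or C⁻¹ to be
a product of letters, and forces the letters to be those of the axis.

An isomorphism of çarks commutes with right multiplication by S and R, so it is a left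
multiplication and conjugates ⟨M⟩ to ⟨N⟩; the orientations of the spines decide between
N and N⁻¹.

An integral solution of x² - Δ y² = 1 with y ≠ 0 makes any primitive form of
discriminant Δ the form of a hyperbolic element. The solution comes from following the
river of x² - Δ y²: its steps are reversible and only finitely many forms occur, so the
form itself recurs.
-}

module Submission where

open import Defs
open import Algebra.Bundles using (Group)
open import Data.Bool.Base using (Bool; true; false; not)
open import Data.Fin.Base as Fin using (Fin; zero; suc; toℕ)
import Data.Fin.Properties as Fin
open import Data.Integer.Base as ℤ
  using (ℤ; +_; +0; +[1+_]; -[1+_]; 0ℤ; 1ℤ; -1ℤ; _+_; _*_; _-_; -_; ∣_∣)
import Data.Integer.DivMod as ℤ
import Data.Integer.Divisibility.Signed as ℤ using (divides; ∣ᵤ⇒∣)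
import Data.Integer.Properties as ℤ
open import Data.Integer.Tactic.RingSolver using (solve-∀)
open import Data.List.Base as List using (List; []; _∷_; _++_; length)
import Data.List.Properties as List
open import Data.Nat.Base as ℕ using (ℕ; zero; suc)
import Data.Nat.Divisibility as ℕ
import Data.Nat.DivMod as ℕ
import Data.Nat.GCD as ℕ
open import Data.Nat.Induction using (<-wellFounded)
import Data.Nat.Properties as ℕ
import Data.Nat.Tactic.RingSolver as ℕ
open import Data.Product.Base using (Σ-syntax; ∃-syntax; _×_; _,_; proj₁; proj₂)
open import Data.Sum.Base using (_⊎_; inj₁; inj₂)
open import Function.Base using (case_of_)
open import Function.Bundles using (Inverse; Surjection)
open import Induction.WellFounded using (Acc; acc)
open import Relation.Binary.Bundles using (Setoid)
open import Relation.Binary.PropositionalEquality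
  using (_≡_; _≢_; refl; sym; trans; cong; cong₂; subst; module ≡-Reasoning)
open import Relation.Binary.Structures using (IsEquivalence)
open import Relation.Nullary.Decidable using (yes; no)
open import Relation.Nullary.Negation using (¬_; contradiction)

module PSL = Group PSL₂ℤ
open PSL using (_≈_; _∙_; ε; _⁻¹; ∙-cong; ∙-congˡ; ∙-congʳ; assoc; identityˡ; identityʳ)
open import Algebra.Properties.Group PSL₂ℤ
  using (\\-leftDividesˡ; \\-leftDividesʳ; //-rightDividesˡ; //-rightDividesʳ; ∙-cancelˡ; ∙-cancelʳ; ⁻¹-involutive)
open import Algebra.Properties.AbelianGroup ℤ.+-0-abelianGroup using () renaming (∙-cancelˡ to +-cancelˡ)
import Relation.Binary.Reasoning.Setoid PSL.setoid as ≈-Reasoning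

-- The quotient remembers the group generated by M but not M itself, and an axis has a signed
-- translation length. A çark therefore singles out one of the two generators only through the
-- orientation of its spine: this is `towards M ℓ`, and the element of the çark is this generator as
-- seen from the base edge.
--
-- An isomorphism is given only modulo translations. It sends each edge of one spine to a translate
-- of an edge of the other, by a power that may vary with the edge, and it intertwines one generator
-- with an unspecified power of the other. Uniqueness of the next letter removes the first
-- ambiguity; comparing translation lengths in both directions removes the second.
--
-- Sign changes of an integral form stand in for the fixed points of M on the real line, so
-- everything stays in integer arithmetic.
--
-- Solving x² - Δ y² = 1 amounts to solving t² - Δ u² = 4 with t = 2 x and u = 2 y. The resulting
-- automorph is perhaps not the fundamental one, but its entries are integral whatever the parity of
-- B.

matrix-≡ : ∀ {p q r s p′ q′ r′ s′} → p ≡ p′ → q ≡ q′ → r ≡ r′ → s ≡ s′ →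
           ⟦ p , q , r , s ⟧ ≡ ⟦ p′ , q′ , r′ , s′ ⟧
matrix-≡ refl refl refl refl = refl

-- Conjugation and the trace

conj : SL₂ℤ → SL₂ℤ → SL₂ℤ
conj C Y = C ⁻¹ ∙ (Y ∙ C)

conj-cong : ∀ {C D Y Z} → C ≈ D → Y ≈ Z → conj C Y ≈ conj D Z
conj-cong e f = ∙-cong (PSL.⁻¹-cong e) (∙-cong f e)

∙-conj : ∀ C Y → C ∙ conj C Y ≈ Y ∙ C
∙-conj C Y = \\-leftDividesˡ C (Y ∙ C)

conj-unique : ∀ {C Y Z} → Y ∙ C ≈ C ∙ Z → conj C Y ≈ Z
conj-unique {C} e = PSL.trans (∙-congˡ e) (\\-leftDividesʳ C _)

conj-∙ : ∀ C D Y → conj (C ∙ D) Y ≈ conj D (conj C Y)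
conj-∙ C D Y = conj-unique (begin
  Y ∙ (C ∙ D)              ≈⟨ assoc Y C D ⟨
  (Y ∙ C) ∙ D              ≈⟨ ∙-congʳ (∙-conj C Y) ⟨
  (C ∙ conj C Y) ∙ D       ≈⟨ assoc C _ D ⟩
  C ∙ (conj C Y ∙ D)       ≈⟨ ∙-congˡ (∙-conj D _) ⟨
  C ∙ (D ∙ conj D (conj C Y)) ≈⟨ assoc C D _ ⟨
  (C ∙ D) ∙ conj D (conj C Y) ∎)
  where open ≈-Reasoning

conj-ε : ∀ Y → conj ε Y ≈ Y
conj-ε Y = conj-unique (PSL.trans (identityʳ Y) (PSL.sym (identityˡ Y)))

∣trace∣-cong : ∀ {X Y} → X ≈ Y → ∣ trace X ∣ ≡ ∣ trace Y ∣
∣trace∣-cong {⟦ _ , _ , _ , _ ⟧ ,det=1: _} {⟦ _ , _ , _ , _ ⟧ ,det=1: _} (same refl) = refl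
∣trace∣-cong {⟦ _ , _ , _ , _ ⟧ ,det=1: _} {⟦ p , _ , _ , s ⟧ ,det=1: _} (opposite refl) =
  trans (cong ∣_∣ (sym (ℤ.neg-distrib-+ p s))) (ℤ.∣-i∣≡∣i∣ (p + s))

trace-conj : ∀ C Y → trace (conj C Y) ≡ trace Y
trace-conj (⟦ x , u , y , v ⟧ ,det=1: d) (⟦ p , q , r , s ⟧ ,det=1: _) =
  trans (e x u y v p q r s) (trans (cong ((p + s) *_) d) (ℤ.*-identityʳ (p + s)))
  where
  e : ∀ x u y v p q r s →
      (v * (p * x + q * y) + - u * (r * x + s * y)) + (- y * (p * u + q * v) + x * (r * u + s * v))
      ≡ (p + s) * (x * v - u * y)
  e = solve-∀

S∙S∙ : ∀ X → S ∙ (S ∙ X) ≈ X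
S∙S∙ X = PSL.trans (PSL.sym (assoc S S X)) (PSL.trans (∙-congʳ (opposite refl)) (identityˡ X))


-- Generation by `S` and `R` through Euclid's algorithm

shift : ℤ → SL₂ℤ
shift n = ⟦ 1ℤ , n , 0ℤ , 1ℤ ⟧ ,det=1: e n
  where
  e : ∀ n → 1ℤ * 1ℤ - n * 0ℤ ≡ 1ℤ
  e = solve-∀

shift-∙ : ∀ m n X → shift m ∙ (shift n ∙ X) ≈ shift (m + n) ∙ X
shift-∙ m n X = PSL.trans (PSL.sym (assoc _ _ X)) (∙-congʳ (same (matrix-≡ (e′ m) (e m n) refl (e″ n))))
  where
  e′ : ∀ m → 1ℤ * 1ℤ + m * 0ℤ ≡ 1ℤ
  e′ = solve-∀
  e″ : ∀ n → 0ℤ * n + 1ℤ * 1ℤ ≡ 1ℤ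
  e″ = solve-∀
  e : ∀ m n → 1ℤ * n + m * 1ℤ ≡ m + n
  e = solve-∀

SRR≈shift : S ∙ (R ∙ R) ≈ shift -1ℤ
SRR≈shift = opposite refl

undo-euclid-step : ∀ k X → shift k ∙ (S ∙ (S ∙ (shift (- k) ∙ X))) ≈ X
undo-euclid-step k X = begin
  shift k ∙ (S ∙ (S ∙ (shift (- k) ∙ X)))  ≈⟨ ∙-congˡ (S∙S∙ (shift (- k) ∙ X)) ⟩
  shift k ∙ (shift (- k) ∙ X)              ≈⟨ shift-∙ k (- k) X ⟩
  shift (k + - k) ∙ X                      ≡⟨ cong (λ n → shift n ∙ X) (ℤ.+-inverseʳ k) ⟩
  shift 0ℤ ∙ X                             ≈⟨ ∙-congʳ {X} {shift 0ℤ} {ε} (same refl) ⟩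
  ε ∙ X                                    ≈⟨ identityˡ X ⟩
  X                                        ∎
  where open ≈-Reasoning

-- An induction principle rather than a factorization into generators: it yields the normal forms,
-- and later it extends the right equivariance of an isomorphism from `S` and `R` to the whole
-- group.
module Generation (P : SL₂ℤ → Set) (resp : ∀ {X Y} → X ≈ Y → P X → P Y)
                  (base : P ε) (S-closed : ∀ {X} → P X → P (S ∙ X))
                  (R-closed : ∀ {X} → P X → P (R ∙ X)) where

  shift-closed : ∀ n {X} → P X → P (shift n ∙ X)
  shift-closed +0 {X} x = resp (PSL.sym (PSL.trans (∙-congʳ (same refl)) (identityˡ X))) x
  shift-closed +[1+ n ] {X} x = resp (begin
      R ∙ (S ∙ (shift (+ n) ∙ X))    ≈⟨ assoc R S _ ⟨
      (R ∙ S) ∙ (shift (+ n) ∙ X)    ≈⟨ ∙-congʳ RS≈shift ⟩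
      shift 1ℤ ∙ (shift (+ n) ∙ X)   ≈⟨ shift-∙ 1ℤ (+ n) X ⟩
      shift +[1+ n ] ∙ X             ∎)
    (R-closed (S-closed (shift-closed (+ n) x)))
    where
    open ≈-Reasoning
    RS≈shift : R ∙ S ≈ shift 1ℤ
    RS≈shift = opposite refl
  shift-closed -[1+ zero ] {X} x = resp (∙-congʳ SRR≈shift)
    (resp (PSL.sym (PSL.trans (assoc S _ X) (∙-congˡ (assoc R R X)))) (S-closed (R-closed (R-closed x))))
  shift-closed -[1+ suc n ] {X} x = resp (begin
      (S ∙ (R ∙ R)) ∙ (shift -[1+ n ] ∙ X) ≈⟨ ∙-congʳ SRR≈shift ⟩
      shift -1ℤ ∙ (shift -[1+ n ] ∙ X)     ≈⟨ shift-∙ -1ℤ -[1+ n ] X ⟩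
      shift -[1+ suc n ] ∙ X               ∎)
    (resp (PSL.sym (PSL.trans (assoc S _ _) (∙-congˡ (assoc R R _)))) (S-closed (R-closed (R-closed (shift-closed -[1+ n ] x)))))
    where
    open ≈-Reasoning

  upper-triangular : ∀ X → SL₂ℤ.r X ≡ 0ℤ → P X
  upper-triangular (⟦ p , q , .0ℤ , s ⟧ ,det=1: d) refl = cases p refl
    where
    ps≡1 : p * s ≡ 1ℤ
    ps≡1 = trans (sym (e p q s)) d
      where
      e : ∀ p q s → p * s - q * 0ℤ ≡ p * s
      e = solve-∀
    ∣p∣≡1 : ∣ p ∣ ≡ 1
    ∣p∣≡1 = ℕ.m*n≡1⇒m≡1 ∣ p ∣ ∣ s ∣ (trans (sym (ℤ.abs-* p s)) (cong ∣_∣ ps≡1))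
    goal : SL₂ℤ
    goal = ⟦ p , q , 0ℤ , s ⟧ ,det=1: d
    s-from : ∀ σ → σ * σ ≡ 1ℤ → p ≡ σ → s ≡ σ
    s-from σ σσ≡1 refl = trans (sym (ℤ.*-identityˡ s))
      (trans (cong (_* s) (sym σσ≡1)) (trans (ℤ.*-assoc p p s) (trans (cong (p *_) ps≡1) (ℤ.*-identityʳ p))))
    cases : ∀ z → p ≡ z → P goal
    cases (+ n) e = resp {shift q} (same (matrix-≡ (sym p≡1) refl refl (sym (s-from 1ℤ refl p≡1))))
                         (resp (identityʳ (shift q)) (shift-closed q base))
      where
      p≡1 : p ≡ 1ℤ
      p≡1 = trans e (cong +_ (trans (cong ∣_∣ (sym e)) ∣p∣≡1))
    -- The representative with p = 1 is the negated matrix, whose upper right entry is - q.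
    cases -[1+ n ] e = resp {shift (- q)} (opposite (matrix-≡ (cong -_ (sym p≡-1)) refl refl (cong -_ (sym (s-from -1ℤ refl p≡-1)))))
                         (resp (identityʳ (shift (- q))) (shift-closed (- q) base))
      where
      p≡-1 : p ≡ -1ℤ
      p≡-1 = trans e (cong (λ k → - (+ k)) (trans (cong ∣_∣ (sym e)) ∣p∣≡1))

  -- Division with remainder of the first column: `S` after `shift (- k)` brings p modulo r to the
  -- lower left corner, and its absolute value is the measure of the descent.
  euclid-step : ∀ p q r s d .{{_ : ℤ.NonZero r}} →
                (∀ Y → ∣ SL₂ℤ.r Y ∣ ℕ.< ∣ r ∣ → P Y) → P (⟦ p , q , r , s ⟧ ,det=1: d)
  euclid-step p q r s d ih = resp {shift k ∙ (S ∙ Y)} {X} (undo-euclid-step k X) (shift-closed k {S ∙ Y} (S-closed {Y} (ih Y ∣r′∣<∣r∣)))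
    where
    k = p ℤ./ r
    X = ⟦ p , q , r , s ⟧ ,det=1: d
    Y = S ∙ (shift (- k) ∙ X)
    r′≡p%r : SL₂ℤ.r Y ≡ + (p ℤ.% r)
    r′≡p%r = trans (cong (λ p → 1ℤ * (1ℤ * p + - k * r) + 0ℤ * (0ℤ * p + 1ℤ * r)) (ℤ.a≡a%n+[a/n]*n p r))
                   (e (+ (p ℤ.% r)) k r)
      where
      e : ∀ m k r → 1ℤ * (1ℤ * (m + k * r) + - k * r) + 0ℤ * (0ℤ * (m + k * r) + 1ℤ * r) ≡ m
      e = solve-∀
    ∣r′∣<∣r∣ : ∣ SL₂ℤ.r Y ∣ ℕ.< ∣ r ∣
    ∣r′∣<∣r∣ = subst (λ z → ∣ z ∣ ℕ.< ∣ r ∣) (sym r′≡p%r) (ℤ.n%d<d p r)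

  euclid : ∀ X → Acc ℕ._<_ ∣ SL₂ℤ.r X ∣ → P X
  euclid X@(⟦ _ , _ , +0 , _ ⟧ ,det=1: _) _ = upper-triangular X refl
  euclid (⟦ p , q , r@(+[1+ _ ]) , s ⟧ ,det=1: d) (acc rec) = euclid-step p q r s d (λ Y lt → euclid Y (rec lt))
  euclid (⟦ p , q , r@(-[1+ _ ]) , s ⟧ ,det=1: d) (acc rec) = euclid-step p q r s d (λ Y lt → euclid Y (rec lt))

  generated : ∀ X → P X
  generated X = euclid X (<-wellFounded _)

-- Normal forms

ρ : Bool → SL₂ℤ
ρ false = R
ρ true  = R ⁻¹

-- The representatives of S ∙ ρ t whose products are all of the shape
-- ⟦ a , - b , - c , d ⟧ with a, b, c, d ≥ 0.
letter : Bool → SL₂ℤ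
letter false = ⟦ 1ℤ , 0ℤ , -1ℤ , 1ℤ ⟧ ,det=1: refl
letter true  = ⟦ 1ℤ , -1ℤ , 0ℤ , 1ℤ ⟧ ,det=1: refl

letter≈S∙ρ : ∀ t → letter t ≈ S ∙ ρ t
letter≈S∙ρ false = opposite refl
letter≈S∙ρ true  = same refl

ρ∙ρ : ∀ t → ρ t ∙ ρ t ≈ ρ (not t)
ρ∙ρ false = opposite refl
ρ∙ρ true  = opposite refl

ρ∙ρ-not : ∀ t → ρ t ∙ ρ (not t) ≈ ε
ρ∙ρ-not false = same refl
ρ∙ρ-not true  = same refl

ρ-not∙ρ : ∀ t → ρ (not t) ∙ ρ t ≈ ε
ρ-not∙ρ false = same refl
ρ-not∙ρ true  = same refl

word : List Bool → SL₂ℤ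
word []      = ε
word (t ∷ u) = letter t ∙ word u

cap : Bool → SL₂ℤ
cap false = ε
cap true  = S

S∙cap : ∀ b → S ∙ cap b ≈ cap (not b)
S∙cap false = same refl
S∙cap true  = opposite refl

word-++ : ∀ u v → word (u ++ v) ≈ word u ∙ word v
word-++ []      v = PSL.sym (identityˡ (word v))
word-++ (t ∷ u) v = PSL.trans (∙-congˡ (word-++ u v)) (PSL.sym (assoc (letter t) (word u) (word v)))

letter∙ : ∀ t X → letter t ∙ X ≈ S ∙ (ρ t ∙ X)
letter∙ t X = PSL.trans (∙-congʳ (letter≈S∙ρ t)) (assoc S (ρ t) X)

S∙letter∙ : ∀ t X → S ∙ (letter t ∙ X) ≈ ρ t ∙ X
S∙letter∙ t X = PSL.trans (∙-congˡ (letter∙ t X)) (S∙S∙ (ρ t ∙ X))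

ρ∙ρ∙ : ∀ t X → ρ t ∙ (ρ t ∙ X) ≈ ρ (not t) ∙ X
ρ∙ρ∙ t X = PSL.trans (PSL.sym (assoc (ρ t) (ρ t) X)) (∙-congʳ (ρ∙ρ t))

ρ∙ρ-not∙ : ∀ t X → ρ t ∙ (ρ (not t) ∙ X) ≈ X
ρ∙ρ-not∙ t X = PSL.trans (PSL.sym (assoc (ρ t) (ρ (not t)) X)) (PSL.trans (∙-congʳ (ρ∙ρ-not t)) (identityˡ X))

ρ-not∙ρ∙ : ∀ t X → ρ (not t) ∙ (ρ t ∙ X) ≈ X
ρ-not∙ρ∙ t X = PSL.trans (PSL.sym (assoc (ρ (not t)) (ρ t) X)) (PSL.trans (∙-congʳ (ρ-not∙ρ t)) (identityˡ X))

data NormalForm (X : SL₂ℤ) : Set where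
  plain  : ∀ u b → X ≈ word u ∙ cap b → NormalForm X
  turned : ∀ t u b → X ≈ ρ t ∙ (word u ∙ cap b) → NormalForm X

normalForm : ∀ X → NormalForm X
normalForm = Generation.generated NormalForm resp (plain [] false (PSL.sym (identityʳ ε))) S-closed R-closed
  where
  resp : ∀ {X Y} → X ≈ Y → NormalForm X → NormalForm Y
  resp e (plain u b f)    = plain u b (PSL.trans (PSL.sym e) f)
  resp e (turned t u b f) = turned t u b (PSL.trans (PSL.sym e) f)
  S-closed : ∀ {X} → NormalForm X → NormalForm (S ∙ X)
  S-closed (plain [] b f) = plain [] (not b)
    (PSL.trans (∙-congˡ (PSL.trans f (identityˡ (cap b)))) (PSL.trans (S∙cap b) (PSL.sym (identityˡ (cap (not b))))))
  S-closed (plain (t ∷ u) b f) = turned t u b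
    (PSL.trans (∙-congˡ (PSL.trans f (assoc (letter t) (word u) (cap b)))) (S∙letter∙ t (word u ∙ cap b)))
  S-closed (turned t u b f) = plain (t ∷ u) b
    (PSL.trans (∙-congˡ f) (PSL.trans (PSL.sym (letter∙ t (word u ∙ cap b))) (PSL.sym (assoc (letter t) (word u) (cap b)))))
  R-closed : ∀ {X} → NormalForm X → NormalForm (R ∙ X)
  R-closed (plain u b f)        = turned false u b (∙-congˡ f)
  R-closed (turned false u b f) = turned true u b (PSL.trans (∙-congˡ f) (ρ∙ρ∙ false (word u ∙ cap b)))
  R-closed (turned true u b f)  = plain u b (PSL.trans (∙-congˡ f) (ρ∙ρ-not∙ false (word u ∙ cap b)))

-- Inversion reverses the turns and flips each of them. So this shape of normal form is the inverse
-- of a word: an edge reached by it lies behind, not ahead.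
inverse-word : ∀ t u → ∃[ v ] (ρ t ∙ (word u ∙ S)) ∙ word v ≈ ε
inverse-word t [] = not t ∷ [] , (begin
  (ρ t ∙ (ε ∙ S)) ∙ word (not t ∷ [])   ≈⟨ ∙-cong (∙-congˡ (identityˡ S)) (identityʳ (letter (not t))) ⟩
  (ρ t ∙ S) ∙ letter (not t)            ≈⟨ assoc (ρ t) S (letter (not t)) ⟩
  ρ t ∙ (S ∙ letter (not t))            ≈⟨ ∙-congˡ (∙-congˡ (letter≈S∙ρ (not t))) ⟩
  ρ t ∙ (S ∙ (S ∙ ρ (not t)))           ≈⟨ ∙-congˡ (S∙S∙ (ρ (not t))) ⟩
  ρ t ∙ ρ (not t)                       ≈⟨ ρ∙ρ-not t ⟩
  ε                                     ∎)
  where open ≈-Reasoning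
inverse-word t (t′ ∷ u) with inverse-word t′ u
... | v , e = v ++ (not t ∷ []) , (begin
  (ρ t ∙ ((letter t′ ∙ word u) ∙ S)) ∙ word (v ++ (not t ∷ []))
    ≈⟨ ∙-cong (∙-congˡ (PSL.trans (assoc (letter t′) (word u) S) (letter∙ t′ (word u ∙ S))))
              (PSL.trans (word-++ v (not t ∷ [])) (∙-congˡ (identityʳ (letter (not t))))) ⟩
  (ρ t ∙ (S ∙ X)) ∙ (word v ∙ letter (not t))
    ≈⟨ assoc (ρ t) (S ∙ X) _ ⟩
  ρ t ∙ ((S ∙ X) ∙ (word v ∙ letter (not t)))
    ≈⟨ ∙-congˡ (assoc S X _) ⟩
  ρ t ∙ (S ∙ (X ∙ (word v ∙ letter (not t))))
    ≈⟨ ∙-congˡ (∙-congˡ (assoc X (word v) (letter (not t)))) ⟨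
  ρ t ∙ (S ∙ ((X ∙ word v) ∙ letter (not t)))
    ≈⟨ ∙-congˡ (∙-congˡ (∙-congʳ e)) ⟩
  ρ t ∙ (S ∙ (ε ∙ letter (not t)))
    ≈⟨ ∙-congˡ (∙-congˡ (identityˡ (letter (not t)))) ⟩
  ρ t ∙ (S ∙ letter (not t))
    ≈⟨ ∙-congˡ (∙-congˡ (letter≈S∙ρ (not t))) ⟩
  ρ t ∙ (S ∙ (S ∙ ρ (not t)))
    ≈⟨ ∙-congˡ (S∙S∙ (ρ (not t))) ⟩
  ρ t ∙ ρ (not t)
    ≈⟨ ρ∙ρ-not t ⟩
  ε ∎)
  where
  open ≈-Reasoning
  X = ρ t′ ∙ (word u ∙ S)

-- Signs of the form along the tree

eval : Form → ℤ → ℤ → ℤ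
eval ⟨ A , B , C ⟩ x y = A * x * x + B * x * y + C * y * y

-- A positive multiple of f_M. The factor trace M makes it independent of the sign
-- of the matrix and avoids the division by the gcd.
river : SL₂ℤ → Form
river M = ⟨ trace M * r , trace M * (s - p) , - (trace M * q) ⟩
  where open SL₂ℤ M

Flows : SL₂ℤ → Set
Flows M = Form.A (river M) ℤ.< 0ℤ × 0ℤ ℤ.< Form.C (river M)

form-≡ : ∀ {A B C A′ B′ C′} → A ≡ A′ → B ≡ B′ → C ≡ C′ → ⟨ A , B , C ⟩ ≡ ⟨ A′ , B′ , C′ ⟩
form-≡ refl refl refl = refl

river-cong : ∀ {X Y} → X ≈ Y → river X ≡ river Y
river-cong {⟦ _ , _ , _ , _ ⟧ ,det=1: _} {⟦ _ , _ , _ , _ ⟧ ,det=1: _} (same refl) = refl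
river-cong {⟦ _ , _ , _ , _ ⟧ ,det=1: _} {⟦ p , q , r , s ⟧ ,det=1: _} (opposite refl) =
  form-≡ (e p s r) (e′ p s) (cong -_ (e p s q))
  where
  e : ∀ p s x → (- p + - s) * - x ≡ (p + s) * x
  e = solve-∀
  e′ : ∀ p s → (- p + - s) * (- s - - p) ≡ (p + s) * (s - p)
  e′ = solve-∀

Flows-cong : ∀ {X Y} → X ≈ Y → Flows X → Flows Y
Flows-cong e = subst (λ f → Form.A f ℤ.< 0ℤ × 0ℤ ℤ.< Form.C f) (river-cong e)

-- Conjugation changes the basis of the form to the columns of C, so the outer coefficients become
-- values at these columns.
river-conj-A : ∀ C Y → Form.A (river (conj C Y)) ≡ eval (river Y) (SL₂ℤ.p C) (SL₂ℤ.r C)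
river-conj-A C@(⟦ x , u , y , v ⟧ ,det=1: d) Y@(⟦ p , q , r , s ⟧ ,det=1: d′) =
  trans (cong (_* SL₂ℤ.r (conj C Y)) (trace-conj C Y)) (e x u y v p q r s)
  where
  e : ∀ x u y v p q r s →
      (p + s) * (- y * (p * x + q * y) + x * (r * x + s * y))
      ≡ (p + s) * r * x * x + (p + s) * (s - p) * x * y + - ((p + s) * q) * y * y
  e = solve-∀

river-conj-C : ∀ C Y → Form.C (river (conj C Y)) ≡ eval (river Y) (SL₂ℤ.q C) (SL₂ℤ.s C)
river-conj-C C@(⟦ x , u , y , v ⟧ ,det=1: d) Y@(⟦ p , q , r , s ⟧ ,det=1: d′) =
  trans (cong (λ t → - (t * SL₂ℤ.q (conj C Y))) (trace-conj C Y)) (e x u y v p q r s)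
  where
  e : ∀ x u y v p q r s →
      - ((p + s) * (v * (p * u + q * v) + - u * (r * u + s * v)))
      ≡ (p + s) * r * u * u + (p + s) * (s - p) * u * v + - ((p + s) * q) * v * v
  e = solve-∀

-- Turning through the first quadrant from the first basis vector to the second,
-- a form with A < 0 < C changes sign only once, from negative to positive; the
-- reason is u v f(x,y) - x y f(u,v) = (x v - u y) (A x u - C y v).
no-return : ∀ f x y u v → Form.A f ℤ.< 0ℤ → 0ℤ ℤ.< Form.C f → u ℕ.* y ≡ suc (x ℕ.* v) →
            eval f (+ x) (+ y) ℤ.< 0ℤ → ¬ (0ℤ ℤ.< eval f (+ u) (+ v))
no-return f@(⟨ -[1+ a ] , B , +[1+ c ] ⟩) x y u v ℤ.-<+ (ℤ.+<+ _) d f₁<0 0<f₂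
  with eval f (+ x) (+ y) in e₁ | eval f (+ u) (+ v) in e₂
no-return f@(⟨ -[1+ a ] , B , +[1+ c ] ⟩) x y u v ℤ.-<+ (ℤ.+<+ _) d ℤ.-<+ (ℤ.+<+ _)
  | -[1+ f₁ ] | +[1+ f₂ ] = impossible x y u v d e₁ (ℕ.m+n≡0⇒m≡0 (suc a ℕ.* x ℕ.* u) first≡0) (ℕ.m+n≡0⇒n≡0 (suc a ℕ.* x ℕ.* u) first≡0)
  where
  sum≡0ℤ : ∀ A C x y u v F G → u * y - x * v ≡ 1ℤ →
           A * x * x + B * x * y + C * y * y ≡ F → A * u * u + B * u * v + C * v * v ≡ G →
           - A * x * u + C * y * v + (u * v * - F + x * y * G) ≡ 0ℤ
  sum≡0ℤ A C x y u v _ _ d refl refl =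
    trans (e A B C x y u v) (trans (cong (λ δ → (1ℤ - δ) * (C * y * v - A * x * u)) d) (ℤ.*-zeroˡ (C * y * v - A * x * u)))
    where
    e : ∀ A B C x y u v →
        - A * x * u + C * y * v
          + (u * v * - (A * x * x + B * x * y + C * y * y) + x * y * (A * u * u + B * u * v + C * v * v))
        ≡ (1ℤ - (u * y - x * v)) * (C * y * v - A * x * u)
    e = solve-∀
  det≡1 : + u * + y - + x * + v ≡ 1ℤ
  det≡1 = begin
    + u * + y - + x * + v                ≡⟨ cong₂ _-_ (sym (ℤ.pos-* u y)) (sym (ℤ.pos-* x v)) ⟩
    + (u ℕ.* y) - + (x ℕ.* v)            ≡⟨ cong (λ n → + n - + (x ℕ.* v)) d ⟩
    1ℤ + + (x ℕ.* v) - + (x ℕ.* v)       ≡⟨ e (+ (x ℕ.* v)) ⟩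
    1ℤ                                   ∎
    where
    open ≡-Reasoning
    e : ∀ n → 1ℤ + n - n ≡ 1ℤ
    e = solve-∀
  pos-*³ : ∀ i j k → + (i ℕ.* j ℕ.* k) ≡ + i * + j * + k
  pos-*³ i j k = trans (ℤ.pos-* (i ℕ.* j) k) (cong (_* + k) (ℤ.pos-* i j))
  sum≡0 : suc a ℕ.* x ℕ.* u ℕ.+ suc c ℕ.* y ℕ.* v ℕ.+ (u ℕ.* v ℕ.* suc f₁ ℕ.+ x ℕ.* y ℕ.* suc f₂) ≡ 0
  sum≡0 = ℤ.+-injective (trans
    (cong₂ _+_ (cong₂ _+_ (pos-*³ (suc a) x u) (pos-*³ (suc c) y v))
               (cong₂ _+_ (pos-*³ u v (suc f₁)) (pos-*³ x y (suc f₂))))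
    (sum≡0ℤ -[1+ a ] +[1+ c ] (+ x) (+ y) (+ u) (+ v) -[1+ f₁ ] +[1+ f₂ ] det≡1 e₁ e₂))
  first≡0 : suc a ℕ.* x ℕ.* u ℕ.+ suc c ℕ.* y ℕ.* v ≡ 0
  first≡0 = ℕ.m+n≡0⇒m≡0 _ sum≡0
  -- All summands of `sum≡0` are nonnegative, so x u = 0 and y v = 0. With u y = 1 + x v this leaves
  -- only x = v = 0, where the value at (x , y) is C y², which is not negative.
  impossible : ∀ x y u v → u ℕ.* y ≡ suc (x ℕ.* v) → eval f (+ x) (+ y) ≡ -[1+ f₁ ] →
               suc a ℕ.* x ℕ.* u ≡ 0 → ¬ (suc c ℕ.* y ℕ.* v ≡ 0)
  impossible zero (suc y) (suc u) zero d e _ _ = case trans (sym (z A B C (+ suc y))) e of λ ()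
    where
    A = -[1+ a ]
    C = +[1+ c ]
    z : ∀ A B C y → A * 0ℤ * 0ℤ + B * 0ℤ * y + C * y * y ≡ C * y * y
    z = solve-∀
  impossible _ _ zero _ () _ _ _
  impossible x zero (suc u) v d = contradiction (trans (sym (ℕ.*-zeroʳ u)) d) λ ()

pos-det : ∀ a b c d → + a * + d - - (+ b) * - (+ c) ≡ 1ℤ → a ℕ.* d ≡ suc (b ℕ.* c)
pos-det a b c d e = ℤ.+-injective (begin
  + (a ℕ.* d)                                            ≡⟨ ℤ.pos-* a d ⟩
  + a * + d                                              ≡⟨ e₁ (+ a) (+ b) (+ c) (+ d) ⟩
  (+ a * + d - - (+ b) * - (+ c)) + + b * + c            ≡⟨ cong₂ _+_ e (sym (ℤ.pos-* b c)) ⟩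
  1ℤ + + (b ℕ.* c)                                       ∎)
  where
  open ≡-Reasoning
  e₁ : ∀ a b c d → a * d ≡ (a * d - - b * - c) + b * c
  e₁ = solve-∀

data Nonnegative (X : SL₂ℤ) : Set where
  entries : ∀ a b c d → SL₂ℤ.matrix X ≡ ⟦ + a , - (+ b) , - (+ c) , + d ⟧ → Nonnegative X

word-nonnegative : ∀ u → Nonnegative (word u)
word-nonnegative [] = entries 1 0 0 1 refl
word-nonnegative (false ∷ u) with word u | word-nonnegative u
... | _ ,det=1: _ | entries a b c d refl = entries a b (a ℕ.+ c) (b ℕ.+ d)
  (matrix-≡ (e₁ (+ a) (- (+ c))) (e₁ (- (+ b)) (+ d)) (e₂ (+ a) (+ c)) (e₃ (+ b) (+ d)))
  where
  e₁ : ∀ x y → 1ℤ * x + 0ℤ * y ≡ x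
  e₁ = solve-∀
  e₂ : ∀ x y → -1ℤ * x + 1ℤ * - y ≡ - (x + y)
  e₂ = solve-∀
  e₃ : ∀ x y → -1ℤ * - x + 1ℤ * y ≡ x + y
  e₃ = solve-∀
word-nonnegative (true ∷ u) with word u | word-nonnegative u
... | _ ,det=1: _ | entries a b c d refl = entries (a ℕ.+ c) (b ℕ.+ d) c d
  (matrix-≡ (e₃ (+ a) (+ c)) (e₂ (+ b) (+ d)) (e₁ (+ a) (- (+ c))) (e₁ (- (+ b)) (+ d)))
  where
  e₁ : ∀ x y → 0ℤ * x + 1ℤ * y ≡ y
  e₁ = solve-∀
  e₂ : ∀ x y → 1ℤ * - x + -1ℤ * y ≡ - (x + y)
  e₂ = solve-∀
  e₃ : ∀ x y → 1ℤ * x + -1ℤ * - y ≡ x + y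
  e₃ = solve-∀

unipotent : ∀ a d → suc a ℕ.* suc d ≡ 1 → ¬ (2 ℕ.< suc a ℕ.+ suc d)
unipotent zero zero _ (ℕ.s≤s (ℕ.s≤s ()))

-- A zero on the diagonal contradicts a d = 1 + b c, and a zero off the diagonal gives a = d = 1 and
-- trace 2. So all four numbers are positive, with A = - (a + d) c and C = (a + d) b.
hyperbolic-word-flows : ∀ u → Hyperbolic (word u) → Flows (word u)
hyperbolic-word-flows u h with word u | word-nonnegative u
... | _ ,det=1: δ | entries (suc a) (suc b) (suc c) (suc d) refl rewrite ℕ.+-suc a d = ℤ.-<+ , ℤ.+<+ ℕ.z<s
... | _ ,det=1: δ | entries zero b c d refl = contradiction (pos-det 0 b c d δ) λ ()
... | _ ,det=1: δ | entries (suc a) b c zero refl =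
  contradiction (trans (sym (ℕ.*-zeroʳ a)) (pos-det (suc a) b c 0 δ)) λ ()
... | _ ,det=1: δ | entries (suc a) zero c (suc d) refl = contradiction h (unipotent a d (pos-det (suc a) 0 c (suc d) δ))
... | _ ,det=1: δ | entries (suc a) (suc b) zero (suc d) refl =
  contradiction h (unipotent a d (trans (pos-det (suc a) (suc b) 0 (suc d) δ) (cong suc (ℕ.*-zeroʳ b))))

no-crossing : ∀ {Y} C f x y u v → Form.A f ℤ.< 0ℤ → 0ℤ ℤ.< Form.C f → u ℕ.* y ≡ suc (x ℕ.* v) →
              eval (river Y) (SL₂ℤ.p C) (SL₂ℤ.r C) ≡ eval f (+ x) (+ y) →
              eval (river Y) (SL₂ℤ.q C) (SL₂ℤ.s C) ≡ eval f (+ u) (+ v) →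
              ¬ Flows (conj C Y)
no-crossing {Y} C f x y u v A<0 0<C δ e₁ e₂ (A′<0 , 0<C′) = no-return f x y u v A<0 0<C δ
  (subst (ℤ._< 0ℤ) (trans (river-conj-A C Y) e₁) A′<0)
  (subst (0ℤ ℤ.<_) (trans (river-conj-C C Y) e₂) 0<C′)

mirror : Form → Form
mirror ⟨ A , B , C ⟩ = ⟨ A , - B , C ⟩

eval-mirror : ∀ f x y → eval f (- x) y ≡ eval (mirror f) x y
eval-mirror ⟨ A , B , C ⟩ x y = e A B C x y
  where
  e : ∀ A B C x y → A * - x * - x + B * - x * y + C * y * y ≡ A * x * x + - B * x * y + C * y * y
  e = solve-∀

eval-even : ∀ f x y → eval f (- x) (- y) ≡ eval f x y
eval-even ⟨ A , B , C ⟩ x y = e A B C x y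
  where
  e : ∀ A B C x y → A * - x * - x + B * - x * - y + C * - y * - y ≡ A * x * x + B * x * y + C * y * y
  e = solve-∀

-- The columns of `W ∙ S` are (- b , d) and (- a , c), in the second quadrant; `mirror` reflects it
-- to the first and keeps A and C.
no-crossing-S : ∀ {Y W} → Nonnegative W → Flows Y → ¬ Flows (conj (W ∙ S) Y)
no-crossing-S {Y} {W@(_ ,det=1: δ)} (entries a b c d refl) (A<0 , 0<C) =
  no-crossing {Y} (W ∙ S) (mirror (river Y)) b d a c A<0 0<C (pos-det a b c d δ)
    (trans (cong₂ (eval (river Y)) (e₁ (+ a) (- (+ b))) (e₁ (- (+ c)) (+ d))) (eval-mirror (river Y) (+ b) (+ d)))
    (trans (cong₂ (eval (river Y)) (e₂ (+ a) (- (+ b))) (trans (e₂ (- (+ c)) (+ d)) (ℤ.neg-involutive (+ c))))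
           (eval-mirror (river Y) (+ a) (+ c)))
  where
  e₁ : ∀ x y → x * 0ℤ + y * 1ℤ ≡ y
  e₁ = solve-∀
  e₂ : ∀ x y → x * -1ℤ + y * 0ℤ ≡ - x
  e₂ = solve-∀

conj-R² : ∀ Y W → conj (ρ true ∙ W) Y ≈ conj ((R ∙ R) ∙ W) Y
conj-R² Y W = conj-cong {Y = Y} (∙-congʳ {W} (PSL.sym (ρ∙ρ false))) PSL.refl

-- Left multiplication by `ρ t` carries the columns of W, up to sign, into the first quadrant, in
-- the order that `no-return` excludes.
no-crossing-ρ : ∀ {Y W} t → Nonnegative W → Flows Y → ¬ Flows (conj (ρ t ∙ W) Y)
no-crossing-ρ {Y} {W@(_ ,det=1: δ)} false (entries a b c d refl) (A<0 , 0<C) =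
  no-crossing {Y} (R ∙ W) (river Y) (a ℕ.+ c) a (b ℕ.+ d) b A<0 0<C (δ′ (pos-det a b c d δ))
    (cong₂ (eval (river Y)) (e₁ (+ a) (+ c)) (e₃ (+ a) (- (+ c))))
    (trans (cong₂ (eval (river Y)) (e₂ (+ b) (+ d)) (e₃ (- (+ b)) (+ d)))
           (eval-even (river Y) (+ (b ℕ.+ d)) (+ b)))
  where
  e₁ : ∀ x y → 1ℤ * x + -1ℤ * - y ≡ x + y
  e₁ = solve-∀
  e₂ : ∀ x y → 1ℤ * - x + -1ℤ * y ≡ - (x + y)
  e₂ = solve-∀
  e₃ : ∀ x y → 1ℤ * x + 0ℤ * y ≡ x
  e₃ = solve-∀
  δ′ : a ℕ.* d ≡ suc (b ℕ.* c) → (b ℕ.+ d) ℕ.* a ≡ suc ((a ℕ.+ c) ℕ.* b)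
  δ′ e = trans (f₁ a b d) (trans (cong (b ℕ.* a ℕ.+_) e) (f₂ a b c))
    where
    f₁ : ∀ a b d → (b ℕ.+ d) ℕ.* a ≡ b ℕ.* a ℕ.+ a ℕ.* d
    f₁ = ℕ.solve-∀
    f₂ : ∀ a b c → b ℕ.* a ℕ.+ suc (b ℕ.* c) ≡ suc ((a ℕ.+ c) ℕ.* b)
    f₂ = ℕ.solve-∀
no-crossing-ρ {Y} {W@(_ ,det=1: δ)} true (entries a b c d refl) (A<0 , 0<C) flows =
  no-crossing {Y} ((R ∙ R) ∙ W) (river Y) c (a ℕ.+ c) d (b ℕ.+ d) A<0 0<C (δ′ (pos-det a b c d δ))
    (cong₂ (eval (river Y)) (e₃ (+ a) (+ c)) (e₁ (+ a) (+ c)))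
    (trans (cong₂ (eval (river Y)) (e₄ (- (+ b)) (+ d)) (e₂ (+ b) (+ d)))
           (eval-even (river Y) (+ d) (+ (b ℕ.+ d))))
    (Flows-cong (conj-R² Y W) flows)
  where
  e₁ : ∀ x y → 1ℤ * x + -1ℤ * - y ≡ x + y
  e₁ = solve-∀
  e₂ : ∀ x y → 1ℤ * - x + -1ℤ * y ≡ - (x + y)
  e₂ = solve-∀
  e₃ : ∀ x y → 0ℤ * x + -1ℤ * - y ≡ y
  e₃ = solve-∀
  e₄ : ∀ x y → 0ℤ * x + -1ℤ * y ≡ - y
  e₄ = solve-∀
  δ′ : a ℕ.* d ≡ suc (b ℕ.* c) → d ℕ.* (a ℕ.+ c) ≡ suc (c ℕ.* (b ℕ.+ d))
  δ′ e = trans (f₁ a c d) (trans (cong (d ℕ.* c ℕ.+_) e) (f₂ b c d))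
    where
    f₁ : ∀ a c d → d ℕ.* (a ℕ.+ c) ≡ d ℕ.* c ℕ.+ a ℕ.* d
    f₁ = ℕ.solve-∀
    f₂ : ∀ b c d → d ℕ.* c ℕ.+ suc (b ℕ.* c) ≡ suc (c ℕ.* (b ℕ.+ d))
    f₂ = ℕ.solve-∀

-- Lines

not-both : ∀ {N X Y C} → Y ≈ X ∙ C → (∀ {Z} → Flows Z → ¬ Flows (conj C Z)) →
           Flows (conj X N) → ¬ Flows (conj Y N)
not-both {N} {X} {Y} {C} e crossing x y =
  crossing x (Flows-cong (PSL.trans (conj-cong {Y = N} e PSL.refl) (conj-∙ X C N)) y)

-- An edge is oriented from its •-vertex to its ⊗-vertex. The edges X and `X ∙ (word u ∙ S)` then
-- face each other, which cannot happen along an oriented line.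
not-both-S : ∀ {N X Y} u → Y ≈ X ∙ (word u ∙ S) → Flows (conj X N) → ¬ Flows (conj Y N)
not-both-S u e = not-both e (no-crossing-S (word-nonnegative u))

-- The other inconsistent position: X and Y point away from each other, on different branches at the
-- •-vertex where X starts.
not-both-ρ : ∀ {N X Y} t u → Y ≈ X ∙ (ρ t ∙ word u) → Flows (conj X N) → ¬ Flows (conj Y N)
not-both-ρ t u e = not-both e (no-crossing-ρ t (word-nonnegative u))

≡-or-not : ∀ t t′ → t ≡ t′ ⊎ t′ ≡ not t
≡-or-not false false = inj₁ refl
≡-or-not false true  = inj₂ refl
≡-or-not true  false = inj₂ refl
≡-or-not true  true  = inj₁ refl

letter-not : ∀ t X → letter (not t) ∙ X ≈ letter t ∙ (ρ t ∙ X)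
letter-not t X = begin
  letter (not t) ∙ X            ≈⟨ letter∙ (not t) X ⟩
  S ∙ (ρ (not t) ∙ X)           ≈⟨ ∙-congˡ (ρ∙ρ∙ t X) ⟨
  S ∙ (ρ t ∙ (ρ t ∙ X))         ≈⟨ letter∙ t (ρ t ∙ X) ⟨
  letter t ∙ (ρ t ∙ X)          ∎
  where open ≈-Reasoning

-- Different turns after X would make Y and Z diverge from a common •-vertex. Allowing a word u
-- after the second turn lets a distant edge decide the turn.
same-next-letter : ∀ {N Y Z} X t t′ u → Y ≈ X ∙ letter t → Z ≈ X ∙ (letter t′ ∙ word u) →
                   Flows (conj Y N) → Flows (conj Z N) → t ≡ t′
same-next-letter {N} {Y} {Z} X t t′ u e f y z with ≡-or-not t t′
... | inj₁ t≡t′ = t≡t′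
... | inj₂ refl = contradiction z (not-both-ρ t u (begin
  Z                                     ≈⟨ f ⟩
  X ∙ (letter (not t) ∙ word u)         ≈⟨ ∙-congˡ (letter-not t (word u)) ⟩
  X ∙ (letter t ∙ (ρ t ∙ word u))       ≈⟨ assoc X (letter t) (ρ t ∙ word u) ⟨
  (X ∙ letter t) ∙ (ρ t ∙ word u)       ≈⟨ ∙-congʳ e ⟨
  Y ∙ (ρ t ∙ word u)                    ∎) y)
  where open ≈-Reasoning

-- Two different predecessors of Z would face each other: one is reached from the other by
-- `letter (not t) ∙ S`.
same-previous-letter : ∀ {N X Y} Z t t′ → Z ≈ X ∙ letter t → Z ≈ Y ∙ letter t′ →
                       Flows (conj X N) → Flows (conj Y N) → t ≡ t′
same-previous-letter {N} {X} {Y} Z t t′ e f x y with ≡-or-not t t′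
... | inj₁ t≡t′ = t≡t′
... | inj₂ refl = contradiction y (not-both-S (not t ∷ []) (∙-cancelʳ (letter (not t)) Y _ (begin
  Y ∙ letter (not t)                                      ≈⟨ f ⟨
  Z                                                       ≈⟨ e ⟩
  X ∙ letter t                                            ≈⟨ ∙-congˡ key ⟨
  X ∙ ((word (not t ∷ []) ∙ S) ∙ letter (not t))          ≈⟨ assoc X (word (not t ∷ []) ∙ S) (letter (not t)) ⟨
  (X ∙ (word (not t ∷ []) ∙ S)) ∙ letter (not t)          ∎)) x)
  where
  open ≈-Reasoning
  key : (word (not t ∷ []) ∙ S) ∙ letter (not t) ≈ letter t
  key = begin
    ((letter (not t) ∙ ε) ∙ S) ∙ letter (not t)     ≈⟨ ∙-congʳ (∙-congʳ (identityʳ (letter (not t)))) ⟩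
    (letter (not t) ∙ S) ∙ letter (not t)           ≈⟨ assoc (letter (not t)) S (letter (not t)) ⟩
    letter (not t) ∙ (S ∙ letter (not t))           ≈⟨ ∙-congˡ (∙-congˡ (letter≈S∙ρ (not t))) ⟩
    letter (not t) ∙ (S ∙ (S ∙ ρ (not t)))          ≈⟨ ∙-congˡ (S∙S∙ (ρ (not t))) ⟩
    letter (not t) ∙ ρ (not t)                      ≈⟨ letter-not t (ρ (not t)) ⟩
    letter t ∙ (ρ t ∙ ρ (not t))                    ≈⟨ ∙-congˡ (ρ∙ρ-not t) ⟩
    letter t ∙ ε                                    ≈⟨ identityʳ (letter t) ⟩
    letter t                                        ∎

≈ε⇒diagonal : ∀ {X} → X ≈ ε → SL₂ℤ.q X ≡ 0ℤ × SL₂ℤ.r X ≡ 0ℤ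
≈ε⇒diagonal {⟦ _ , _ , _ , _ ⟧ ,det=1: _} (same refl)     = refl , refl
≈ε⇒diagonal {⟦ _ , _ , _ , _ ⟧ ,det=1: _} (opposite refl) = refl , refl

-- Vanishing of the entry - (a + c), or - (b + d), would force a = 0, or d = 0, against a d = 1 + b
-- c. Hence a nonempty word is never trivial and a line never closes up.
letter∙nonnegative≉ε : ∀ {W} t → Nonnegative W → ¬ (letter t ∙ W ≈ ε)
letter∙nonnegative≉ε {_ ,det=1: δ} false (entries a b c d refl) e =
  contradiction (trans (cong (ℕ._* d) (sym a≡0)) (pos-det a b c d δ)) λ ()
  where
  f : ∀ x y → x + y ≡ - (-1ℤ * x + 1ℤ * - y)
  f = solve-∀
  a≡0 : a ≡ 0
  a≡0 = ℕ.m+n≡0⇒m≡0 a (ℤ.+-injective (trans (f (+ a) (+ c)) (cong -_ (proj₂ (≈ε⇒diagonal e)))))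
letter∙nonnegative≉ε {_ ,det=1: δ} true (entries a b c d refl) e =
  contradiction (trans (sym (ℕ.*-zeroʳ a)) (trans (cong (a ℕ.*_) (sym d≡0)) (pos-det a b c d δ))) λ ()
  where
  f : ∀ x y → x + y ≡ - (1ℤ * - x + -1ℤ * y)
  f = solve-∀
  d≡0 : d ≡ 0
  d≡0 = ℕ.m+n≡0⇒n≡0 b (ℤ.+-injective (trans (f (+ b) (+ d)) (cong -_ (proj₁ (≈ε⇒diagonal e)))))

ℤ-induction : (P : ℤ → Set) → P 0ℤ → (∀ i → P i → P (ℤ.suc i)) → (∀ i → P (ℤ.suc i) → P i) → ∀ i → P i
ℤ-induction P z s p (+ zero)      = z
ℤ-induction P z s p +[1+ n ]      = s (+ n) (ℤ-induction P z s p (+ n))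
ℤ-induction P z s p -[1+ zero ]   = p -[1+ zero ] z
ℤ-induction P z s p -[1+ suc n ]  = p -[1+ suc n ] (ℤ-induction P z s p -[1+ n ])

suc-+ : ∀ i j → ℤ.suc (i + j) ≡ i + ℤ.suc j
suc-+ = e
  where
  e : ∀ i j → 1ℤ + (i + j) ≡ i + (1ℤ + j)
  e = solve-∀

-- Only the edges entering the ⊗-vertices are recorded: the walk leaves the i-th
-- ⊗-vertex by edge i ∙ S.
record Line (N : SL₂ℤ) : Set where
  field
    hyperbolic : Hyperbolic N
    edge       : ℤ → SL₂ℤ
    turn       : ℤ → Bool
    step       : ∀ i → edge (ℤ.suc i) ≈ edge i ∙ letter (turn i)
    period     : ℕ
    translates : ∀ i → N ∙ edge i ≈ edge (i + +[1+ period ])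

  path : ∀ n i → ∃[ u ] (length u ≡ n) × (edge (i + + n) ≈ edge i ∙ word u)
  path zero    i = [] , refl , PSL.trans (PSL.reflexive (cong edge (ℤ.+-identityʳ i))) (PSL.sym (identityʳ (edge i)))
  path (suc n) i with path n (ℤ.suc i)
  ... | u , l , e = turn i ∷ u , cong suc l , (begin
    edge (i + ℤ.suc (+ n))                   ≡⟨ cong edge (trans (sym (suc-+ i (+ n))) (sym (ℤ.+-assoc 1ℤ i (+ n)))) ⟩
    edge (ℤ.suc i + + n)                     ≈⟨ e ⟩
    edge (ℤ.suc i) ∙ word u                  ≈⟨ ∙-congʳ (step i) ⟩
    (edge i ∙ letter (turn i)) ∙ word u      ≈⟨ assoc (edge i) (letter (turn i)) (word u) ⟩
    edge i ∙ (letter (turn i) ∙ word u)      ∎)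
    where open ≈-Reasoning

  flows : ∀ i → Flows (conj (edge i) N)
  flows i with path (suc period) i
  ... | u , _ , e = Flows-cong (PSL.sym conj≈word) (hyperbolic-word-flows u (subst (2 ℕ.<_) ∣trace∣≡ hyperbolic))
    where
    conj≈word : conj (edge i) N ≈ word u
    conj≈word = conj-unique (PSL.trans (translates i) e)
    ∣trace∣≡ : ∣ trace N ∣ ≡ ∣ trace (word u) ∣
    ∣trace∣≡ = trans (cong ∣_∣ (sym (trace-conj (edge i) N))) (∣trace∣-cong conj≈word)

  -- The sign condition at the far end alone forces every turn on the way to agree with the line.
  along : ∀ u i → Flows (conj (edge i ∙ word u) N) → edge (i + + length u) ≈ edge i ∙ word u
  along []      i _ = PSL.trans (PSL.reflexive (cong edge (ℤ.+-identityʳ i))) (PSL.sym (identityʳ (edge i)))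
  along (t ∷ u) i f = begin
    edge (i + ℤ.suc (+ length u))   ≡⟨ cong edge (trans (sym (suc-+ i (+ length u))) (sym (ℤ.+-assoc 1ℤ i (+ length u)))) ⟩
    edge (ℤ.suc i + + length u)     ≈⟨ along u (ℤ.suc i) (Flows-cong (conj-cong {Y = N} (PSL.sym regroup) PSL.refl) f) ⟩
    edge (ℤ.suc i) ∙ word u         ≈⟨ regroup ⟩
    edge i ∙ (letter t ∙ word u)    ∎
    where
    open ≈-Reasoning
    turn≡t : turn i ≡ t
    turn≡t = same-next-letter {N} (edge i) (turn i) t u (step i) PSL.refl (flows (ℤ.suc i)) f
    regroup : edge (ℤ.suc i) ∙ word u ≈ edge i ∙ (letter t ∙ word u)
    regroup = PSL.trans (∙-congʳ (PSL.trans (step i) (∙-congˡ (PSL.reflexive (cong letter turn≡t)))))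
                        (assoc (edge i) (letter t) (word u))

  no-loop : ∀ i n → ¬ (edge (i + +[1+ n ]) ≈ edge i)
  no-loop i n e with path (suc n) i
  ... | t ∷ u , _ , f = letter∙nonnegative≉ε t (word-nonnegative u)
    (∙-cancelˡ (edge i) _ ε (PSL.trans (PSL.sym f) (PSL.trans e (PSL.sym (identityʳ (edge i))))))

  edge-injective : ∀ i j → edge i ≈ edge j → i ≡ j
  edge-injective i j e with j - i in eq
  ... | +0       = sym (ℤ.i-j≡0⇒i≡j j i eq)
  ... | +[1+ n ] = contradiction
    (PSL.trans (PSL.reflexive (cong edge (trans (cong (λ k → i + k) (sym eq)) (f i j)))) (PSL.sym e)) (no-loop i n)
    where
    f : ∀ i j → i + (j - i) ≡ j
    f = solve-∀
  ... | -[1+ n ] = contradiction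
    (PSL.trans (PSL.reflexive (cong edge (trans (cong (λ k → j - k) (sym eq)) (f i j)))) e) (no-loop j n)
    where
    f : ∀ i j → j - (j - i) ≡ i
    f = solve-∀

open Line

module _ {N} (L L′ : Line N) where

  agree-suc : ∀ {i j} → edge L i ≈ edge L′ j → edge L (ℤ.suc i) ≈ edge L′ (ℤ.suc j)
  agree-suc {i} {j} e = PSL.trans (step L i) (PSL.trans (∙-cong e (PSL.reflexive (cong letter turn≡)))
                                                       (PSL.sym (step L′ j)))
    where
    turn≡ : turn L i ≡ turn L′ j
    turn≡ = same-next-letter {N} (edge L i) (turn L i) (turn L′ j) [] (step L i)
      (PSL.trans (step L′ j) (∙-cong (PSL.sym e) (PSL.sym (identityʳ (letter (turn L′ j))))))
      (flows L (ℤ.suc i)) (flows L′ (ℤ.suc j))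

  agree-pred : ∀ {i j} → edge L (ℤ.suc i) ≈ edge L′ (ℤ.suc j) → edge L i ≈ edge L′ j
  agree-pred {i} {j} e = ∙-cancelʳ (letter (turn L i)) (edge L i) (edge L′ j)
    (PSL.trans (PSL.sym (step L i)) (PSL.trans e (PSL.trans (step L′ j)
      (∙-congˡ (PSL.reflexive (cong letter (sym turn≡)))))))
    where
    turn≡ : turn L i ≡ turn L′ j
    turn≡ = same-previous-letter {N} (edge L (ℤ.suc i)) (turn L i) (turn L′ j) (step L i)
      (PSL.trans e (step L′ j)) (flows L i) (flows L′ j)

  agree : ∀ {i j} → edge L i ≈ edge L′ j → ∀ n → edge L (n + i) ≈ edge L′ (n + j)
  agree {i} {j} e = ℤ-induction _
    (PSL.trans (PSL.reflexive (cong (edge L) (ℤ.+-identityˡ i)))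
      (PSL.trans e (PSL.reflexive (cong (edge L′) (sym (ℤ.+-identityˡ j))))))
    (λ n f → PSL.trans (PSL.reflexive (cong (edge L) (ℤ.+-assoc 1ℤ n i)))
      (PSL.trans (agree-suc f) (PSL.reflexive (cong (edge L′) (sym (ℤ.+-assoc 1ℤ n j))))))
    (λ n f → agree-pred (PSL.trans (PSL.reflexive (cong (edge L) (sym (ℤ.+-assoc 1ℤ n i))))
      (PSL.trans f (PSL.reflexive (cong (edge L′) (ℤ.+-assoc 1ℤ n j))))))

  -- The four normal forms are the four relative positions of two edges. Facing and diverging edges
  -- are excluded by signs; otherwise one edge lies ahead of the other, and `along` puts it on the
  -- line of the one behind.
  meet : ∃[ i ] ∃[ j ] edge L i ≈ edge L′ j
  meet = from-normal-form (normalForm (X ⁻¹ ∙ Y))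
    where
    X = edge L 0ℤ
    Y = edge L′ 0ℤ
    to-Y : ∀ {C} → X ⁻¹ ∙ Y ≈ C → Y ≈ X ∙ C
    to-Y e = PSL.trans (PSL.sym (\\-leftDividesˡ X Y)) (∙-congˡ e)
    from-normal-form : NormalForm (X ⁻¹ ∙ Y) → ∃[ i ] ∃[ j ] edge L i ≈ edge L′ j
    from-normal-form (plain u false e) = _ , 0ℤ ,
      PSL.trans (along L u 0ℤ (Flows-cong (conj-cong {Y = N} X∙u PSL.refl) (flows L′ 0ℤ))) (PSL.sym X∙u)
      where
      X∙u : Y ≈ X ∙ word u
      X∙u = to-Y (PSL.trans e (identityʳ (word u)))
    from-normal-form (plain u true e) = contradiction (flows L′ 0ℤ) (not-both-S u (to-Y e) (flows L 0ℤ))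
    from-normal-form (turned t u false e) = contradiction (flows L′ 0ℤ)
      (not-both-ρ t u (to-Y (PSL.trans e (∙-congˡ (identityʳ (word u))))) (flows L 0ℤ))
    from-normal-form (turned t u true e) with inverse-word t u
    ... | v , f = 0ℤ , _ ,
      PSL.sym (PSL.trans (along L′ v 0ℤ (Flows-cong (conj-cong {Y = N} Y∙v PSL.refl) (flows L 0ℤ))) (PSL.sym Y∙v))
      where
      Y∙v : X ≈ Y ∙ word v
      Y∙v = begin
        X                                              ≈⟨ identityʳ X ⟨
        X ∙ ε                                          ≈⟨ ∙-congˡ f ⟨
        X ∙ ((ρ t ∙ (word u ∙ S)) ∙ word v)            ≈⟨ assoc X (ρ t ∙ (word u ∙ S)) (word v) ⟨
        (X ∙ (ρ t ∙ (word u ∙ S))) ∙ word v            ≈⟨ ∙-congʳ (to-Y e) ⟨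
        Y ∙ word v                                     ∎
        where open ≈-Reasoning

  line-unique : ∃[ j ] ∀ i → edge L i ≈ edge L′ (i + j)
  line-unique with meet
  ... | k , l , e = l - k , λ i → PSL.trans (PSL.reflexive (cong (edge L) (f i k)))
                                    (PSL.trans (agree e (i - k)) (PSL.reflexive (cong (edge L′) (g i k l))))
    where
    f : ∀ i k → i ≡ (i - k) + k
    f = solve-∀
    g : ∀ i k l → (i - k) + l ≡ i + (l - k)
    g = solve-∀

-- Existence of the axis

ConjugateToWord : SL₂ℤ → Set
ConjugateToWord M = ∃[ C ] ∃[ u ] conj C M ≈ word u

ConjugateToWord-conj : ∀ {M} C → ConjugateToWord (conj C M) → ConjugateToWord M
ConjugateToWord-conj {M} C (D , u , e) = C ∙ D , u , PSL.trans (conj-∙ C D M) e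

Hyperbolic-cong : ∀ {M N} → M ≈ N → Hyperbolic M → Hyperbolic N
Hyperbolic-cong e = subst (2 ℕ.<_) (∣trace∣-cong e)

Hyperbolic-conj : ∀ C M → Hyperbolic M → Hyperbolic (conj C M)
Hyperbolic-conj C M = subst (2 ℕ.<_) (cong ∣_∣ (sym (trace-conj C M)))

ε-not-hyperbolic : ¬ Hyperbolic ε
ε-not-hyperbolic (ℕ.s≤s (ℕ.s≤s ()))

S-not-hyperbolic : ¬ Hyperbolic S
S-not-hyperbolic ()

ρ-not-hyperbolic : ∀ t → ¬ Hyperbolic (ρ t)
ρ-not-hyperbolic false (ℕ.s≤s ())
ρ-not-hyperbolic true  (ℕ.s≤s ())

-- Conjugation moves the leading `ρ t` to the end, where it joins `S` to form one more letter.
reduce-turned-S : ∀ {M} t u → M ≈ ρ t ∙ (word u ∙ S) → ConjugateToWord M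
reduce-turned-S {M} t u e = ρ t , u ++ (t ∷ []) , conj-unique (begin
  M ∙ ρ t                                   ≈⟨ ∙-congʳ e ⟩
  (ρ t ∙ (word u ∙ S)) ∙ ρ t                ≈⟨ assoc (ρ t) (word u ∙ S) (ρ t) ⟩
  ρ t ∙ ((word u ∙ S) ∙ ρ t)                ≈⟨ ∙-congˡ (assoc (word u) S (ρ t)) ⟩
  ρ t ∙ (word u ∙ (S ∙ ρ t))                ≈⟨ ∙-congˡ (∙-congˡ (letter≈S∙ρ t)) ⟨
  ρ t ∙ (word u ∙ letter t)                 ≈⟨ ∙-congˡ (∙-congˡ (identityʳ (letter t))) ⟨
  ρ t ∙ (word u ∙ word (t ∷ []))            ≈⟨ ∙-congˡ (word-++ u (t ∷ [])) ⟨
  ρ t ∙ word (u ++ (t ∷ []))                ∎)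
  where open ≈-Reasoning

rotate-turned : ∀ {M} t v s → M ≈ ρ t ∙ word (v List.∷ʳ s) → conj (ρ (not s)) M ≈ ρ s ∙ (ρ t ∙ (word v ∙ S))
rotate-turned {M} t v s e = conj-unique (begin
  M ∙ ρ (not s)
    ≈⟨ ∙-congʳ (PSL.trans e (∙-congˡ (PSL.trans (word-++ v (s ∷ [])) (∙-congˡ (identityʳ (letter s)))))) ⟩
  (ρ t ∙ (word v ∙ letter s)) ∙ ρ (not s)            ≈⟨ assoc (ρ t) (word v ∙ letter s) (ρ (not s)) ⟩
  ρ t ∙ ((word v ∙ letter s) ∙ ρ (not s))            ≈⟨ ∙-congˡ (assoc (word v) (letter s) (ρ (not s))) ⟩
  ρ t ∙ (word v ∙ (letter s ∙ ρ (not s)))            ≈⟨ ∙-congˡ (∙-congˡ (letter∙ s (ρ (not s)))) ⟩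
  ρ t ∙ (word v ∙ (S ∙ (ρ s ∙ ρ (not s))))           ≈⟨ ∙-congˡ (∙-congˡ (PSL.trans (∙-congˡ (ρ∙ρ-not s)) (identityʳ S))) ⟩
  ρ t ∙ (word v ∙ S)                                 ≈⟨ ρ-not∙ρ∙ s (ρ t ∙ (word v ∙ S)) ⟨
  ρ (not s) ∙ (ρ s ∙ (ρ t ∙ (word v ∙ S)))           ∎)
  where open ≈-Reasoning

rotate-S : ∀ {M} t u → M ≈ word (t ∷ u) ∙ S → conj S M ≈ ρ t ∙ word u
rotate-S {M} t u e = conj-unique (begin
  M ∙ S                                  ≈⟨ ∙-congʳ e ⟩
  ((letter t ∙ word u) ∙ S) ∙ S          ≈⟨ assoc (letter t ∙ word u) S S ⟩
  (letter t ∙ word u) ∙ (S ∙ S)          ≈⟨ ∙-congˡ {letter t ∙ word u} (S∙cap true) ⟩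
  (letter t ∙ word u) ∙ ε                ≈⟨ identityʳ (letter t ∙ word u) ⟩
  letter t ∙ word u                      ≈⟨ letter∙ t (word u) ⟩
  S ∙ (ρ t ∙ word u)                     ∎)
  where open ≈-Reasoning

-- Conjugation carries the turn s of the last letter to the front. If it equals t, the two merge
-- into `ρ (not t)` and `reduce-turned-S` finishes; if not, they cancel and a word followed by `S`
-- remains, which conjugation by `S` shortens in turn. The descent could end without a word only at
-- `ρ t` or `S`, whose traces are too small.
reduce-turned : ∀ n {M} t u → length u ℕ.≤ n → Hyperbolic M → M ≈ ρ t ∙ word u → ConjugateToWord M
reduce-S : ∀ n {M} u → length u ℕ.≤ n → Hyperbolic M → M ≈ word u ∙ S → ConjugateToWord M

reduce-turned n t u u≤n h e with List.initLast u
... | [] = contradiction (Hyperbolic-cong (PSL.trans e (identityʳ (ρ t))) h) (ρ-not-hyperbolic t)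
reduce-turned zero {M} t .(v List.∷ʳ s) u≤n h e | v List.∷ʳ′ s =
  contradiction (subst (ℕ._≤ 0) (List.length-++ v) u≤n) (ℕ.<⇒≱ (ℕ.m≤n+m 1 (length v)))
reduce-turned (suc n) {M} t .(v List.∷ʳ s) u≤n h e | v List.∷ʳ′ s = ConjugateToWord-conj (ρ (not s)) (rest (≡-or-not s t))
  where
  v≤n : length v ℕ.≤ n
  v≤n = ℕ.s≤s⁻¹ (subst (ℕ._≤ suc n) (trans (List.length-++ v) (ℕ.+-comm (length v) 1)) u≤n)
  rest : s ≡ t ⊎ t ≡ not s → ConjugateToWord (conj (ρ (not s)) M)
  rest (inj₁ refl) = reduce-turned-S (not t) v (PSL.trans (rotate-turned t v t e) (ρ∙ρ∙ t (word v ∙ S)))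
  rest (inj₂ refl) = reduce-S n v v≤n (Hyperbolic-conj (ρ (not s)) M h)
    (PSL.trans (rotate-turned (not s) v s e) (ρ∙ρ-not∙ s (word v ∙ S)))

reduce-S _ [] _ h e = contradiction (Hyperbolic-cong (PSL.trans e (identityˡ S)) h) S-not-hyperbolic
reduce-S (suc n) {M} (t ∷ u) (ℕ.s≤s u≤n) h e =
  ConjugateToWord-conj S (reduce-turned n t u u≤n (Hyperbolic-conj S M h) (rotate-S t u e))

conjugateToWord : ∀ M → Hyperbolic M → ConjugateToWord M
conjugateToWord M h with normalForm M
... | plain u false e    = ε , u , PSL.trans (conj-ε M) (PSL.trans e (identityʳ (word u)))
... | plain u true e     = reduce-S (length u) u ℕ.≤-refl h e
... | turned t u false e = reduce-turned (length u) t u ℕ.≤-refl h (PSL.trans e (∙-congˡ (identityʳ (word u))))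
... | turned t u true e  = reduce-turned-S t u e

-- The periodic line spelled by a word

^-suc : ∀ X k → X ^ (ℤ.suc k) ≈ X ∙ X ^ k
^-suc X k = PSL.trans (^-homo-+ X 1ℤ k) (∙-congʳ (identityʳ X))

division-unique : ∀ d .{{_ : ℕ.NonZero d}} r k → r ℕ.< d →
                  (+ r + k * + d) ℤ.%ℕ d ≡ r × (+ r + k * + d) ℤ./ℕ d ≡ k
division-unique d r k r<d = ℤ.+-injective r′≡r , sym k≡k′
  where
  i = + r + k * + d
  r′ = i ℤ.%ℕ d
  k′ = i ℤ./ℕ d
  difference : (k - k′) * + d ≡ + r′ - + r
  difference = trans (e (+ r) k k′ (+ d)) (trans (cong (λ j → j - + r - k′ * + d) (ℤ.a≡a%ℕn+[a/ℕn]*n i d)) (f (+ r) k′ (+ d) (+ r′)))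
    where
    e : ∀ r k k′ d → (k - k′) * d ≡ (r + k * d) - r - k′ * d
    e = solve-∀
    f : ∀ r k′ d r′ → (r′ + k′ * d) - r - k′ * d ≡ r′ - r
    f = solve-∀
  ∣k-k′∣*d<d : ∣ k - k′ ∣ ℕ.* d ℕ.< d
  ∣k-k′∣*d<d = ℕ.≤-<-trans
    (ℕ.≤-reflexive (trans (sym (ℤ.abs-* (k - k′) (+ d))) (cong ∣_∣ (trans difference (ℤ.m-n≡m⊖n r′ r)))))
    (ℕ.≤-<-trans (ℤ.∣m⊝n∣≤m⊔n r′ r) (ℕ.⊔-lub (ℤ.n%ℕd<d i d) r<d))
  k≡k′ : k ≡ k′
  k≡k′ = ℤ.i-j≡0⇒i≡j k k′ (ℤ.∣i∣≡0⇒i≡0 (small ∣ k - k′ ∣ ∣k-k′∣*d<d))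
    where
    small : ∀ m → m ℕ.* d ℕ.< d → m ≡ 0
    small zero    _ = refl
    small (suc m) l = contradiction (ℕ.m≤m+n d (m ℕ.* d)) (ℕ.<⇒≱ l)
  r′≡r : + r′ ≡ + r
  r′≡r = ℤ.i-j≡0⇒i≡j (+ r′) (+ r) (trans (sym difference)
    (trans (cong (_* + d) (trans (cong (_- k′) k≡k′) (ℤ.+-inverseʳ k′))) (ℤ.*-zeroˡ (+ d))))

-- The default `false` is never reached on a line: `turnᴾ` asks only for remainders below the length
-- of the word.
nth : List Bool → ℕ → Bool
nth []      _       = false
nth (t ∷ _) zero    = t
nth (_ ∷ u) (suc n) = nth u n

word-take-suc : ∀ u n → n ℕ.< length u → word (List.take (suc n) u) ≈ word (List.take n u) ∙ letter (nth u n)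
word-take-suc (t ∷ u) zero    _ = PSL.trans (identityʳ (letter t)) (PSL.sym (identityˡ (letter t)))
word-take-suc (t ∷ u) (suc n) (ℕ.s≤s n<u) =
  PSL.trans (∙-congˡ (word-take-suc u n n<u)) (PSL.sym (assoc (letter t) (word (List.take n u)) (letter (nth u n))))

module PeriodicLine {M C : SL₂ℤ} (h : Hyperbolic M) (t : Bool) (v : List Bool)
                    (conj≈word : conj C M ≈ word (t ∷ v)) where

  u = t ∷ v
  ℓ = length u

  prefix : ℤ → ℕ → SL₂ℤ
  prefix k r = M ^ k ∙ (C ∙ word (List.take r u))

  ^-suc′ : ∀ k → M ^ (ℤ.suc k) ≈ M ^ k ∙ M
  ^-suc′ k = PSL.trans (PSL.reflexive (cong (M ^_) (ℤ.+-comm 1ℤ k)))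
    (PSL.trans (^-homo-+ M k 1ℤ) (∙-congˡ (identityʳ M)))

  prefix-suc : ∀ k r → prefix (ℤ.suc k) r ≈ M ∙ prefix k r
  prefix-suc k r = PSL.trans (∙-congʳ (^-suc M k)) (assoc M (M ^ k) (C ∙ word (List.take r u)))

  prefix-wrap : ∀ k → prefix k ℓ ≈ prefix (ℤ.suc k) 0
  prefix-wrap k = begin
    M ^ k ∙ (C ∙ word (List.take ℓ u))     ≡⟨ cong (λ w → M ^ k ∙ (C ∙ word w)) (List.take-all ℓ u ℕ.≤-refl) ⟩
    M ^ k ∙ (C ∙ word u)                   ≈⟨ ∙-congˡ (∙-congˡ conj≈word) ⟨
    M ^ k ∙ (C ∙ conj C M)                 ≈⟨ ∙-congˡ (∙-conj C M) ⟩
    M ^ k ∙ (M ∙ C)                        ≈⟨ assoc (M ^ k) M C ⟨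
    (M ^ k ∙ M) ∙ C                        ≈⟨ ∙-cong (PSL.sym (^-suc′ k)) (PSL.sym (identityʳ C)) ⟩
    M ^ (ℤ.suc k) ∙ (C ∙ ε)                ∎
    where open ≈-Reasoning

  edgeᴾ : ℤ → SL₂ℤ
  edgeᴾ i = prefix (i ℤ./ℕ ℓ) (i ℤ.%ℕ ℓ)

  turnᴾ : ℤ → Bool
  turnᴾ i = nth u (i ℤ.%ℕ ℓ)

  edge-at : ∀ k r → r ℕ.< ℓ → edgeᴾ (+ r + k * + ℓ) ≈ prefix k r
  edge-at k r r<ℓ = PSL.reflexive (cong₂ prefix (proj₂ unique) (proj₁ unique))
    where unique = division-unique ℓ r k r<ℓ

  -- Admitting r = ℓ lets the last letter of a period be treated like the others: the full word at
  -- power k is the empty word at the next power.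
  edge-at-≤ : ∀ k r → r ℕ.≤ ℓ → edgeᴾ (+ r + k * + ℓ) ≈ prefix k r
  edge-at-≤ k r r≤ℓ with ℕ.m≤n⇒m<n∨m≡n r≤ℓ
  ... | inj₁ r<ℓ  = edge-at k r r<ℓ
  ... | inj₂ refl = PSL.trans (PSL.reflexive (cong edgeᴾ (e (+ ℓ) k)))
                      (PSL.trans (edge-at (ℤ.suc k) 0 ℕ.z<s) (PSL.sym (prefix-wrap k)))
    where
    e : ∀ l k → l + k * l ≡ 0ℤ + (1ℤ + k) * l
    e = solve-∀

  line : Line M
  line = record
    { hyperbolic = h
    ; edge       = edgeᴾ
    ; turn       = turnᴾ
    ; step       = λ i → stepᴾ i (i ℤ.%ℕ ℓ) (i ℤ./ℕ ℓ) (ℤ.n%ℕd<d i ℓ) (ℤ.a≡a%ℕn+[a/ℕn]*n i ℓ)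
    ; period     = length v
    ; translates = λ i → translatesᴾ i (i ℤ.%ℕ ℓ) (i ℤ./ℕ ℓ) (ℤ.n%ℕd<d i ℓ) (ℤ.a≡a%ℕn+[a/ℕn]*n i ℓ)
    }
    where
    stepᴾ : ∀ i r k → r ℕ.< ℓ → i ≡ + r + k * + ℓ → edgeᴾ (ℤ.suc i) ≈ prefix k r ∙ letter (nth u r)
    stepᴾ i r k r<ℓ i≡ = begin
      edgeᴾ (ℤ.suc i)
        ≡⟨ cong edgeᴾ (trans (cong ℤ.suc i≡) (sym (ℤ.+-assoc 1ℤ (+ r) (k * + ℓ)))) ⟩
      edgeᴾ (+ suc r + k * + ℓ)                                          ≈⟨ edge-at-≤ k (suc r) r<ℓ ⟩
      M ^ k ∙ (C ∙ word (List.take (suc r) u))                           ≈⟨ ∙-congˡ (∙-congˡ (word-take-suc u r r<ℓ)) ⟩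
      M ^ k ∙ (C ∙ (word (List.take r u) ∙ letter (nth u r)))            ≈⟨ ∙-congˡ (assoc C (word (List.take r u)) (letter (nth u r))) ⟨
      M ^ k ∙ ((C ∙ word (List.take r u)) ∙ letter (nth u r))            ≈⟨ assoc (M ^ k) (C ∙ word (List.take r u)) (letter (nth u r)) ⟨
      prefix k r ∙ letter (nth u r)                                      ∎
      where open ≈-Reasoning
    translatesᴾ : ∀ i r k → r ℕ.< ℓ → i ≡ + r + k * + ℓ → M ∙ prefix k r ≈ edgeᴾ (i + + ℓ)
    translatesᴾ i r k r<ℓ i≡ = PSL.trans (PSL.sym (prefix-suc k r)) (PSL.trans (PSL.sym (edge-at (ℤ.suc k) r r<ℓ))
      (PSL.reflexive (cong edgeᴾ (sym (trans (cong (_+ + ℓ) i≡) (e (+ r) k (+ ℓ)))))))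
      where
      e : ∀ r k l → (r + k * l) + l ≡ r + (1ℤ + k) * l
      e = solve-∀

axis-line : ∀ M → Hyperbolic M → Line M
axis-line M h with conjugateToWord M h
... | C , []    , e = contradiction (Hyperbolic-cong e (Hyperbolic-conj C M h)) ε-not-hyperbolic
... | C , t ∷ v , e = PeriodicLine.line {M} {C} h t v e

-- Axes and lines

S≉ε : ¬ (S ≈ ε)
S≉ε (same ())
S≉ε (opposite ())

ρ≉ε : ∀ t → ¬ (ρ t ≈ ε)
ρ≉ε false (same ())
ρ≉ε false (opposite ())
ρ≉ε true  (same ())
ρ≉ε true  (opposite ())

R^1≈ρ : R ^ℕ 1 ≈ ρ false
R^1≈ρ = identityʳ R

R^2≈ρ : R ^ℕ 2 ≈ ρ true
R^2≈ρ = opposite refl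

line⇒axis : ∀ {M} → Line M → OrientedAxis M
line⇒axis {M} L = record
  { line            = record { before = edge L ; after = λ i → edge L i ∙ S ; at-⊗ = at-⊗ ; at-• = at-• }
  ; nonBacktracking = record
    { turns-⊗ = λ i e → S≉ε (∙-cancelˡ (edge L i) S ε (PSL.trans (PSL.sym e) (PSL.sym (identityʳ (edge L i)))))
    ; turns-• = λ i e → ρ≉ε (turn L i) (∙-cancelˡ (edge L i ∙ S) (ρ (turn L i)) ε
        (PSL.trans (PSL.sym (next i)) (PSL.trans (PSL.sym e) (PSL.sym (identityʳ (edge L i ∙ S))))))
    }
  ; length            = +[1+ period L ]
  ; length≢0          = λ ()
  ; translates-before = translates L
  ; translates-after  = λ i → PSL.trans (PSL.sym (assoc M (edge L i) S)) (∙-congʳ (translates L i))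
  }
  where
  next : ∀ i → edge L (ℤ.suc i) ≈ (edge L i ∙ S) ∙ ρ (turn L i)
  next i = PSL.trans (step L i) (PSL.trans (∙-congˡ (letter≈S∙ρ (turn L i))) (PSL.sym (assoc (edge L i) S (ρ (turn L i)))))
  at-⊗ : ∀ i → Σ[ k ∈ Fin 2 ] edge L i ∙ S ^ℕ toℕ k ≈ edge L i ∙ S
  at-⊗ i = suc zero , ∙-congˡ (identityʳ S)
  at-• : ∀ i → Σ[ k ∈ Fin 3 ] (edge L i ∙ S) ∙ R ^ℕ toℕ k ≈ edge L (ℤ.suc i)
  at-• i with turn L i | next i
  ... | false | e = suc zero , PSL.trans (∙-congˡ R^1≈ρ) (PSL.sym e)
  ... | true  | e = suc (suc zero) , PSL.trans (∙-congˡ R^2≈ρ) (PSL.sym e)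

module _ {w : Walk 𝓕} (nb : NonBacktracking w) where
  open Walk w
  open NonBacktracking nb

  after≈before∙S : ∀ i → after i ≈ before i ∙ S
  after≈before∙S i with at-⊗ i
  ... | zero     , e = contradiction (PSL.trans (PSL.sym (identityʳ (before i))) e) (turns-⊗ i)
  ... | suc zero , e = PSL.trans (PSL.sym e) (∙-congˡ (identityʳ S))

  after∙ρ : ∀ i t {X} → X ≈ ρ t → after i ∙ X ≈ before i ∙ letter t
  after∙ρ i t e = PSL.trans (∙-cong (after≈before∙S i) e)
    (PSL.trans (assoc (before i) S (ρ t)) (∙-congˡ (PSL.sym (letter≈S∙ρ t))))

  walk-step : ∀ i → ∃[ t ] before (ℤ.suc i) ≈ before i ∙ letter t
  walk-step i with at-• i
  ... | zero           , e = contradiction (PSL.trans (PSL.sym (identityʳ (after i))) e) (turns-• i)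
  ... | suc zero       , e = false , PSL.trans (PSL.sym e) (after∙ρ i false {R ^ℕ 1} R^1≈ρ)
  ... | suc (suc zero) , e = true , PSL.trans (PSL.sym e) (after∙ρ i true {R ^ℕ 2} R^2≈ρ)

-- ℓ is the signed translation length of M; towards M ℓ translates forwards.
towards : SL₂ℤ → ℤ → SL₂ℤ
towards M (+ _)    = M
towards M -[1+ _ ] = M ⁻¹

Hyperbolic-⁻¹ : ∀ M → Hyperbolic M → Hyperbolic (M ⁻¹)
Hyperbolic-⁻¹ (⟦ p , q , r , s ⟧ ,det=1: _) = subst (λ t → 2 ℕ.< ∣ t ∣) (ℤ.+-comm p s)

Hyperbolic-towards : ∀ M ℓ → Hyperbolic M → Hyperbolic (towards M ℓ)
Hyperbolic-towards M (+ _)    h = h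
Hyperbolic-towards M -[1+ _ ] h = Hyperbolic-⁻¹ M h

axis⇒line : ∀ {M} → Hyperbolic M → (axis : OrientedAxis M) → Line (towards M (OrientedAxis.length axis))
axis⇒line {M} h axis = record
  { hyperbolic = Hyperbolic-towards M ℓ h
  ; edge       = before
  ; turn       = λ i → proj₁ (walk-step nonBacktracking i)
  ; step       = λ i → proj₂ (walk-step nonBacktracking i)
  ; period     = ℕ.pred ∣ ℓ ∣
  ; translates = forwards ℓ length≢0 translates-before
  }
  where
  open OrientedAxis axis renaming (length to ℓ; line to walk)
  open Walk walk
  forwards : ∀ ℓ → ¬ (ℓ ≡ 0ℤ) → (∀ i → M ∙ before i ≈ before (i + ℓ)) →
             ∀ i → towards M ℓ ∙ before i ≈ before (i + +[1+ ℕ.pred ∣ ℓ ∣ ])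
  forwards +0       ℓ≢0 e i = contradiction refl ℓ≢0
  forwards +[1+ n ] _   e i = e i
  forwards -[1+ n ] _   e i = PSL.trans
    (∙-congˡ (PSL.sym (PSL.trans (e (i + +[1+ n ])) (PSL.reflexive (cong before (cancel i +[1+ n ]))))))
    (\\-leftDividesʳ M (before (i + +[1+ n ])))
    where
    cancel : ∀ i n → i + n - n ≡ i
    cancel = solve-∀

-- Powers of a generator and transport of lines

^ℕ-cong : ∀ {X Y} n → X ≈ Y → X ^ℕ n ≈ Y ^ℕ n
^ℕ-cong zero    e = PSL.refl
^ℕ-cong (suc n) e = ∙-cong e (^ℕ-cong n e)

⁻¹-^ : ∀ X k → (X ⁻¹) ^ (- k) ≈ X ^ k
⁻¹-^ X +0       = PSL.refl
⁻¹-^ X +[1+ n ] = ^ℕ-cong (suc n) (⁻¹-involutive X)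
⁻¹-^ X -[1+ n ] = PSL.refl

power-of-towards : ∀ M ℓ k → ∃[ l ] M ^ k ≈ towards M ℓ ^ l
power-of-towards M (+ _)    k = k , PSL.refl
power-of-towards M -[1+ _ ] k = - k , PSL.sym (⁻¹-^ M k)

towards-power : ∀ M ℓ k → ∃[ l ] towards M ℓ ^ k ≈ M ^ l
towards-power M (+ _)    k = k , PSL.refl
towards-power M -[1+ _ ] k = - k , PSL.trans (PSL.reflexive (cong ((M ⁻¹) ^_) (sym (ℤ.neg-involutive k)))) (⁻¹-^ M (- k))

intertwine-^ : ∀ {g m n} → g ∙ m ≈ n ∙ g → ∀ k → g ∙ m ^ k ≈ n ^ k ∙ g
intertwine-^ {g} {m} {n} e = ℤ-induction _ (PSL.trans (identityʳ g) (PSL.sym (identityˡ g))) up down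
  where
  open ≈-Reasoning
  up : ∀ k → g ∙ m ^ k ≈ n ^ k ∙ g → g ∙ m ^ ℤ.suc k ≈ n ^ ℤ.suc k ∙ g
  up k f = begin
    g ∙ m ^ ℤ.suc k       ≈⟨ ∙-congˡ (^-suc m k) ⟩
    g ∙ (m ∙ m ^ k)       ≈⟨ assoc g m (m ^ k) ⟨
    (g ∙ m) ∙ m ^ k       ≈⟨ ∙-congʳ e ⟩
    (n ∙ g) ∙ m ^ k       ≈⟨ assoc n g (m ^ k) ⟩
    n ∙ (g ∙ m ^ k)       ≈⟨ ∙-congˡ f ⟩
    n ∙ (n ^ k ∙ g)       ≈⟨ assoc n (n ^ k) g ⟨
    (n ∙ n ^ k) ∙ g       ≈⟨ ∙-congʳ (^-suc n k) ⟨
    n ^ ℤ.suc k ∙ g       ∎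
  down : ∀ k → g ∙ m ^ ℤ.suc k ≈ n ^ ℤ.suc k ∙ g → g ∙ m ^ k ≈ n ^ k ∙ g
  down k f = ∙-cancelˡ n (g ∙ m ^ k) (n ^ k ∙ g) (begin
    n ∙ (g ∙ m ^ k)       ≈⟨ assoc n g (m ^ k) ⟨
    (n ∙ g) ∙ m ^ k       ≈⟨ ∙-congʳ e ⟨
    (g ∙ m) ∙ m ^ k       ≈⟨ assoc g m (m ^ k) ⟩
    g ∙ (m ∙ m ^ k)       ≈⟨ ∙-congˡ (^-suc m k) ⟨
    g ∙ m ^ ℤ.suc k       ≈⟨ f ⟩
    n ^ ℤ.suc k ∙ g       ≈⟨ ∙-congʳ (^-suc n k) ⟩
    (n ∙ n ^ k) ∙ g       ≈⟨ assoc n (n ^ k) g ⟩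
    n ∙ (n ^ k ∙ g)       ∎)

translates-^ : ∀ {N} (L : Line N) k i → N ^ k ∙ edge L i ≈ edge L (i + k * +[1+ period L ])
translates-^ {N} L = ℤ-induction _
  (λ i → PSL.trans (identityˡ (edge L i)) (PSL.reflexive (cong (edge L) (sym (e₀ i ℓ))))) up down
  where
  open ≈-Reasoning
  ℓ = +[1+ period L ]
  e₀ : ∀ i l → i + 0ℤ * l ≡ i
  e₀ = solve-∀
  e : ∀ i k l → i + k * l + l ≡ i + (1ℤ + k) * l
  e = solve-∀
  N∙N^ : ∀ k i → N ^ ℤ.suc k ∙ edge L i ≈ N ∙ (N ^ k ∙ edge L i)
  N∙N^ k i = PSL.trans (∙-congʳ (^-suc N k)) (assoc N (N ^ k) (edge L i))
  N∙edge : ∀ k i → N ∙ edge L (i + k * ℓ) ≈ edge L (i + ℤ.suc k * ℓ)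
  N∙edge k i = PSL.trans (translates L (i + k * ℓ)) (PSL.reflexive (cong (edge L) (e i k ℓ)))
  up : ∀ k → (∀ i → N ^ k ∙ edge L i ≈ edge L (i + k * ℓ)) → ∀ i → N ^ ℤ.suc k ∙ edge L i ≈ edge L (i + ℤ.suc k * ℓ)
  up k f i = PSL.trans (N∙N^ k i) (PSL.trans (∙-congˡ (f i)) (N∙edge k i))
  down : ∀ k → (∀ i → N ^ ℤ.suc k ∙ edge L i ≈ edge L (i + ℤ.suc k * ℓ)) → ∀ i → N ^ k ∙ edge L i ≈ edge L (i + k * ℓ)
  down k f i = ∙-cancelˡ N _ _ (PSL.trans (PSL.sym (N∙N^ k i)) (PSL.trans (f i) (PSL.sym (N∙edge k i))))

transport-line : ∀ {g m n} → g ∙ m ≈ n ∙ g → Line m → Line n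
transport-line {g} {m} {n} e L = record
  { hyperbolic = Hyperbolic-cong (conj-unique {g ⁻¹} m≈) (Hyperbolic-conj (g ⁻¹) m (hyperbolic L))
  ; edge       = λ i → g ∙ edge L i
  ; turn       = turn L
  ; step       = λ i → PSL.trans (∙-congˡ (step L i)) (PSL.sym (assoc g (edge L i) (letter (turn L i))))
  ; period     = period L
  ; translates = λ i → PSL.trans (PSL.sym (assoc n g (edge L i))) (PSL.trans (∙-congʳ (PSL.sym e))
                         (PSL.trans (assoc g m (edge L i)) (∙-congˡ (translates L i))))
  }
  where
  m≈ : m ∙ g ⁻¹ ≈ g ⁻¹ ∙ n
  m≈ = ∙-cancelˡ g _ _ (begin
    g ∙ (m ∙ g ⁻¹)    ≈⟨ assoc g m (g ⁻¹) ⟨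
    (g ∙ m) ∙ g ⁻¹    ≈⟨ ∙-congʳ e ⟩
    (n ∙ g) ∙ g ⁻¹    ≈⟨ //-rightDividesʳ g n ⟩
    n                 ≈⟨ \\-leftDividesˡ g n ⟨
    g ∙ (g ⁻¹ ∙ n)    ∎)
    where open ≈-Reasoning

-- Çarks and hyperbolic elements

module Oriented (Γ : OrientedÇark) where
  open OrientedÇark Γ public using (base; M)
  open OrientedAxis (OrientedÇark.axis Γ) public using (nonBacktracking) renaming (length to ℓ; line to walk)
  generator : SL₂ℤ
  generator = towards M ℓ
  line : Line generator
  line = axis⇒line (OrientedÇark.hyperbolic Γ) (OrientedÇark.axis Γ)

-- Left multiplication by `base ⁻¹` moves the base edge to `ε` and turns the generator that follows
-- the orientation into this conjugate.
element : OrientedÇark → HyperbolicElement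
element Γ = conj base generator , Hyperbolic-conj base generator (hyperbolic line)
  where open Oriented Γ

-- An isomorphism of graphs commutes with the right multiplication by S and R,
-- hence by everything; so it is the left multiplication by g = b′ b⁻¹, where b
-- and b′ are the base edges.
module FromIso {Γ Δ : OrientedÇark} (iso : Γ ≅ Δ) where
  open _≅_ iso
  open _≅ᴿ_ graph-iso
  private
    module Γ  = Oriented Γ
    module Δ  = Oriented Δ
    module EΓ = RibbonGraph.Edge (OrientedÇark.graph Γ)
    module E  = RibbonGraph.Edge (OrientedÇark.graph Δ)

  g : SL₂ℤ
  g = Δ.base ∙ Γ.base ⁻¹

  act : ∀ {X Y} W → X E.≈ Y → (X ∙ W) E.≈ (Y ∙ W)
  act {X} W (k , e) = k , PSL.trans (PSL.sym (assoc (Δ.M ^ k) X W)) (∙-congʳ e)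

  ≈⇒E≈ : ∀ {X Y} → X ≈ Y → X E.≈ Y
  ≈⇒E≈ {X} e = 0ℤ , PSL.trans (identityˡ X) e

  to-≈ : ∀ {X Y} → X ≈ Y → to X E.≈ to Y
  to-≈ {X} e = Inverse.to-cong edges (0ℤ , PSL.trans (identityˡ X) e)

  to-∙ : ∀ W X → to (X ∙ W) E.≈ (to X ∙ W)
  to-∙ = Generation.generated (λ W → ∀ X → to (X ∙ W) E.≈ (to X ∙ W)) resp base-case
           (λ {W} → closed S W (VerticesIso.rotation ⊗-iso)) (λ {W} → closed R W (VerticesIso.rotation •-iso))
    where
    resp : ∀ {V W} → V ≈ W → (∀ X → to (X ∙ V) E.≈ (to X ∙ V)) → ∀ X → to (X ∙ W) E.≈ (to X ∙ W)
    resp e f X = E.trans (to-≈ (∙-congˡ (PSL.sym e))) (E.trans (f X) (≈⇒E≈ (∙-congˡ e)))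
    base-case : ∀ X → to (X ∙ ε) E.≈ (to X ∙ ε)
    base-case X = E.trans (to-≈ (identityʳ X)) (≈⇒E≈ (PSL.sym (identityʳ (to X))))
    closed : ∀ T W → (∀ X → to (X ∙ T) E.≈ (to X ∙ T)) → (∀ X → to (X ∙ W) E.≈ (to X ∙ W)) →
             ∀ X → to (X ∙ (T ∙ W)) E.≈ (to X ∙ (T ∙ W))
    closed T W rot f X = E.trans (to-≈ (PSL.sym (assoc X T W))) (E.trans (f (X ∙ T))
      (E.trans (act W (rot X)) (≈⇒E≈ (assoc (to X) T W))))

  to≈g∙ : ∀ X → to X E.≈ (g ∙ X)
  to≈g∙ X = E.trans (to-≈ (PSL.sym (\\-leftDividesˡ Γ.base X)))
    (E.trans (to-∙ (Γ.base ⁻¹ ∙ X) Γ.base)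
    (E.trans (act (Γ.base ⁻¹ ∙ X) base-edge)
             (≈⇒E≈ (PSL.sym (assoc Δ.base (Γ.base ⁻¹) X)))))

  power : ∀ {X Y} → X E.≈ Y → ∃[ k ] Δ.generator ^ k ∙ X ≈ Y
  power (k , e) with power-of-towards Δ.M Δ.ℓ k
  ... | l , f = l , PSL.trans (∙-congʳ (PSL.sym f)) e

  ε≈generator : ε EΓ.≈ Γ.generator
  ε≈generator with towards-power Γ.M Γ.ℓ 1ℤ
  ... | k , f = k , PSL.trans (identityʳ (Γ.M ^ k)) (PSL.trans (PSL.sym f) (identityʳ Γ.generator))

  g∙-cong : ∀ {X Y} → X EΓ.≈ Y → (g ∙ X) E.≈ (g ∙ Y)
  g∙-cong {X} {Y} e = E.trans {g ∙ X} {to X} {g ∙ Y} (E.sym {to X} {g ∙ X} (to≈g∙ X))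
    (E.trans {to X} {to Y} {g ∙ Y} (Inverse.to-cong edges e) (to≈g∙ Y))

  g∙-power : ∀ {X Y} → X EΓ.≈ Y → ∃[ k ] Δ.generator ^ k ∙ (g ∙ X) ≈ g ∙ Y
  g∙-power {X} {Y} e = power {g ∙ X} {g ∙ Y} (g∙-cong {X} {Y} e)

  -- `ε` and the generator represent the same edge of the first quotient, so their images g and
  -- `g ∙ Γ.generator` differ by a power of the second generator, for now an unknown one.
  intertwines : ∃[ k ] g ∙ Γ.generator ≈ Δ.generator ^ k ∙ g
  intertwines = drop-ε (g∙-power {ε} {Γ.generator} ε≈generator)
    where
    drop-ε : ∃[ k ] Δ.generator ^ k ∙ (g ∙ ε) ≈ g ∙ Γ.generator → ∃[ k ] g ∙ Γ.generator ≈ Δ.generator ^ k ∙ g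
    drop-ε (k , e) = k , PSL.trans (PSL.sym e) (∙-congˡ {Δ.generator ^ k} {g ∙ ε} {g} (identityʳ g))

  on-line : ∀ i → ∃[ a ] g ∙ edge Γ.line i ≈ edge Δ.line a
  on-line i = locate (power {edge Δ.line j} {g ∙ edge Γ.line i} (E.trans {edge Δ.line j} {to (edge Γ.line i)} {g ∙ edge Γ.line i}
      (E.sym {to (edge Γ.line i)} {edge Δ.line j} (proj₁ (proj₂ spine-walk i))) (to≈g∙ (edge Γ.line i))))
    where
    j = i + proj₁ spine-walk
    locate : ∃[ k ] Δ.generator ^ k ∙ edge Δ.line j ≈ g ∙ edge Γ.line i → ∃[ a ] g ∙ edge Γ.line i ≈ edge Δ.line a
    locate (k , e) = j + k * +[1+ period Δ.line ] , PSL.trans (PSL.sym e) (translates-^ Δ.line k j)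

  -- `on-line` locates each edge separately, with an index that may jump. But the image of the next
  -- edge lies somewhere on the line, hence satisfies the sign condition, and this forces its turn,
  -- so that the indices advance together.
  follows : ∀ {a} → g ∙ edge Γ.line 0ℤ ≈ edge Δ.line a → ∀ n → g ∙ edge Γ.line (+ n) ≈ edge Δ.line (a + + n)
  follows {a} e zero    = PSL.trans e (PSL.reflexive (cong (edge Δ.line) (sym (ℤ.+-identityʳ a))))
  follows {a} e (suc n) = begin
    g ∙ edge Γ.line +[1+ n ]                              ≈⟨ g∙step ⟩
    (g ∙ edge Γ.line (+ n)) ∙ letter t                    ≈⟨ ∙-cong (follows e n) (PSL.reflexive (cong letter t≡t′)) ⟩
    edge Δ.line b ∙ letter t′                             ≈⟨ step Δ.line b ⟨
    edge Δ.line (ℤ.suc b)                                 ≡⟨ cong (edge Δ.line) (suc-+ a (+ n)) ⟩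
    edge Δ.line (a + +[1+ n ])                            ∎
    where
    open ≈-Reasoning
    b = a + + n
    t = turn Γ.line (+ n)
    t′ = turn Δ.line b
    a′ = proj₁ (on-line +[1+ n ])
    g∙step : g ∙ edge Γ.line +[1+ n ] ≈ (g ∙ edge Γ.line (+ n)) ∙ letter t
    g∙step = PSL.trans (∙-congˡ (step Γ.line (+ n))) (PSL.sym (assoc g (edge Γ.line (+ n)) (letter t)))
    t≡t′ : t ≡ t′
    t≡t′ = sym (same-next-letter {Δ.generator} (edge Δ.line b) t′ t [] (step Δ.line b)
      (begin
        edge Δ.line a′                          ≈⟨ proj₂ (on-line +[1+ n ]) ⟨
        g ∙ edge Γ.line +[1+ n ]                ≈⟨ g∙step ⟩
        (g ∙ edge Γ.line (+ n)) ∙ letter t      ≈⟨ ∙-cong (follows e n) (PSL.sym (identityʳ (letter t))) ⟩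
        edge Δ.line b ∙ (letter t ∙ ε)          ∎)
      (flows Δ.line (ℤ.suc b)) (flows Δ.line a′))

  -- The image of the edge one period further on is located twice: following the line gives index a
  -- + p, the intertwining gives a + k p′, and the edges of a line are distinct.
  period-multiple : ∃[ k ] (g ∙ Γ.generator ≈ Δ.generator ^ k ∙ g) × (+[1+ period Γ.line ] ≡ k * +[1+ period Δ.line ])
  period-multiple = compare intertwines (on-line 0ℤ)
    where
    p  = +[1+ period Γ.line ]
    p′ = +[1+ period Δ.line ]
    compare : ∃[ k ] g ∙ Γ.generator ≈ Δ.generator ^ k ∙ g → ∃[ a ] g ∙ edge Γ.line 0ℤ ≈ edge Δ.line a →
              ∃[ k ] (g ∙ Γ.generator ≈ Δ.generator ^ k ∙ g) × (p ≡ k * p′)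
    compare (k , e) (a , f) = k , e , +-cancelˡ a p (k * p′) (edge-injective Δ.line (a + p) (a + k * p′) (begin
      edge Δ.line (a + p)                       ≈⟨ follows f (suc (period Γ.line)) ⟨
      g ∙ edge Γ.line p                         ≡⟨ cong (λ j → g ∙ edge Γ.line j) (ℤ.+-identityˡ p) ⟨
      g ∙ edge Γ.line (0ℤ + p)                  ≈⟨ ∙-congˡ (translates Γ.line 0ℤ) ⟨
      g ∙ (Γ.generator ∙ edge Γ.line 0ℤ)        ≈⟨ assoc g Γ.generator (edge Γ.line 0ℤ) ⟨
      (g ∙ Γ.generator) ∙ edge Γ.line 0ℤ        ≈⟨ ∙-congʳ e ⟩
      (Δ.generator ^ k ∙ g) ∙ edge Γ.line 0ℤ    ≈⟨ assoc (Δ.generator ^ k) g (edge Γ.line 0ℤ) ⟩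
      Δ.generator ^ k ∙ (g ∙ edge Γ.line 0ℤ)    ≈⟨ ∙-congˡ f ⟩
      Δ.generator ^ k ∙ edge Δ.line a           ≈⟨ translates-^ Δ.line k a ⟩
      edge Δ.line (a + k * p′)                  ∎))
      where open ≈-Reasoning

-- Positivity of both lengths excludes k = -1, which would reverse the spine, and mutual
-- divisibility excludes proper powers.
mutual-multiples : ∀ m n k l → +[1+ m ] ≡ k * +[1+ n ] → +[1+ n ] ≡ l * +[1+ m ] → k ≡ 1ℤ
mutual-multiples m n k l e f = ℤ.*-cancelʳ-≡ k 1ℤ +[1+ n ] (trans (sym e) (trans (cong +_ m≡n) (sym (ℤ.*-identityˡ +[1+ n ]))))
  where
  m≡n : suc m ≡ suc n
  m≡n = ℕ.∣-antisym (ℕ.divides ∣ l ∣ (trans (cong ∣_∣ f) (ℤ.abs-* l +[1+ m ])))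
                    (ℕ.divides ∣ k ∣ (trans (cong ∣_∣ e) (ℤ.abs-* k +[1+ n ])))

intertwines⇒conj≈ : ∀ {b b′ m n} → (b′ ∙ b ⁻¹) ∙ m ≈ n ∙ (b′ ∙ b ⁻¹) → conj b m ≈ conj b′ n
intertwines⇒conj≈ {b} {b′} {m} {n} e = conj-unique (∙-cancelˡ g _ _ (begin
  g ∙ (m ∙ b)                   ≈⟨ assoc g m b ⟨
  (g ∙ m) ∙ b                   ≈⟨ ∙-congʳ e ⟩
  (n ∙ g) ∙ b                   ≈⟨ assoc n g b ⟩
  n ∙ (g ∙ b)                   ≈⟨ ∙-congˡ (//-rightDividesˡ b b′) ⟩
  n ∙ b′                        ≈⟨ ∙-conj b′ n ⟨
  b′ ∙ conj b′ n                ≈⟨ ∙-congʳ (//-rightDividesˡ b b′) ⟨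
  (g ∙ b) ∙ conj b′ n           ≈⟨ assoc g b (conj b′ n) ⟩
  g ∙ (b ∙ conj b′ n)           ∎))
  where
  open ≈-Reasoning
  g = b′ ∙ b ⁻¹

conj≈⇒intertwines : ∀ {b b′ m n} → conj b m ≈ conj b′ n → (b′ ∙ b ⁻¹) ∙ m ≈ n ∙ (b′ ∙ b ⁻¹)
conj≈⇒intertwines {b} {b′} {m} {n} e = ∙-cancelʳ b _ _ (begin
  (g ∙ m) ∙ b                   ≈⟨ assoc g m b ⟩
  g ∙ (m ∙ b)                   ≈⟨ ∙-congˡ (∙-conj b m) ⟨
  g ∙ (b ∙ conj b m)            ≈⟨ assoc g b (conj b m) ⟨
  (g ∙ b) ∙ conj b m            ≈⟨ ∙-cong (//-rightDividesˡ b b′) e ⟩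
  b′ ∙ conj b′ n                ≈⟨ ∙-conj b′ n ⟩
  n ∙ b′                        ≈⟨ ∙-congˡ (//-rightDividesˡ b b′) ⟨
  n ∙ (g ∙ b)                   ≈⟨ assoc n g b ⟨
  (n ∙ g) ∙ b                   ∎)
  where
  open ≈-Reasoning
  g = b′ ∙ b ⁻¹

element-cong : ∀ {Γ Δ} → Γ ≅ Δ → proj₁ (element Γ) ≈ proj₁ (element Δ)
element-cong {Γ} {Δ} iso = combine (FromIso.period-multiple iso)
                                   (FromIso.period-multiple (Setoid.sym orientedÇarks {Γ} {Δ} iso))
  where
  module Γ = Oriented Γ
  module Δ = Oriented Δ
  g = Δ.base ∙ Γ.base ⁻¹
  p  = period Γ.line
  p′ = period Δ.line
  combine : ∃[ k ] (g ∙ Γ.generator ≈ Δ.generator ^ k ∙ g) × (+[1+ p ] ≡ k * +[1+ p′ ]) →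
            ∃[ l ] ((Γ.base ∙ Δ.base ⁻¹) ∙ Δ.generator ≈ Γ.generator ^ l ∙ (Γ.base ∙ Δ.base ⁻¹)) × (+[1+ p′ ] ≡ l * +[1+ p ]) →
            conj Γ.base Γ.generator ≈ conj Δ.base Δ.generator
  combine (k , e , f) (l , _ , f′) = intertwines⇒conj≈ {Γ.base} {Δ.base} (PSL.trans e (∙-congʳ {g} (PSL.trans
    (PSL.reflexive (cong (Δ.generator ^_) (mutual-multiples p p′ k l f f′))) (identityʳ Δ.generator))))

module ToIso {M N g} (to-power : ∀ k → ∃[ l ] g ∙ M ^ k ≈ N ^ l ∙ g)
                     (from-power : ∀ k → ∃[ l ] g ⁻¹ ∙ N ^ k ≈ M ^ l ∙ g ⁻¹) where

  translation : (L : LeftInvariantEquivalence) → Inverse (⟨ M ⟩＼ L) (⟨ N ⟩＼ L)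
  translation L = record
    { to        = g ∙_
    ; from      = g ⁻¹ ∙_
    ; to-cong   = moves to-power
    ; from-cong = moves from-power
    ; inverse   = (λ {X} e → Setoid.trans (⟨ N ⟩＼ L) (moves to-power e)
                    (0ℤ , reflexive (PSL.trans (identityˡ _) (\\-leftDividesˡ g X))))
                , (λ {X} e → Setoid.trans (⟨ M ⟩＼ L) (moves from-power e)
                    (0ℤ , reflexive (PSL.trans (identityˡ _) (\\-leftDividesʳ g X))))
    }
    where
    open LeftInvariantEquivalence L
    moves : ∀ {h M N} → (∀ k → ∃[ l ] h ∙ M ^ k ≈ N ^ l ∙ h) →
            ∀ {X Y} → Setoid._≈_ (⟨ M ⟩＼ L) X Y → Setoid._≈_ (⟨ N ⟩＼ L) (h ∙ X) (h ∙ Y)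
    moves {h} {M} {N} power {X} (k , e) with power k
    ... | l , f = l , IsEquivalence.trans isEquivalence (reflexive (begin
      N ^ l ∙ (h ∙ X)     ≈⟨ assoc (N ^ l) h X ⟨
      (N ^ l ∙ h) ∙ X     ≈⟨ ∙-congʳ f ⟨
      (h ∙ M ^ k) ∙ X     ≈⟨ assoc h (M ^ k) X ⟩
      h ∙ (M ^ k ∙ X)     ∎)) (invariant h e)
      where open ≈-Reasoning

  vertices-iso : ∀ T n .{{_ : ℕ.NonZero n}} (Tⁿ≈ε : T ^ℕ n ≈ ε) →
                 VerticesIso (translation singletons) (quotientVertices M T n Tⁿ≈ε) (quotientVertices N T n Tⁿ≈ε)
  vertices-iso T n Tⁿ≈ε = record
    { vertices  = translation (cosets T n Tⁿ≈ε)
    ; incidence = λ X → Setoid.refl (⟨ N ⟩＼ cosets T n Tⁿ≈ε) {g ∙ X}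
    ; rotation  = λ X → 0ℤ , PSL.trans (identityˡ (g ∙ (X ∙ T))) (PSL.sym (assoc g X T))
    }

  graph-iso : ⟨ M ⟩＼𝓕 ≅ᴿ ⟨ N ⟩＼𝓕
  graph-iso = record
    { edges = translation singletons
    ; ⊗-iso = vertices-iso S 2 S²≈ε
    ; •-iso = vertices-iso R 3 R³≈ε
    }

-- The translation g taking one base edge to the other conjugates the generators, so it carries the
-- first line to a line of the second generator. By `line-unique` this is the second spine up to a
-- shift, which is what `Carries` allows.
element-injective : ∀ {Γ Δ} → proj₁ (element Γ) ≈ proj₁ (element Δ) → Γ ≅ Δ
element-injective {Γ} {Δ} e = record
  { graph-iso  = ToIso.graph-iso {Γ.M} {Δ.M} {g} to-power from-power
  ; base-edge  = 0ℤ , PSL.trans (identityˡ (g ∙ Γ.base)) (//-rightDividesˡ Γ.base Δ.base)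
  ; spine-walk = proj₁ unique , λ i →
        (0ℤ , PSL.trans (identityˡ _) (proj₂ unique i))
      , (0ℤ , PSL.trans (identityˡ _) (begin
          g ∙ Walk.after Γ.walk i                          ≈⟨ ∙-congˡ (after≈before∙S Γ.nonBacktracking i) ⟩
          g ∙ (edge Γ.line i ∙ S)                          ≈⟨ assoc g (edge Γ.line i) S ⟨
          (g ∙ edge Γ.line i) ∙ S                          ≈⟨ ∙-congʳ (proj₂ unique i) ⟩
          edge Δ.line (i + proj₁ unique) ∙ S               ≈⟨ after≈before∙S Δ.nonBacktracking (i + proj₁ unique) ⟨
          Walk.after Δ.walk (i + proj₁ unique)             ∎))
  }
  where
  open ≈-Reasoning
  module Γ = Oriented Γ
  module Δ = Oriented Δ
  g = Δ.base ∙ Γ.base ⁻¹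
  g∙m≈n∙g : g ∙ Γ.generator ≈ Δ.generator ∙ g
  g∙m≈n∙g = conj≈⇒intertwines e
  g⁻¹∙n≈m∙g⁻¹ : g ⁻¹ ∙ Δ.generator ≈ Γ.generator ∙ g ⁻¹
  g⁻¹∙n≈m∙g⁻¹ = ∙-cancelˡ g _ _ (begin
    g ∙ (g ⁻¹ ∙ Δ.generator)      ≈⟨ \\-leftDividesˡ g Δ.generator ⟩
    Δ.generator                   ≈⟨ //-rightDividesʳ g Δ.generator ⟨
    (Δ.generator ∙ g) ∙ g ⁻¹      ≈⟨ ∙-congʳ g∙m≈n∙g ⟨
    (g ∙ Γ.generator) ∙ g ⁻¹      ≈⟨ assoc g Γ.generator (g ⁻¹) ⟩
    g ∙ (Γ.generator ∙ g ⁻¹)      ∎)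
  via : ∀ {h M N ℓ ℓ′} → h ∙ towards M ℓ ≈ towards N ℓ′ ∙ h → ∀ k → ∃[ l ] h ∙ M ^ k ≈ N ^ l ∙ h
  via {h} {M} {N} {ℓ} {ℓ′} f k with power-of-towards M ℓ k
  ... | l , x with towards-power N ℓ′ l
  ... | l′ , y = l′ , PSL.trans (∙-congˡ x) (PSL.trans (intertwine-^ f l) (∙-congʳ y))
  to-power : ∀ k → ∃[ l ] g ∙ Γ.M ^ k ≈ Δ.M ^ l ∙ g
  to-power = via {ℓ = Γ.ℓ} {ℓ′ = Δ.ℓ} g∙m≈n∙g
  from-power : ∀ k → ∃[ l ] g ⁻¹ ∙ Δ.M ^ k ≈ Γ.M ^ l ∙ g ⁻¹
  from-power = via {ℓ = Δ.ℓ} {ℓ′ = Γ.ℓ} g⁻¹∙n≈m∙g⁻¹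
  unique : ∃[ j ] ∀ i → g ∙ edge Γ.line i ≈ edge Δ.line (i + j)
  unique = line-unique (transport-line g∙m≈n∙g Γ.line) Δ.line

çarkOf : HyperbolicElement → OrientedÇark
çarkOf (M , h) = record { M = M ; hyperbolic = h ; base = ε ; axis = line⇒axis (axis-line M h) }

element-çarkOf : ∀ M → proj₁ (element (çarkOf M)) ≈ proj₁ M
element-çarkOf (M , _) = conj-ε M

çark : Inverse hyperbolicElements orientedÇarks
çark = record
  { to        = çarkOf
  ; from      = element
  ; to-cong   = λ {M} {N} e → element-injective {çarkOf M} {çarkOf N}
                  (PSL.trans (element-çarkOf M) (PSL.trans e (PSL.sym (element-çarkOf N))))
  ; from-cong = λ {Γ} {Δ} → element-cong {Γ} {Δ}
  ; inverse   = (λ {Γ} {M} e → element-injective {çarkOf M} {Γ} (PSL.trans (element-çarkOf M) e))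
              , (λ {M} {Γ} e → PSL.trans (element-cong {Γ} {çarkOf M} e) (element-çarkOf M))
  }

çarkOf-IsÇarkOf : ∀ M → çarkOf M IsÇarkOf M
çarkOf-IsÇarkOf (M , h) = witness (line⇒axis (axis-line M h)) (ℤ.+<+ ℕ.z<s)
  where
  witness : (axis : OrientedAxis M) → 0ℤ ℤ.< OrientedAxis.length axis →
            record { M = M ; hyperbolic = h ; base = ε ; axis = axis } IsÇarkOf (M , h)
  witness axis 0<ℓ = axis , 0<ℓ , Setoid.refl orientedÇarks
    {record { M = M ; hyperbolic = h ; base = ε ; axis = axis }}

-- The form of a hyperbolic element

exact-division : ∀ k d .{{_ : ℤ.NonZero (+ d)}} → (k * + d) ℤ./ + d ≡ k
exact-division k d@(suc _) = trans (ℤ.div-pos-is-/ℕ (k * + d) d)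
  (trans (cong (ℤ._/ℕ d) (sym (ℤ.+-identityˡ (k * + d)))) (proj₂ (division-unique d 0 k ℕ.z<s)))

∣-exact-division : ∀ x d .{{_ : ℤ.NonZero (+ d)}} → d ℕ.∣ ∣ x ∣ → (x ℤ./ + d) * + d ≡ x
∣-exact-division x d d∣x with ℤ.∣ᵤ⇒∣ {+ d} {x} d∣x
... | ℤ.divides k refl = cong (_* + d) (exact-division k d)

infix 4 _IsFormOf_
-- Multiplying by the content replaces the divisions in `form` by ring equations; these determine
-- the form because the content is nonzero.
record _IsFormOf_ (f : Form) (M : SL₂ℤ) : Set where
  open SL₂ℤ M
  open Form f
  field
    scaled-A : A * content M ≡ sgn (trace M) * r
    scaled-B : B * content M ≡ sgn (trace M) * (s - p)
    scaled-C : C * content M ≡ sgn (trace M) * - q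

-- `content` takes the entries in the order q, s - p, r, whereas `Primitive` meets them as r, s - p,
-- - q.
gcd-swap : ∀ i j k → ℕ.gcd i (ℕ.gcd j k) ≡ ℕ.gcd k (ℕ.gcd j i)
gcd-swap i j k = trans (sym (ℕ.gcd-assoc i j k)) (trans (ℕ.gcd-comm (ℕ.gcd i j) k) (cong (ℕ.gcd k) (ℕ.gcd-comm i j)))

form-isFormOf : ∀ M h → form (M , h) IsFormOf M
form-isFormOf M@(⟦ p , q , r , s ⟧ ,det=1: _) h = record
  { scaled-A = exact r (ℕ.∣-trans (ℕ.gcd[m,n]∣n ∣ q ∣ _) (ℕ.gcd[m,n]∣n ∣ s - p ∣ ∣ r ∣))
  ; scaled-B = exact (s - p) (ℕ.∣-trans (ℕ.gcd[m,n]∣n ∣ q ∣ _) (ℕ.gcd[m,n]∣m ∣ s - p ∣ ∣ r ∣))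
  ; scaled-C = exact (- q) (subst (c ℕ.∣_) (sym (ℤ.∣-i∣≡∣i∣ q)) (ℕ.gcd[m,n]∣m ∣ q ∣ _))
  }
  where
  c : ℕ
  c = ∣ content M ∣
  instance
    c≢0 : ℤ.NonZero (content M)
    c≢0 = ℤ.≢-nonZero (content≢0 M h)
  exact : ∀ x → c ℕ.∣ ∣ x ∣ → ((sgn (trace M) * x) ℤ./ content M) * content M ≡ sgn (trace M) * x
  exact x d = ∣-exact-division (sgn (trace M) * x) c
    (subst (c ℕ.∣_) (sym (ℤ.abs-* (sgn (trace M)) x)) (ℕ.∣n⇒∣m*n ∣ sgn (trace M) ∣ d))

isFormOf-unique : ∀ {M f g} → Hyperbolic M → f IsFormOf M → g IsFormOf M → f ≡ g
isFormOf-unique {M} h φ ψ =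
  form-≡ (cancel (scaled-A φ) (scaled-A ψ)) (cancel (scaled-B φ) (scaled-B ψ)) (cancel (scaled-C φ) (scaled-C ψ))
  where
  open _IsFormOf_
  cancel : ∀ {x y z} → x * content M ≡ z → y * content M ≡ z → x ≡ y
  cancel {x} {y} e f = ℤ.*-cancelʳ-≡ x y (content M) {{ℤ.≢-nonZero (content≢0 M h)}} (trans e (sym f))

sgn-neg : ∀ i → sgn (- i) ≡ - sgn i
sgn-neg +0       = refl
sgn-neg +[1+ _ ] = refl
sgn-neg -[1+ _ ] = refl

isFormOf-cong : ∀ {M N f} → M ≈ N → f IsFormOf M → f IsFormOf N
isFormOf-cong {⟦ _ , _ , _ , _ ⟧ ,det=1: _} {⟦ _ , _ , _ , _ ⟧ ,det=1: _} (same refl) φ =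
  record { scaled-A = scaled-A ; scaled-B = scaled-B ; scaled-C = scaled-C }
  where open _IsFormOf_ φ
isFormOf-cong {M@(⟦ _ , _ , _ , _ ⟧ ,det=1: _)} {N@(⟦ p , q , r , s ⟧ ,det=1: _)} {⟨ A , B , C ⟩} (opposite refl) φ = record
  { scaled-A = flip A (- r) r scaled-A (e₁ (sgn (p + s)) r)
  ; scaled-B = flip B (- s - - p) (s - p) scaled-B (e₂ (sgn (p + s)) s p)
  ; scaled-C = flip C (- - q) (- q) scaled-C (e₁ (sgn (p + s)) (- q))
  }
  where
  open _IsFormOf_ φ
  neg-difference : ∀ s p → - s - - p ≡ - (s - p)
  neg-difference = solve-∀
  e₁ : ∀ t x → - t * - x ≡ t * x
  e₁ = solve-∀
  e₂ : ∀ t s p → - t * (- s - - p) ≡ t * (s - p)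
  e₂ = solve-∀
  content≡ : content M ≡ content N
  content≡ = cong +_ (cong₂ ℕ.gcd (ℤ.∣-i∣≡∣i∣ q) (cong₂ ℕ.gcd
    (trans (cong ∣_∣ (neg-difference s p)) (ℤ.∣-i∣≡∣i∣ (s - p))) (ℤ.∣-i∣≡∣i∣ r)))
  sgn≡ : sgn (- p + - s) ≡ - sgn (p + s)
  sgn≡ = trans (cong sgn (sym (ℤ.neg-distrib-+ p s))) (sgn-neg (p + s))
  flip : ∀ X x y → X * content M ≡ sgn (- p + - s) * x → - sgn (p + s) * x ≡ sgn (p + s) * y → X * content N ≡ sgn (p + s) * y
  flip X x y e f = trans (cong (X *_) (sym content≡)) (trans e (trans (cong (_* x) sgn≡) f))

form-cong : ∀ {M N} → proj₁ M ≈ proj₁ N → form M ≡ form N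
form-cong {M , h} {N , h′} e = isFormOf-unique h′ (isFormOf-cong e (form-isFormOf M h)) (form-isFormOf N h′)

sgn² : ∀ i → 2 ℕ.< ∣ i ∣ → sgn i * sgn i ≡ 1ℤ
sgn² +0       ()
sgn² +[1+ _ ] _ = refl
sgn² -[1+ _ ] _ = refl

square-abs : ∀ i → + (∣ i ∣ ℕ.* ∣ i ∣) ≡ i * i
square-abs (+ n)    = ℤ.pos-* n n
square-abs -[1+ n ] = refl

-- This is t² - Δ c² = 4 for the trace t and the content c: determinant 1 turns (s - p)² + 4 q r
-- into (p + s)² - 4.
discriminant-scaled : ∀ {M f} → Hyperbolic M → f IsFormOf M →
                      discriminant f * (content M * content M) + + 4 ≡ trace M * trace M
discriminant-scaled {M@(⟦ p , q , r , s ⟧ ,det=1: d)} {⟨ A , B , C ⟩} h φ = begin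
  (B * B - + 4 * A * C) * (c * c) + + 4                         ≡⟨ cong (_+ + 4) (e₁ A B C c) ⟩
  (B * c) * (B * c) - + 4 * (A * c) * (C * c) + + 4
    ≡⟨ cong (_+ + 4) (cong₂ _-_ (cong₂ _*_ scaled-B scaled-B) (cong₂ (λ x y → + 4 * x * y) scaled-A scaled-C)) ⟩
  (σ * (s - p)) * (σ * (s - p)) - + 4 * (σ * r) * (σ * - q) + + 4 ≡⟨ cong (_+ + 4) (e₂ σ p q r s) ⟩
  (σ * σ) * ((s - p) * (s - p) + + 4 * (q * r)) + + 4
    ≡⟨ cong (λ z → z * ((s - p) * (s - p) + + 4 * (q * r)) + + 4) (sgn² (p + s) h) ⟩
  1ℤ * ((s - p) * (s - p) + + 4 * (q * r)) + + 4 * 1ℤ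
    ≡⟨ cong (λ z → 1ℤ * ((s - p) * (s - p) + + 4 * (q * r)) + + 4 * z) d ⟨
  1ℤ * ((s - p) * (s - p) + + 4 * (q * r)) + + 4 * (p * s - q * r) ≡⟨ e₃ p q r s ⟩
  (p + s) * (p + s)                                             ∎
  where
  open ≡-Reasoning
  open _IsFormOf_ φ
  c = content M
  σ = sgn (p + s)
  e₁ : ∀ A B C c → (B * B - + 4 * A * C) * (c * c) ≡ (B * c) * (B * c) - + 4 * (A * c) * (C * c)
  e₁ = solve-∀
  e₂ : ∀ σ p q r s → (σ * (s - p)) * (σ * (s - p)) - + 4 * (σ * r) * (σ * - q) ≡ (σ * σ) * ((s - p) * (s - p) + + 4 * (q * r))
  e₂ = solve-∀
  e₃ : ∀ p q r s → 1ℤ * ((s - p) * (s - p) + + 4 * (q * r)) + + 4 * (p * s - q * r) ≡ (p + s) * (p + s)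
  e₃ = solve-∀

-- For t = m + 1 the difference of squares is odd, for t = m + 2 it is 4 only when m = 0 and t = 2,
-- and for t ≥ m + 3 it exceeds 4.
no-squares-4-apart : ∀ m t → 2 ℕ.< t → ¬ (m ℕ.* m ℕ.+ 4 ≡ t ℕ.* t)
no-squares-4-apart m t 2<t e with ℕ.m≤n⇒∃[o]m+o≡n m<t
  where
  m<t : suc m ℕ.≤ t
  m<t with m ℕ.<? t
  ... | yes m<t = m<t
  ... | no m≮t  = contradiction (ℕ.*-mono-≤ (ℕ.≮⇒≥ m≮t) (ℕ.≮⇒≥ m≮t))
                    (ℕ.<⇒≱ (subst (m ℕ.* m ℕ.<_) e (ℕ.m<m+n (m ℕ.* m) ℕ.z<s)))
... | zero        , refl = odd m (ℕ.+-cancelˡ-≡ (m ℕ.* m) 4 _ (trans e (f m)))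
  where
  f : ∀ m → (suc m ℕ.+ 0) ℕ.* (suc m ℕ.+ 0) ≡ m ℕ.* m ℕ.+ (m ℕ.+ m ℕ.+ 1)
  f = ℕ.solve-∀
  odd : ∀ m → ¬ (4 ≡ m ℕ.+ m ℕ.+ 1)
  odd zero ()
  odd (suc zero) ()
  odd (suc (suc m)) e = contradiction (trans e (g m)) λ ()
    where
    g : ∀ m → suc (suc m) ℕ.+ suc (suc m) ℕ.+ 1 ≡ 5 ℕ.+ (m ℕ.+ m)
    g = ℕ.solve-∀
... | suc zero    , refl = zero-gap m 2<t (ℕ.+-cancelˡ-≡ (m ℕ.* m ℕ.+ 4) 0 _ (trans (ℕ.+-identityʳ _) (trans e (f m))))
  where
  f : ∀ m → (suc m ℕ.+ 1) ℕ.* (suc m ℕ.+ 1) ≡ m ℕ.* m ℕ.+ 4 ℕ.+ (4 ℕ.* m)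
  f = ℕ.solve-∀
  zero-gap : ∀ m → 2 ℕ.< suc m ℕ.+ 1 → ¬ (0 ≡ 4 ℕ.* m)
  zero-gap zero (ℕ.s≤s (ℕ.s≤s ()))
  zero-gap (suc m) _ ()
... | suc (suc k) , refl = contradiction (ℕ.+-cancelˡ-≡ (m ℕ.* m ℕ.+ 4) 0 _ (trans (ℕ.+-identityʳ _) (trans e (f m k)))) λ ()
  where
  f : ∀ m k → (suc m ℕ.+ suc (suc k)) ℕ.* (suc m ℕ.+ suc (suc k))
              ≡ m ℕ.* m ℕ.+ 4 ℕ.+ suc (4 ℕ.+ 6 ℕ.* m ℕ.+ 6 ℕ.* k ℕ.+ 2 ℕ.* m ℕ.* k ℕ.+ k ℕ.* k)
  f = ℕ.solve-∀

isFormOf-admissible : ∀ {M f} → Hyperbolic M → f IsFormOf M → Primitive f × Indefinite f × ¬ IsSquare (discriminant f)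
isFormOf-admissible {M@(⟦ p , q , r , s ⟧ ,det=1: _)} {f@(⟨ A , B , C ⟩)} h φ = isPrimitive , isIndefinite , isNonsquare
  where
  open _IsFormOf_ φ
  t = p + s
  c = ∣ content M ∣
  instance
    c≢0 : ℕ.NonZero c
    c≢0 = ℤ.≢-nonZero (content≢0 M h)

  ∣σ*∣ : ∀ x → ∣ sgn t * x ∣ ≡ ∣ x ∣
  ∣σ*∣ x = trans (ℤ.abs-* (sgn t) x) (trans (cong (ℕ._* ∣ x ∣) (∣sgn∣ t h)) (ℕ.*-identityˡ ∣ x ∣))
    where
    ∣sgn∣ : ∀ t → 2 ℕ.< ∣ t ∣ → ∣ sgn t ∣ ≡ 1
    ∣sgn∣ +0       ()
    ∣sgn∣ +[1+ _ ] _ = refl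
    ∣sgn∣ -[1+ _ ] _ = refl

  unscale : ∀ X x → X * content M ≡ sgn t * x → c ℕ.* ∣ X ∣ ≡ ∣ x ∣
  unscale X x e = trans (ℕ.*-comm c ∣ X ∣) (trans (sym (ℤ.abs-* X (content M))) (trans (cong ∣_∣ e) (∣σ*∣ x)))

  isPrimitive : Primitive f
  isPrimitive = cong +_ (ℕ.*-cancelˡ-≡ (ℕ.gcd a (ℕ.gcd b b′)) 1 c (begin
    c ℕ.* ℕ.gcd a (ℕ.gcd b b′)                     ≡⟨ ℕ.c*gcd[m,n]≡gcd[cm,cn] c a (ℕ.gcd b b′) ⟩
    ℕ.gcd (c ℕ.* a) (c ℕ.* ℕ.gcd b b′)             ≡⟨ cong (ℕ.gcd (c ℕ.* a)) (ℕ.c*gcd[m,n]≡gcd[cm,cn] c b b′) ⟩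
    ℕ.gcd (c ℕ.* a) (ℕ.gcd (c ℕ.* b) (c ℕ.* b′))   ≡⟨ cong₂ ℕ.gcd (unscale A r scaled-A)
                                                        (cong₂ ℕ.gcd (unscale B (s - p) scaled-B)
                                                          (trans (unscale C (- q) scaled-C) (ℤ.∣-i∣≡∣i∣ q))) ⟩
    ℕ.gcd ∣ r ∣ (ℕ.gcd ∣ s - p ∣ ∣ q ∣)            ≡⟨ gcd-swap (∣ r ∣) (∣ s - p ∣) (∣ q ∣) ⟩
    c                                              ≡⟨ ℕ.*-identityʳ c ⟨
    c ℕ.* 1                                        ∎))
    where
    open ≡-Reasoning
    a = ∣ A ∣
    b = ∣ B ∣
    b′ = ∣ C ∣

  t² : discriminant f * + (c ℕ.* c) + + 4 ≡ + (∣ t ∣ ℕ.* ∣ t ∣)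
  t² = trans (cong (λ z → discriminant f * z + + 4) (ℤ.pos-* c c)) (trans (discriminant-scaled h φ) (sym (square-abs t)))

  isIndefinite : Indefinite f
  isIndefinite with 0ℤ ℤ.<? discriminant f
  ... | yes 0<Δ = 0<Δ
  ... | no 0≮Δ  = contradiction (ℕ.*-mono-≤ h h) (ℕ.<⇒≱ (ℕ.s≤s (ℕ.≤-trans (ℤ.drop‿+≤+ t²≤4) (ℕ.m≤m+n 4 4))))
    where
    open ℤ.≤-Reasoning
    t²≤4 : + (∣ t ∣ ℕ.* ∣ t ∣) ℤ.≤ + 4
    t²≤4 = begin
      + (∣ t ∣ ℕ.* ∣ t ∣)                ≡⟨ t² ⟨
      discriminant f * + (c ℕ.* c) + + 4 ≤⟨ ℤ.+-monoˡ-≤ (+ 4) (ℤ.*-monoʳ-≤-nonNeg (+ (c ℕ.* c)) (ℤ.≮⇒≥ 0≮Δ)) ⟩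
      0ℤ * + (c ℕ.* c) + + 4             ≡⟨⟩
      + 4                                ∎

  isNonsquare : ¬ IsSquare (discriminant f)
  isNonsquare (m , e) = no-squares-4-apart (∣ m ∣ ℕ.* c) ∣ t ∣ h (ℤ.+-injective (begin
    + (∣ m ∣ ℕ.* c ℕ.* (∣ m ∣ ℕ.* c)) + + 4     ≡⟨ cong (λ n → + n + + 4) (ℕ.[m*n]*[o*p]≡[m*o]*[n*p] (∣ m ∣) c (∣ m ∣) c) ⟩
    + (∣ m ∣ ℕ.* ∣ m ∣ ℕ.* (c ℕ.* c)) + + 4     ≡⟨ cong (_+ + 4) (ℤ.pos-* (∣ m ∣ ℕ.* ∣ m ∣) (c ℕ.* c)) ⟩
    + (∣ m ∣ ℕ.* ∣ m ∣) * + (c ℕ.* c) + + 4     ≡⟨ cong (λ n → n * + (c ℕ.* c) + + 4) (trans (square-abs m) (sym e)) ⟩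
    discriminant f * + (c ℕ.* c) + + 4          ≡⟨ t² ⟩
    + (∣ t ∣ ℕ.* ∣ t ∣)                         ∎))
    where open ≡-Reasoning

-- Pell's equation

-- Conway's river: f takes values of opposite signs on the two basis vectors, and
-- the next basis is chosen among (e₁ , e₁ + e₂) and (e₁ + e₂ , e₂) accordingly.
Crossing : Form → Set
Crossing ⟨ A , B , C ⟩ = 0ℤ ℤ.< A × C ℤ.< 0ℤ

upper lower : Form → Form
upper ⟨ A , B , C ⟩ = ⟨ A , B + + 2 * A , A + B + C ⟩
lower ⟨ A , B , C ⟩ = ⟨ A + B + C , B + + 2 * C , C ⟩

middle : Form → ℤ
middle ⟨ A , B , C ⟩ = A + B + C

downstream-by : ℤ → Form → Form
downstream-by +0       = upper
downstream-by +[1+ _ ] = lower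
downstream-by -[1+ _ ] = upper

downstream : Form → Form
downstream f = downstream-by (middle f) f

discriminant-upper : ∀ f → discriminant (upper f) ≡ discriminant f
discriminant-upper ⟨ A , B , C ⟩ = e A B C
  where
  e : ∀ A B C → (B + + 2 * A) * (B + + 2 * A) - + 4 * A * (A + B + C) ≡ B * B - + 4 * A * C
  e = solve-∀

discriminant-lower : ∀ f → discriminant (lower f) ≡ discriminant f
discriminant-lower ⟨ A , B , C ⟩ = e A B C
  where
  e : ∀ A B C → (B + + 2 * C) * (B + + 2 * C) - + 4 * (A + B + C) * C ≡ B * B - + 4 * A * C
  e = solve-∀

discriminant-downstream : ∀ f → discriminant (downstream f) ≡ discriminant f
discriminant-downstream f with middle f
... | +0       = discriminant-upper f
... | +[1+ _ ] = discriminant-lower f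
... | -[1+ _ ] = discriminant-upper f

-- If A + B + C = 0, the discriminant is (A - C)².
middle≢0 : ∀ f → ¬ IsSquare (discriminant f) → middle f ≢ 0ℤ
middle≢0 ⟨ A , B , C ⟩ nonsquare δ≡0 = nonsquare (A - C , (begin
  B * B - + 4 * A * C                                ≡⟨ e A B C ⟩
  (A - C) * (A - C) + (A + B + C) * (B - A - C)      ≡⟨ cong (λ δ → (A - C) * (A - C) + δ * (B - A - C)) δ≡0 ⟩
  (A - C) * (A - C) + 0ℤ * (B - A - C)               ≡⟨ cong (λ z → (A - C) * (A - C) + z) (ℤ.*-zeroˡ (B - A - C)) ⟩
  (A - C) * (A - C) + 0ℤ                             ≡⟨ ℤ.+-identityʳ ((A - C) * (A - C)) ⟩
  (A - C) * (A - C)                                  ∎))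
  where
  open ≡-Reasoning
  e : ∀ A B C → B * B - + 4 * A * C ≡ (A - C) * (A - C) + (A + B + C) * (B - A - C)
  e = solve-∀

downstream-crossing : ∀ f → middle f ≢ 0ℤ → Crossing f → Crossing (downstream f)
downstream-crossing f δ≢0 (0<A , C<0) with middle f in eq
... | +0       = contradiction refl δ≢0
... | +[1+ _ ] = subst (0ℤ ℤ.<_) (sym eq) (ℤ.+<+ ℕ.z<s) , C<0
... | -[1+ _ ] = 0<A , subst (ℤ._< 0ℤ) (sym eq) ℤ.-<+

upper-injective : ∀ {f g} → upper f ≡ upper g → f ≡ g
upper-injective {⟨ A , B , C ⟩} {⟨ A′ , B′ , C′ ⟩} e = form-≡ A≡ B≡ C≡
  where
  A≡ : A ≡ A′
  A≡ = cong Form.A e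
  B≡ : B ≡ B′
  B≡ = trans (u A B) (trans (cong₂ (λ x y → x - + 2 * y) (cong Form.B e) A≡) (sym (u A′ B′)))
    where
    u : ∀ A B → B ≡ B + + 2 * A - + 2 * A
    u = solve-∀
  C≡ : C ≡ C′
  C≡ = +-cancelˡ (A + B) C C′ (trans (cong Form.C e) (cong (_+ C′) (sym (cong₂ _+_ A≡ B≡))))

lower-injective : ∀ {f g} → lower f ≡ lower g → f ≡ g
lower-injective {⟨ A , B , C ⟩} {⟨ A′ , B′ , C′ ⟩} e = form-≡ A≡ B≡ C≡
  where
  C≡ : C ≡ C′
  C≡ = cong Form.C e
  B≡ : B ≡ B′
  B≡ = trans (u C B) (trans (cong₂ (λ x y → x - + 2 * y) (cong Form.B e) C≡) (sym (u C′ B′)))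
    where
    u : ∀ A B → B ≡ B + + 2 * A - + 2 * A
    u = solve-∀
  A≡ : A ≡ A′
  A≡ = trans (u A B C) (trans (cong₂ _-_ (cong Form.A e) (cong₂ _+_ B≡ C≡)) (sym (u A′ B′ C′)))
    where
    u : ∀ A B C → A ≡ A + B + C - (B + C)
    u = solve-∀

-- Upstream, the value at e₁ - e₂ tells the two moves apart.
upper≢lower : ∀ {f g} → Crossing f → Crossing g → upper f ≢ lower g
upper≢lower {⟨ A , B , C ⟩} {⟨ A′ , B′ , C′ ⟩} (_ , C<0) (0<A′ , _) e = ℤ.<-asym C<0 (subst (0ℤ ℤ.<_) A′≡C 0<A′)
  where
  difference : Form → ℤ
  difference ⟨ A , B , C ⟩ = A - B + C
  u : ∀ A B C → A - (B + + 2 * A) + (A + B + C) ≡ C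
  u = solve-∀
  l : ∀ A B C → (A + B + C) - (B + + 2 * C) + C ≡ A
  l = solve-∀
  A′≡C : A′ ≡ C
  A′≡C = trans (sym (l A′ B′ C′)) (trans (cong difference (sym e)) (u A B C))

downstream-injective : ∀ {f g} → Crossing f → Crossing g → downstream f ≡ downstream g → f ≡ g
downstream-injective {f} {g} cf cg e with middle f | middle g
... | +0       | +0       = upper-injective e
... | +0       | -[1+ _ ] = upper-injective e
... | -[1+ _ ] | +0       = upper-injective e
... | -[1+ _ ] | -[1+ _ ] = upper-injective e
... | +[1+ _ ] | +[1+ _ ] = lower-injective e
... | +0       | +[1+ _ ] = contradiction e (upper≢lower cf cg)
... | -[1+ _ ] | +[1+ _ ] = contradiction e (upper≢lower cf cg)
... | +[1+ _ ] | +0       = contradiction (sym e) (upper≢lower cg cf)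
... | +[1+ _ ] | -[1+ _ ] = contradiction (sym e) (upper≢lower cg cf)

-- Finiteness of the crossing forms of given discriminant

Bounded : ℕ → Form → Set
Bounded N ⟨ A , B , C ⟩ = ∣ A ∣ ℕ.≤ N × ∣ B ∣ ℕ.≤ N × ∣ C ∣ ℕ.≤ N

-- When A and C have opposite signs the discriminant is B² + 4 |A| |C|, a sum without cancellation.
crossing-bounded : ∀ {N} f → Crossing f → discriminant f ≡ + N → Bounded N f
crossing-bounded {N} ⟨ A@(+[1+ a ]) , B , C@(-[1+ c ]) ⟩ (ℤ.+<+ _ , ℤ.-<+) e =
    ℕ.≤-trans (ℕ.m≤m*n (suc a) (suc c ℕ.* 4)) (ℕ.≤-trans (ℕ.≤-reflexive (g a c)) (ℕ.m+n≤o⇒n≤o (∣ B ∣ ℕ.* ∣ B ∣) (ℕ.≤-reflexive sum)))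
  , ℕ.≤-trans (m≤m*m ∣ B ∣) (ℕ.m+n≤o⇒m≤o (∣ B ∣ ℕ.* ∣ B ∣) (ℕ.≤-reflexive sum))
  , ℕ.≤-trans (ℕ.m≤m*n (suc c) (suc a ℕ.* 4)) (ℕ.≤-trans (ℕ.≤-reflexive (g′ a c)) (ℕ.m+n≤o⇒n≤o (∣ B ∣ ℕ.* ∣ B ∣) (ℕ.≤-reflexive sum)))
  where
  m≤m*m : ∀ m → m ℕ.≤ m ℕ.* m
  m≤m*m zero    = ℕ.z≤n
  m≤m*m (suc m) = ℕ.m≤m*n (suc m) (suc m)
  g : ∀ a c → suc a ℕ.* (suc c ℕ.* 4) ≡ 4 ℕ.* suc a ℕ.* suc c
  g = ℕ.solve-∀
  g′ : ∀ a c → suc c ℕ.* (suc a ℕ.* 4) ≡ 4 ℕ.* suc a ℕ.* suc c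
  g′ = ℕ.solve-∀
  sum : ∣ B ∣ ℕ.* ∣ B ∣ ℕ.+ 4 ℕ.* suc a ℕ.* suc c ≡ N
  sum = ℤ.+-injective (trans (cong (_+ + (4 ℕ.* suc a ℕ.* suc c)) (square-abs B)) e)

sign-bit : ℤ → Fin 2
sign-bit (+ _)    = zero
sign-bit -[1+ _ ] = suc zero

sign-bit-∣∣-injective : ∀ i j → sign-bit i ≡ sign-bit j → ∣ i ∣ ≡ ∣ j ∣ → i ≡ j
sign-bit-∣∣-injective (+ _)    (+ _)    _ refl = refl
sign-bit-∣∣-injective -[1+ _ ] -[1+ _ ] _ refl = refl

codeℤ : ∀ {N} i → ∣ i ∣ ℕ.≤ N → Fin (2 ℕ.* suc N)
codeℤ i b = Fin.combine (sign-bit i) (Fin.fromℕ< (ℕ.s≤s b))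

codeℤ-injective : ∀ {N} i j (b : ∣ i ∣ ℕ.≤ N) (b′ : ∣ j ∣ ℕ.≤ N) → codeℤ i b ≡ codeℤ j b′ → i ≡ j
codeℤ-injective i j b b′ e with Fin.combine-injective (sign-bit i) (Fin.fromℕ< (ℕ.s≤s b)) (sign-bit j) (Fin.fromℕ< (ℕ.s≤s b′)) e
... | e₁ , e₂ = sign-bit-∣∣-injective i j e₁ (Fin.fromℕ<-injective _ _ (ℕ.s≤s b) (ℕ.s≤s b′) e₂)

codes : ℕ → ℕ
codes N = 2 ℕ.* suc N ℕ.* (2 ℕ.* suc N ℕ.* (2 ℕ.* suc N))

code : ∀ {N} f → Bounded N f → Fin (codes N)
code ⟨ A , B , C ⟩ (a , b , c) = Fin.combine (codeℤ A a) (Fin.combine (codeℤ B b) (codeℤ C c))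

code-injective : ∀ {N} f g (b : Bounded N f) (b′ : Bounded N g) → code f b ≡ code g b′ → f ≡ g
code-injective ⟨ A , B , C ⟩ ⟨ A′ , B′ , C′ ⟩ (a , b , c) (a′ , b′ , c′) e
  with Fin.combine-injective (codeℤ A a) (Fin.combine (codeℤ B b) (codeℤ C c)) (codeℤ A′ a′) (Fin.combine (codeℤ B′ b′) (codeℤ C′ c′)) e
... | e₁ , e₂₃ with Fin.combine-injective (codeℤ B b) (codeℤ C c) (codeℤ B′ b′) (codeℤ C′ c′) e₂₃
... | e₂ , e₃ = form-≡ (codeℤ-injective A A′ a a′ e₁) (codeℤ-injective B B′ b b′ e₂) (codeℤ-injective C C′ c c′ e₃)

-- The discriminant of x² - D y² is 4 D. A square root of it would be even by parity, and its half a
-- square root of D.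
nonsquare-4* : ∀ D → (∀ m → m ℕ.* m ≢ D) → ¬ IsSquare (+ (4 ℕ.* D))
nonsquare-4* D nonsquare (m , e) = parity (∣ m ∣ ℕ.% 2) (ℕ.m%n<n ∣ m ∣ 2) (ℕ.m≡m%n+[m/n]*n ∣ m ∣ 2)
  where
  k = ∣ m ∣ ℕ./ 2
  4D≡m² : 4 ℕ.* D ≡ ∣ m ∣ ℕ.* ∣ m ∣
  4D≡m² = ℤ.+-injective (trans e (sym (square-abs m)))
  even : ∀ k → (k ℕ.* 2) ℕ.* (k ℕ.* 2) ≡ 4 ℕ.* (k ℕ.* k)
  even = ℕ.solve-∀
  odd : ∀ k → (1 ℕ.+ k ℕ.* 2) ℕ.* (1 ℕ.+ k ℕ.* 2) ≡ suc (2 ℕ.* (2 ℕ.* (k ℕ.* k) ℕ.+ 2 ℕ.* k))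
  odd = ℕ.solve-∀
  parity : ∀ r → r ℕ.< 2 → ¬ (∣ m ∣ ≡ r ℕ.+ k ℕ.* 2)
  parity zero _ f = nonsquare k (ℕ.*-cancelˡ-≡ (k ℕ.* k) D 4 (trans (sym (even k)) (trans (cong₂ ℕ._*_ (sym f) (sym f)) (sym 4D≡m²))))
  parity (suc zero) _ f = ℕ.even≢odd (2 ℕ.* D) (2 ℕ.* (k ℕ.* k) ℕ.+ 2 ℕ.* k)
    (trans (sym (ℕ.*-assoc 2 2 D)) (trans 4D≡m² (trans (cong₂ ℕ._*_ f f) (odd k))))
  parity (suc (suc _)) (ℕ.s≤s (ℕ.s≤s ())) _

-- Recurrence of the form x² - D y² along its river

module River (D : ℕ) (nonsquare : ∀ m → m ℕ.* m ≢ D) where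

  D>0 : 0 ℕ.< D
  D>0 = ℕ.n≢0⇒n>0 (λ D≡0 → nonsquare 0 (sym D≡0))

  reach : ℕ → Form
  reach zero    = ⟨ 1ℤ , 0ℤ , - + D ⟩
  reach (suc n) = downstream (reach n)

  discriminant-reach : ∀ n → discriminant (reach n) ≡ + (4 ℕ.* D)
  discriminant-reach zero    = trans (e (+ D)) (sym (ℤ.pos-* 4 D))
    where
    e : ∀ D → 0ℤ * 0ℤ - + 4 * 1ℤ * - D ≡ + 4 * D
    e = solve-∀
  discriminant-reach (suc n) = trans (discriminant-downstream (reach n)) (discriminant-reach n)

  middle-reach≢0 : ∀ n → middle (reach n) ≢ 0ℤ
  middle-reach≢0 n = middle≢0 (reach n) (subst (λ z → ¬ IsSquare z) (sym (discriminant-reach n)) (nonsquare-4* D nonsquare))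

  crossing-reach : ∀ n → Crossing (reach n)
  crossing-reach zero    = ℤ.+<+ ℕ.z<s , ℤ.neg-mono-< (ℤ.+<+ D>0)
  crossing-reach (suc n) = downstream-crossing (reach n) (middle-reach≢0 n) (crossing-reach n)

  -- f is x² - D y² in the basis (x , y), (u , v).
  record Basis (n : ℕ) (f : Form) : Set where
    field
      x y u v : ℕ
      x>0     : 0 ℕ.< x
      v>0     : 0 ℕ.< v
      grown   : n ℕ.≤ u ℕ.+ y
      values  : f ≡ ⟨ + x * + x - + D * (+ y * + y) , + 2 * (+ x * + u - + D * (+ y * + v)) , + u * + u - + D * (+ v * + v) ⟩

  middle-value : ∀ D x y u v → (x * x - D * (y * y)) + + 2 * (x * u - D * (y * v)) + (u * u - D * (v * v))
                 ≡ (x + u) * (x + u) - D * ((y + v) * (y + v))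
  middle-value = solve-∀

  upper-basis : ∀ {n f} → Basis n f → Basis (suc n) (upper f)
  upper-basis {n} record { x = x ; y = y ; u = u ; v = v ; x>0 = x>0 ; v>0 = v>0 ; grown = grown ; values = refl } = record
    { x = x ; y = y ; u = x ℕ.+ u ; v = y ℕ.+ v ; x>0 = x>0 ; v>0 = ℕ.≤-trans v>0 (ℕ.m≤n+m v y)
    ; grown = subst (suc n ℕ.≤_) (sym (ℕ.+-assoc x u y)) (ℕ.+-mono-≤ x>0 grown)
    ; values = form-≡ refl (e (+ D) (+ x) (+ y) (+ u) (+ v)) (middle-value (+ D) (+ x) (+ y) (+ u) (+ v))
    }
    where
    e : ∀ D x y u v → + 2 * (x * u - D * (y * v)) + + 2 * (x * x - D * (y * y)) ≡ + 2 * (x * (x + u) - D * (y * (y + v)))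
    e = solve-∀

  lower-basis : ∀ {n f} → Basis n f → Basis (suc n) (lower f)
  lower-basis {n} record { x = x ; y = y ; u = u ; v = v ; x>0 = x>0 ; v>0 = v>0 ; grown = grown ; values = refl } = record
    { x = x ℕ.+ u ; y = y ℕ.+ v ; u = u ; v = v ; x>0 = ℕ.≤-trans x>0 (ℕ.m≤m+n x u) ; v>0 = v>0
    ; grown = subst (ℕ._≤ u ℕ.+ (y ℕ.+ v)) (ℕ.+-comm n 1)
                (subst (n ℕ.+ 1 ℕ.≤_) (ℕ.+-assoc u y v) (ℕ.+-mono-≤ grown v>0))
    ; values = form-≡ (middle-value (+ D) (+ x) (+ y) (+ u) (+ v)) (e (+ D) (+ x) (+ y) (+ u) (+ v)) refl
    }
    where
    e : ∀ D x y u v → + 2 * (x * u - D * (y * v)) + + 2 * (u * u - D * (v * v)) ≡ + 2 * ((x + u) * u - D * ((y + v) * v))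
    e = solve-∀

  downstream-basis : ∀ {n f} → Basis n f → Basis (suc n) (downstream f)
  downstream-basis {f = f} b with middle f
  ... | +0       = upper-basis b
  ... | +[1+ _ ] = lower-basis b
  ... | -[1+ _ ] = upper-basis b

  basis : ∀ n → Basis n (reach n)
  basis (suc n) = downstream-basis (basis n)
  basis zero    = record { x = 1 ; y = 0 ; u = 0 ; v = 1 ; x>0 = ℕ.z<s ; v>0 = ℕ.z<s ; grown = ℕ.z≤n
                         ; values = form-≡ (e₁ (+ D)) (e₂ (+ D)) (e₃ (+ D)) }
    where
    e₁ : ∀ D → 1ℤ ≡ 1ℤ * 1ℤ - D * (0ℤ * 0ℤ)
    e₁ = solve-∀
    e₂ : ∀ D → 0ℤ ≡ + 2 * (1ℤ * 0ℤ - D * (0ℤ * 1ℤ))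
    e₂ = solve-∀
    e₃ : ∀ D → - D ≡ 0ℤ * 0ℤ - D * (1ℤ * 1ℤ)
    e₃ = solve-∀

  bounded : ∀ n → Bounded (4 ℕ.* D) (reach n)
  bounded n = crossing-bounded (reach n) (crossing-reach n) (discriminant-reach n)

  -- Stepping back turns a recurrence anywhere into a return to the initial form, whose leading
  -- coefficient 1 is the right-hand side of Pell's equation.
  rewind : ∀ i k → reach i ≡ reach (i ℕ.+ k) → reach 0 ≡ reach k
  rewind zero    k e = e
  rewind (suc i) k e = rewind i k (downstream-injective (crossing-reach i) (crossing-reach (i ℕ.+ k)) e)

  encode : ℕ → Fin (codes (4 ℕ.* D))
  encode n = code (reach n) (bounded n)

  encode-injective : ∀ m n → encode m ≡ encode n → reach m ≡ reach n
  encode-injective m n = code-injective (reach m) (reach n) (bounded m) (bounded n)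

  periodic : ∃[ n ] reach (suc n) ≡ reach 0
  periodic = from-collision (Fin.pigeonhole (ℕ.n<1+n (codes (4 ℕ.* D))) (λ i → encode (toℕ i)))
    where
    from-collision : ∃[ i ] ∃[ j ] toℕ i ℕ.< toℕ j × encode (toℕ i) ≡ encode (toℕ j) → ∃[ n ] reach (suc n) ≡ reach 0
    from-collision (i , j , i<j , e) =
      let n , i+n≡j = ℕ.m≤n⇒∃[o]m+o≡n i<j in
      n , sym (rewind (toℕ i) (suc n) (trans (encode-injective (toℕ i) (toℕ j) e)
                                             (cong reach (sym (trans (ℕ.+-suc (toℕ i) n) i+n≡j)))))

  pell : ∃[ x ] ∃[ y ] (0 ℕ.< y) × (+ x * + x - + D * (+ y * + y) ≡ 1ℤ)
  pell = from-period periodic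
    where
    z : ∀ D v x u → + 2 * (x * u - D * (0ℤ * v)) ≡ + 2 * (x * u)
    z = solve-∀
    from-basis : ∀ {n} → Basis (suc n) ⟨ 1ℤ , 0ℤ , - + D ⟩ → ∃[ x ] ∃[ y ] (0 ℕ.< y) × (+ x * + x - + D * (+ y * + y) ≡ 1ℤ)
    from-basis record { x = x ; y = suc y ; values = values } = x , suc y , ℕ.z<s , sym (cong Form.A values)
    -- If y = 0, then `grown` makes u positive, and the middle coefficient 2 x u of the recurred
    -- form could not be 0. So the solution found is not the trivial one.
    from-basis record { x = suc x ; y = zero ; u = suc u ; v = v ; values = values } =
      contradiction (trans (cong Form.B values) (z (+ D) (+ v) +[1+ x ] +[1+ u ])) λ ()
    from-period : ∃[ n ] reach (suc n) ≡ reach 0 → ∃[ x ] ∃[ y ] (0 ℕ.< y) × (+ x * + x - + D * (+ y * + y) ≡ 1ℤ)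
    from-period (n , e) = from-basis (subst (Basis (suc n)) e (basis (suc n)))

-- Automorphs of a form from solutions of Pell's equation

module Automorph (A B C : ℤ) (x y : ℕ) (y>0 : 0 ℕ.< y)
                 (pell : + x * + x - discriminant ⟨ A , B , C ⟩ * (+ y * + y) ≡ 1ℤ)
                 (Δ>0 : 0ℤ ℤ.< discriminant ⟨ A , B , C ⟩) (prim : Primitive ⟨ A , B , C ⟩) where

  κ : ℕ
  κ = 2 ℕ.* y

  -- The classical automorph with diagonal (t - B u) / 2, (t + B u) / 2 and off-diagonal entries - C
  -- u, A u, at t = 2 x and u = 2 y.
  automorph : SL₂ℤ
  automorph = ⟦ + x - B * + y , - (+ κ * C) , + κ * A , + x + B * + y ⟧
    ,det=1: trans (cong (λ k → (+ x - B * + y) * (+ x + B * + y) - - (k * C) * (k * A)) (ℤ.pos-* 2 y))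
                  (trans (e A B C (+ x) (+ y)) pell)
    where
    e : ∀ A B C x y → (x - B * y) * (x + B * y) - - (+ 2 * y * C) * (+ 2 * y * A) ≡ x * x - (B * B - + 4 * A * C) * (y * y)
    e = solve-∀

  trace≡ : trace automorph ≡ + (x ℕ.+ x)
  trace≡ = e (+ x) (B * + y)
    where
    e : ∀ x z → (x - z) + (x + z) ≡ x + x
    e = solve-∀

  1<x : 1 ℕ.< x
  1<x = large x pell
    where
    Δ = discriminant ⟨ A , B , C ⟩
    0<Δy² : 0ℤ ℤ.< Δ * (+ y * + y)
    0<Δy² = positive Δ y Δ>0 y>0
      where
      positive : ∀ Δ y → 0ℤ ℤ.< Δ → 0 ℕ.< y → 0ℤ ℤ.< Δ * (+ y * + y)
      positive +0       _       (ℤ.+<+ ()) _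
      positive +[1+ _ ] (suc _) _ _ = ℤ.+<+ ℕ.z<s
    move : ∀ X Z → X - Z ≡ 1ℤ → Z ≡ X - 1ℤ
    move X Z e = trans (f X Z) (cong (λ w → X - w) e)
      where
      f : ∀ X Z → Z ≡ X - (X - Z)
      f = solve-∀
    large : ∀ x → + x * + x - Δ * (+ y * + y) ≡ 1ℤ → 1 ℕ.< x
    large zero          e = case subst (0ℤ ℤ.<_) (move 0ℤ (Δ * (+ y * + y)) e) 0<Δy² of λ ()
    large (suc zero)    e = case subst (0ℤ ℤ.<_) (move 1ℤ (Δ * (+ y * + y)) e) 0<Δy² of λ { (ℤ.+<+ ()) }
    large (suc (suc _)) _ = ℕ.s≤s ℕ.z<s

  automorph-hyperbolic : Hyperbolic automorph
  automorph-hyperbolic = subst (λ t → 2 ℕ.< ∣ t ∣) (sym trace≡) (ℕ.+-mono-≤-< (ℕ.<⇒≤ 1<x) 1<x)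

  sgn≡1 : sgn (trace automorph) ≡ 1ℤ
  sgn≡1 = trans (cong sgn trace≡) (sgn-pos (x ℕ.+ x) (ℕ.≤-trans (ℕ.<⇒≤ 1<x) (ℕ.m≤m+n x x)))
    where
    sgn-pos : ∀ n → 0 ℕ.< n → sgn (+ n) ≡ 1ℤ
    sgn-pos (suc _) _ = refl

  s-p≡ : (+ x + B * + y) - (+ x - B * + y) ≡ + κ * B
  s-p≡ = trans (e B (+ x) (+ y)) (cong (_* B) (sym (ℤ.pos-* 2 y)))
    where
    e : ∀ B x y → (x + B * y) - (x - B * y) ≡ + 2 * y * B
    e = solve-∀

  -- The entries q, s - p and r are κ times - C, B and A, which have no common factor.
  content≡ : content automorph ≡ + κ
  content≡ = cong +_ (begin
    ℕ.gcd ∣ - (+ κ * C) ∣ (ℕ.gcd ∣ (+ x + B * + y) - (+ x - B * + y) ∣ ∣ + κ * A ∣)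
      ≡⟨ cong₂ ℕ.gcd (trans (ℤ.∣-i∣≡∣i∣ (+ κ * C)) (ℤ.abs-* (+ κ) C))
           (cong₂ ℕ.gcd (trans (cong ∣_∣ s-p≡) (ℤ.abs-* (+ κ) B)) (ℤ.abs-* (+ κ) A)) ⟩
    ℕ.gcd (κ ℕ.* c) (ℕ.gcd (κ ℕ.* b) (κ ℕ.* a))    ≡⟨ cong (ℕ.gcd (κ ℕ.* c)) (ℕ.c*gcd[m,n]≡gcd[cm,cn] κ b a) ⟨
    ℕ.gcd (κ ℕ.* c) (κ ℕ.* ℕ.gcd b a)              ≡⟨ ℕ.c*gcd[m,n]≡gcd[cm,cn] κ c (ℕ.gcd b a) ⟨
    κ ℕ.* ℕ.gcd c (ℕ.gcd b a)                      ≡⟨ cong (κ ℕ.*_) (trans (gcd-swap c b a) (ℤ.+-injective prim)) ⟩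
    κ ℕ.* 1                                        ≡⟨ ℕ.*-identityʳ κ ⟩
    κ                                              ∎)
    where
    open ≡-Reasoning
    a = ∣ A ∣
    b = ∣ B ∣
    c = ∣ C ∣

  automorph-form : ⟨ A , B , C ⟩ IsFormOf automorph
  automorph-form = record
    { scaled-A = scaled A (+ κ * A) (e A (+ κ))
    ; scaled-B = scaled B ((+ x + B * + y) - (+ x - B * + y)) (trans (e B (+ κ)) (cong (1ℤ *_) (sym s-p≡)))
    ; scaled-C = scaled C (- - (+ κ * C)) (trans (e C (+ κ)) (cong (1ℤ *_) (sym (ℤ.neg-involutive (+ κ * C)))))
    }
    where
    e : ∀ X k → X * k ≡ 1ℤ * (k * X)
    e = solve-∀
    scaled : ∀ X z → X * + κ ≡ 1ℤ * z → X * content automorph ≡ sgn (trace automorph) * z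
    scaled X z f = trans (cong (X *_) content≡) (trans f (cong (_* z) (sym sgn≡1)))

form-surjective : ∀ f → Primitive f → Indefinite f → ¬ IsSquare (discriminant f) → ∃[ M ] form M ≡ f
form-surjective f@(⟨ A , B , C ⟩) prim Δ>0 nonsquare = from-pell (River.pell D nonsquare′)
  where
  D = ∣ discriminant f ∣
  D≡Δ : + D ≡ discriminant f
  D≡Δ = ℤ.0≤i⇒+∣i∣≡i (ℤ.<⇒≤ Δ>0)
  nonsquare′ : ∀ m → m ℕ.* m ≢ D
  nonsquare′ m e = nonsquare (+ m , trans (sym D≡Δ) (trans (cong +_ (sym e)) (ℤ.pos-* m m)))
  from-pell : ∃[ x ] ∃[ y ] (0 ℕ.< y) × (+ x * + x - + D * (+ y * + y) ≡ 1ℤ) → ∃[ M ] form M ≡ f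
  from-pell (x , y , y>0 , e) = (automorph , automorph-hyperbolic) ,
    isFormOf-unique automorph-hyperbolic (form-isFormOf automorph automorph-hyperbolic) automorph-form
    where open Automorph A B C x y y>0 (trans (cong (λ d → + x * + x - d * (+ y * + y)) (sym D≡Δ)) e) Δ>0 prim

-- The surjection from çarks to forms

çarkForm : Surjection orientedÇarks admissibleForms
çarkForm = record
  { to         = λ Γ → form (element Γ) ,
                       isFormOf-admissible (proj₂ (element Γ)) (form-isFormOf (proj₁ (element Γ)) (proj₂ (element Γ)))
  ; cong       = λ {Γ} {Δ} e → form-cong {element Γ} {element Δ} (element-cong {Γ} {Δ} e)
  ; surjective = λ (f , prim , Δ>0 , nonsquare) → preimage f (form-surjective f prim Δ>0 nonsquare)
  }
  where
  preimage : ∀ f → ∃[ M ] form M ≡ f → ∃[ Γ ] ∀ {Δ} → Δ ≅ Γ → form (element Δ) ≡ f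
  preimage f (M , e) = çarkOf M , λ {Δ} i → trans
    (form-cong {element Δ} {M} (PSL.trans (element-cong {Δ} {çarkOf M} i) (element-çarkOf M))) e

corollary4p1 : Σ[ çark ∈ Inverse hyperbolicElements orientedÇarks ]
    (∀ M → Inverse.to çark M IsÇarkOf M) ×
    (Σ[ Φ ∈ Surjection orientedÇarks admissibleForms ]
    (∀ Γ → proj₁ (Surjection.to Φ Γ) ≡ form (Inverse.from çark Γ)))
corollary4p1 = çark , çarkOf-IsÇarkOf , çarkForm , λ _ → refl
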